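{- Let $G$ be a simple connected graph of order $n\geq 6$ with minimum degree $\delta(G)=2$. If $$|E(G)|\geq \binom{n-5}{2}+7,$$ then $pc(G)\leq 2$, unless $G$ is isomorphic to $G_1$ or to $G_n$. Here $G_1=K_1\vee 3K_2$, and $G_n$ is the graph of order $n$ obtained from the disjoint union of a complete graph $K_{n-5}$ and the graph $K_1\vee (2K_2)$ by adding an edge joining an arbitrary vertex of $K_{n-5}$ to the vertex of degree $4$ of $K_1\vee(2K_2)$.
   Context: All graphs are simple, finite and undirected. The order of a graph is its number of vertices. $K_r$ is the complete graph on $r$ vertices, $rK_2$ is the disjoint union of $r$ copies of $K_2$, and $G\vee H$ denotes the join of $G$ and $H$, i.e. the disjoint union of $G$ and $H$ together with all edges between a vertex of $G$ and a vertex of $H$. An edge-coloured graph is one in which each edge is assigned a colour (adjacent edges may receive the same colour). A path in an edge-coloured graph is a proper path if no two adjacent edges of the path have the same colour. An edge-coloured graph $G$ is properly connected if every pair of distinct vertices of $G$ is connected by a proper path. For a connected graph $G$, the proper connection number $pc(G)$ is the smallest number of colours needed to colour the edges of $G$ so that $G$ is properly connected. -}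

module Defs where

open import Data.Empty using (⊥)
open import Data.Fin using (Fin; zero; suc; _<_)
open import Data.Fin.Properties using (_≟_; _<?_)
open import Data.List using (List; []; _∷_; length; filter; allFin; cartesianProduct)
open import Data.List.Relation.Unary.Linked using (Linked)
open import Data.List.Relation.Unary.Unique.Propositional using (Unique)
open import Data.Nat as ℕ using (ℕ; _∸_)
open import Data.Product using (Σ-syntax; ∃-syntax; _×_; _,_; map)
open import Data.Sum using (_⊎_; inj₁; inj₂)
open import Data.Unit using (⊤; tt)
open import Function using (_∘_)
open import Function.Bundles using (_↔_; _⇔_; Inverse)
open import Relation.Binary using (Rel; Symmetric; Irreflexive; Decidable; DecidableEquality)
open import Relation.Binary.Construct.Closure.ReflexiveTransitive using (Star; ε; _◅_)
open import Relation.Binary.PropositionalEquality using (_≡_; _≢_; refl; sym)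
open import Relation.Nullary using (yes; no)
open import Relation.Nullary.Decidable using (¬?; _×-dec_)
open import Level using (0ℓ)

record SimpleGraph (V : Set) : Set₁ where
  infix 4 _~_ _~?_
  field
    _~_    : Rel V 0ℓ
    _~?_   : Decidable _~_
    ~-sym  : Symmetric _~_
    ~-irr  : Irreflexive _≡_ _~_

module _ {n : ℕ} (G : SimpleGraph (Fin n)) where
  open SimpleGraph G

  degree : Fin n → ℕ
  degree v = length (filter (v ~?_) (allFin n))

  HasMinDegree : ℕ → Set
  HasMinDegree d = (∀ v → d ℕ.≤ degree v) × (∃[ v ] degree v ≡ d)

  -- Each edge {u , v} is counted once, through its ordering u < v.
  edgeCount : ℕ
  edgeCount = length (filter (λ (u , v) → (u <? v) ×-dec (u ~? v))
                             (cartesianProduct (allFin n) (allFin n)))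

module _ {V : Set} (G : SimpleGraph V) where
  open SimpleGraph G

  Walk : V → V → Set
  Walk = Star _~_

  Connected : Set
  Connected = ∀ u v → Walk u v

  vertices : ∀ {u v} → Walk u v → List V
  vertices {u} ε       = u ∷ []
  vertices {u} (_ ◅ p) = u ∷ vertices p

  IsPath : ∀ {u v} → Walk u v → Set
  IsPath p = Unique (vertices p)

  -- Only edges carry a colour, so that an edgeless graph has a colouring with
  -- no colours.  `undirected` makes the colour depend on neither the
  -- orientation of the edge nor the proof of adjacency.
  record EdgeColouring (k : ℕ) : Set where
    field
      colour     : ∀ {u v} → u ~ v → Fin k
      undirected : ∀ {u v} (e : u ~ v) (e′ : v ~ u) → colour e ≡ colour e′

    colours : ∀ {u v} → Walk u v → List (Fin k)
    colours ε       = []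
    colours (e ◅ p) = colour e ∷ colours p

    -- On a path, two edges are adjacent exactly when they are consecutive.
    IsProperPath : ∀ {u v} → Walk u v → Set
    IsProperPath p = IsPath p × Linked _≢_ (colours p)

    ProperlyConnected : Set
    ProperlyConnected = ∀ u v → u ≢ v → Σ[ p ∈ Walk u v ] IsProperPath p

  ProperlyConnectableWith : ℕ → Set
  ProperlyConnectableWith k = Σ[ c ∈ EdgeColouring k ] EdgeColouring.ProperlyConnected c

  IsProperConnectionNumber : ℕ → Set
  IsProperConnectionNumber k =
    ProperlyConnectableWith k × (∀ j → ProperlyConnectableWith j → k ℕ.≤ j)

infix 4 _≅_
record _≅_ {V W : Set} (G : SimpleGraph V) (H : SimpleGraph W) : Set where
  private
    module G = SimpleGraph G
    module H = SimpleGraph H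
  field
    bijection : V ↔ W
  open Inverse bijection using (to)
  field
    adjacency : ∀ u v → (u G.~ v) ⇔ (to u H.~ to v)

K : (r : ℕ) → SimpleGraph (Fin r)
K r = record
  { _~_   = _≢_
  ; _~?_  = λ u v → ¬? (u ≟ v)
  ; ~-sym = λ u≢v → u≢v ∘ sym
  ; ~-irr = λ u≡v u≢v → u≢v u≡v
  }

-- The disjoint union of r copies of G.
copies : ∀ {V} (r : ℕ) → SimpleGraph V → SimpleGraph (Fin r × V)
copies r G = record
  { _~_   = λ (i , u) (j , v) → i ≡ j × u ~ v
  ; _~?_  = λ (i , u) (j , v) → (i ≟ j) ×-dec (u ~? v)
  ; ~-sym = map sym ~-sym
  ; ~-irr = λ { refl (_ , e) → ~-irr refl e }
  }
  where open SimpleGraph G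

infixr 6 _∨_
_∨_ : ∀ {V W} → SimpleGraph V → SimpleGraph W → SimpleGraph (V ⊎ W)
_∨_ {V} {W} G H = record
  { _~_   = _~_
  ; _~?_  = dec
  ; ~-sym = λ {x} {y} → symm x y
  ; ~-irr = λ {x} {y} → irr x y
  }
  where
  module G = SimpleGraph G
  module H = SimpleGraph H

  _~_ : Rel (V ⊎ W) 0ℓ
  inj₁ u ~ inj₁ v = u G.~ v
  inj₂ u ~ inj₂ v = u H.~ v
  inj₁ _ ~ inj₂ _ = ⊤
  inj₂ _ ~ inj₁ _ = ⊤

  dec : Decidable _~_
  dec (inj₁ u) (inj₁ v) = u G.~? v
  dec (inj₂ u) (inj₂ v) = u H.~? v
  dec (inj₁ _) (inj₂ _) = yes tt
  dec (inj₂ _) (inj₁ _) = yes tt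

  symm : ∀ x y → x ~ y → y ~ x
  symm (inj₁ _) (inj₁ _) e = G.~-sym e
  symm (inj₂ _) (inj₂ _) e = H.~-sym e
  symm (inj₁ _) (inj₂ _) _ = tt
  symm (inj₂ _) (inj₁ _) _ = tt

  irr : ∀ x y → x ≡ y → x ~ y → ⊥
  irr (inj₁ _) _ refl e = G.~-irr refl e
  irr (inj₂ _) _ refl e = H.~-irr refl e

-- The disjoint union of G and H with one further edge, joining a to b.
bridge : ∀ {V W} → DecidableEquality V → DecidableEquality W →
         SimpleGraph V → SimpleGraph W → V → W → SimpleGraph (V ⊎ W)
bridge {V} {W} _≟ⱽ_ _≟ᵂ_ G H a b = record
  { _~_   = _~_
  ; _~?_  = dec
  ; ~-sym = λ {x} {y} → symm x y
  ; ~-irr = λ {x} {y} → irr x y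
  }
  where
  module G = SimpleGraph G
  module H = SimpleGraph H

  _~_ : Rel (V ⊎ W) 0ℓ
  inj₁ u ~ inj₁ v = u G.~ v
  inj₂ u ~ inj₂ v = u H.~ v
  inj₁ u ~ inj₂ v = u ≡ a × v ≡ b
  inj₂ v ~ inj₁ u = u ≡ a × v ≡ b

  dec : Decidable _~_
  dec (inj₁ u) (inj₁ v) = u G.~? v
  dec (inj₂ u) (inj₂ v) = u H.~? v
  dec (inj₁ u) (inj₂ v) = (u ≟ⱽ a) ×-dec (v ≟ᵂ b)
  dec (inj₂ v) (inj₁ u) = (u ≟ⱽ a) ×-dec (v ≟ᵂ b)

  symm : ∀ x y → x ~ y → y ~ x
  symm (inj₁ _) (inj₁ _) e = G.~-sym e
  symm (inj₂ _) (inj₂ _) e = H.~-sym e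
  symm (inj₁ _) (inj₂ _) e = e
  symm (inj₂ _) (inj₁ _) e = e

  irr : ∀ x y → x ≡ y → x ~ y → ⊥
  irr (inj₁ _) _ refl e = G.~-irr refl e
  irr (inj₂ _) _ refl e = H.~-irr refl e

G₁ : SimpleGraph (Fin 1 ⊎ (Fin 3 × Fin 2))
G₁ = K 1 ∨ copies 3 (K 2)

-- `inj₁ zero`, the vertex of K 1, is the vertex of degree 4 of K 1 ∨ copies 2 (K 2).
Gₙ : (n : ℕ) → Fin (n ∸ 5) → SimpleGraph (Fin (n ∸ 5) ⊎ (Fin 1 ⊎ (Fin 2 × Fin 2)))
Gₙ n a = bridge _≟_ (Sum.≡-dec _≟_ (Prod.≡-dec _≟_ _≟_))
                (K (n ∸ 5)) (K 1 ∨ copies 2 (K 2)) a (inj₁ zero)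
  where
  import Data.Sum.Properties as Sum
  import Data.Product.Properties as Prod

{-# OPTIONS --safe #-}
module Submission where

-- Colour with two colours.  A properly connected vertex set S absorbs a vertex with
-- two neighbours in S, by closing a proper path between them into a cycle that
-- alternates except at the new vertex; it also absorbs a 4-cycle through one of its
-- vertices.  All vertex sets of paths are properly connected.  Let S be maximal under
-- the first operation, so that each vertex outside has at most one neighbour in S.
--
-- We induct on n, removing a vertex w that does not disconnect the graph, has no
-- neighbour of degree 2 and has degree at most n - 6: this keeps the minimum degree
-- and the edge bound.  If |S| ≥ 6, every vertex outside S has degree at most n - 6, so
-- it suffices to find a path through the vertices of degree 2 and almost all of their
-- neighbours.  A vertex of degree 2 without neighbours of degree 2 can be removed or
-- is a cut vertex, and then the edge bound makes both sides nearly complete.  The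
-- other vertices of degree 2 form ears, that is, paths of at least two vertices.  Up
-- to two ears lie on a common path, unless they are triangles at the same vertex c,
-- where a 4-cycle through c helps.  Three ears leave at most 9 + C(n-6,2) edges, so
-- n ≤ 8, and this is where G₁ and the smallest Gₙ appear.

open import Data.Bool using (Bool; true; false; not)
open import Data.Bool.Properties using (not-involutive; ¬-not) renaming (_≟_ to _≟ᵇ_)
open import Data.Empty using (⊥; ⊥-elim)
open import Data.Fin as Fin using (Fin; zero; suc)
open import Data.Fin.Patterns
import Data.Fin.Properties as Fin
open import Data.List using (List; []; _∷_; [_]; _++_; length; filter; map; lookup; allFin; cartesianProduct)
open import Data.List.Properties using (length-++; filter-++; filter-accept; filter-reject; length-filter; length-tabulate; ++-assoc; ++-identityʳ)
open import Data.List.Membership.Propositional using (_∈_; _∉_; find; lose)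
open import Data.List.Membership.Propositional.Properties
  using (∈-filter⁻; ∈-filter⁺; ∈-++⁺ˡ; ∈-++⁺ʳ; ∈-++⁻; ∈-∃++; ∈-map⁺; ∈-map⁻; ∈-lookup; ∈-allFin)
open import Data.List.Relation.Binary.Subset.Propositional using (_⊆_)
open import Data.List.Relation.Binary.Permutation.Propositional
  using (_↭_; ↭-refl; ↭-reflexive; ↭-sym; ↭-trans; ↭⇒↭ₛ; refl; prep; swap; trans)
open import Data.List.Relation.Binary.Permutation.Propositional.Properties
  using (∈-resp-↭; filter-↭; ↭-length; shift; shifts; ++-comm; ++⁺ˡ; ++⁺ʳ)
import Data.List.Relation.Binary.Permutation.Setoid.Properties as Permutation
open import Data.List.Relation.Unary.All as All using (All; []; _∷_)
open import Data.List.Relation.Unary.All.Properties using (¬Any⇒All¬; All¬⇒¬Any)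
open import Data.List.Relation.Unary.AllPairs using (AllPairs; allPairs?; []; _∷_)
open import Data.List.Relation.Unary.AllPairs.Properties using (tabulate⁺-<)
open import Data.List.Relation.Unary.Any as Any using (Any; here; there; any?; index)
open import Data.List.Relation.Unary.Any.Properties using (lookup-index)
open import Data.List.Relation.Unary.Linked using (Linked; []; [-]; _∷_)
open import Data.List.Relation.Unary.Unique.Propositional using (Unique)
open import Data.List.Relation.Unary.Unique.Propositional.Properties using (Unique[x∷xs]⇒x∉xs; allFin⁺)
  renaming (filter⁺ to Unique-filter⁺; ++⁺ to Unique-++⁺; map⁺ to Unique-map⁺)
open import Data.Nat using (ℕ; zero; suc; _+_; _*_; _∸_; _≤_; _<_; _≥_; z≤n; s≤s; s≤s⁻¹) renaming (_≟_ to _ℕ≟_)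
open import Data.Nat.Combinatorics using (_C_; nCk+nC[k+1]≡[n+1]C[k+1]; nC1≡n)
open import Data.Nat.Induction using (<-wellFounded)
open import Data.Nat.Properties hiding (_≟_)
open import Data.Nat.Solver using (module +-*-Solver)
open import Data.Product using (Σ-syntax; ∃-syntax; _×_; _,_; proj₁; proj₂)
open import Data.Sum using (_⊎_; inj₁; inj₂; [_,_]′)
open import Data.Unit using (tt)
open import Function using (_∘_)
open import Function.Bundles using (_⇔_; mk⇔; mk↔ₛ′; Equivalence)
open import Induction.WellFounded using (Acc; acc)
open import Relation.Binary using (DecidableEquality; tri<; tri≈; tri>)
open import Relation.Binary.Construct.Closure.ReflexiveTransitive using (ε; _◅_)
open import Relation.Binary.PropositionalEquality as ≡ using (_≡_; _≢_; refl; sym; cong; cong₂; subst; subst₂; setoid)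
open import Relation.Nullary using (¬_; Dec; yes; no; contradiction)
open import Relation.Nullary.Decidable using (¬?; _×-dec_; True; toWitness)
open import Relation.Unary using (Decidable)
open import Defs

-- A route that arrives with the wrong colour cannot be prolonged, and a proper colouring of `S`
-- gives no control over the colour of arrival. The cycle removes this obstacle: from each of its
-- old vertices the new one is reached in both directions, which start with different colours, so
-- every route can be continued. The number `n - 6` is the difference of `C(n-5,2)` and `C(n-6,2)`,
-- that is, the number of edges that one vertex may take away. A vertex outside `S` misses itself
-- and all but at most one vertex of `S`, whence the six. Two triangles at a common vertex are
-- troublesome because the path through them has only five vertices. Removing a vertex may produce
-- an exceptional graph, so the induction proves `PC L ⊎ Exc L`, and `lift` shows that putting the
-- vertex back gives a properly connected graph or a larger `Gₙ`. All this happens in one fixed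
-- graph: an induced subgraph is the duplicate-free list of its vertices, so that removal leaves the
-- adjacency relation alone.

pattern 1st = here ≡.refl
pattern 2nd = there 1st
pattern 3rd = there 2nd
pattern 4th = there 3rd
pattern 5th = there 4th
pattern 6th = there 5th
pattern 7th = there 6th
pattern 8th = there 7th
pattern 5+_ i = Fin.suc (Fin.suc (Fin.suc (Fin.suc (Fin.suc i))))

-- The binomial coefficient `n C 2`, by the recursion that counts edges when vertices are added one
-- at a time.
tri : ℕ → ℕ
tri zero    = 0
tri (suc n) = n + tri n

threshold : ℕ → ℕ
threshold n = tri (n ∸ 5) + 7

-- A clique on `a + b` vertices contains disjoint cliques on `a` and on `b` vertices.
tri-+ : ∀ a b → tri a + tri b ≤ tri (a + b)
tri-+ zero    b = ≤-refl
tri-+ (suc a) b = begin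
  (a + tri a) + tri b  ≡⟨ +-assoc a (tri a) (tri b) ⟩
  a + (tri a + tri b)  ≤⟨ +-mono-≤ (m≤m+n a b) (tri-+ a b) ⟩
  (a + b) + tri (a + b) ∎
  where open ≤-Reasoning

module Graphs {V : Set} (_≟_ : DecidableEquality V) (G : SimpleGraph V) where

  open SimpleGraph G public

  open import Data.List.Membership.DecPropositional _≟_ using (_∈?_) public

  -- Lists without repetition

  Unique-resp-↭ : ∀ {xs ys : List V} → xs ↭ ys → Unique xs → Unique ys
  Unique-resp-↭ p = Permutation.Unique-resp-↭ (setoid V) (↭⇒↭ₛ p)

  ∷-Unique : ∀ {x : V} {xs} → x ∉ xs → Unique xs → Unique (x ∷ xs)
  ∷-Unique x∉ u = ¬Any⇒All¬ _ x∉ ∷ u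

  tail-Unique : ∀ {x : V} {xs} → Unique (x ∷ xs) → Unique xs
  tail-Unique (_ ∷ u) = u

  extract : ∀ {x : V} {xs} → x ∈ xs → ∃[ ys ] xs ↭ x ∷ ys
  extract x∈ with ys , zs , refl ← ∈-∃++ x∈ = ys ++ zs , shift _ ys zs

  ∈-tail : ∀ {x y : V} {xs} → y ∈ x ∷ xs → y ≢ x → y ∈ xs
  ∈-tail (here y≡x) y≢x = contradiction y≡x y≢x
  ∈-tail (there y∈) _   = y∈

  complement : ∀ {xs ys : List V} → Unique xs → xs ⊆ ys → ∃[ zs ] ys ↭ xs ++ zs
  complement {[]}     _ _ = _ , ↭-refl
  complement {x ∷ xs} (x≢ ∷ u) sub
    with ys′ , p ← extract (sub 1st)
    with zs , q ← complement {xs} u (λ y∈ →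
           ∈-tail (∈-resp-↭ p (sub (there y∈))) (λ y≡x → All.lookup x≢ y∈ (sym y≡x)))
    = zs , ↭-trans p (prep x q)

  Unique-⊆-length : ∀ {xs ys : List V} → Unique xs → xs ⊆ ys → length xs ≤ length ys
  Unique-⊆-length {xs} u sub with zs , p ← complement u sub =
    subst (length xs ≤_) (≡.sym (≡.trans (↭-length p) (length-++ xs))) (m≤m+n _ _)

  ⊆-antisym-↭ : ∀ {xs ys : List V} → Unique xs → Unique ys → xs ⊆ ys → ys ⊆ xs → ys ↭ xs
  ⊆-antisym-↭ {xs} ux uy sub sup with complement ux sub
  ... | []     , p = ↭-trans p (subst (_↭ xs) (≡.sym (++-identityʳ xs)) ↭-refl)
  ... | z ∷ zs , p =
    ⊥-elim (All.lookup (disjoint (Unique-resp-↭ (↭-trans p (++-comm xs _)) uy)) (∈-++⁺ʳ zs (sup (∈-resp-↭ (↭-sym p) (∈-++⁺ʳ xs 1st)))) refl)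
    where
    disjoint : ∀ {x : V} {xs} → Unique (x ∷ xs) → All (x ≢_) xs
    disjoint (a ∷ _) = a

  ++-disjoint : ∀ {x : V} xs {ys} → Unique (xs ++ ys) → x ∈ xs → x ∉ ys
  ++-disjoint (x ∷ xs) (x≢ ∷ _) 1st x∈ys = All.lookup x≢ (∈-++⁺ʳ xs x∈ys) refl
  ++-disjoint (_ ∷ xs) (_ ∷ u)  (there x∈) x∈ys = ++-disjoint xs u x∈ x∈ys

  ++-Uniqueˡ : ∀ (xs : List V) {ys} → Unique (xs ++ ys) → Unique xs
  ++-Uniqueˡ []       _ = []
  ++-Uniqueˡ (x ∷ xs) u = ∷-Unique (λ x∈ → Unique[x∷xs]⇒x∉xs u (∈-++⁺ˡ x∈)) (++-Uniqueˡ xs (tail-Unique u))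

  ++-Uniqueʳ : ∀ (xs : List V) {ys} → Unique (xs ++ ys) → Unique ys
  ++-Uniqueʳ []       u = u
  ++-Uniqueʳ (x ∷ xs) u = ++-Uniqueʳ xs (tail-Unique u)

  -- The sublist of us at the positions is, so that facts about explicit lists of
  -- distinct vertices are decided on their positions.
  sel : (us : List V) → List (Fin (length us)) → List V
  sel us = map (lookup us)

  unique? : ∀ {n} (is : List (Fin n)) → Dec (Unique is)
  unique? = allPairs? (λ i j → ¬? (i Fin.≟ j))

  covers? : ∀ {n} (is : List (Fin n)) → Dec (All (λ i → Any (i ≡_) is) (allFin n))
  covers? is = All.all? (λ i → any? (i Fin.≟_) is) (allFin _)

  lookup-injective : ∀ {us : List V} → Unique us → ∀ {i j} → lookup us i ≡ lookup us j → i ≡ j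
  lookup-injective (u≢ ∷ uus) {zero}  {zero}  eq = refl
  lookup-injective (u≢ ∷ uus) {zero}  {suc j} eq = contradiction eq (All.lookup u≢ (∈-lookup j))
  lookup-injective (u≢ ∷ uus) {suc i} {zero}  eq = contradiction (sym eq) (All.lookup u≢ (∈-lookup i))
  lookup-injective (u≢ ∷ uus) {suc i} {suc j} eq = cong suc (lookup-injective uus eq)

  sel-Unique : ∀ {us} → Unique us → (is : List (Fin (length us))) → {True (unique? is)} → Unique (sel us is)
  sel-Unique uus is {d} = Unique-map⁺ (lookup-injective uus) (toWitness d)

  sel-⊆ : ∀ us is → sel us is ⊆ us
  sel-⊆ us is x∈ with i , _ , refl ← ∈-map⁻ (lookup us) x∈ = ∈-lookup i

  ⊆-sel : ∀ us (is : List (Fin (length us))) → {True (covers? is)} → us ⊆ sel us is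
  ⊆-sel us is {d} {x} x∈ = subst (_∈ sel us is) (sym (lookup-index x∈))
                             (∈-map⁺ (lookup us) (All.lookup (toWitness d) (∈-allFin (index x∈))))

  sel-↭ : ∀ {L us} → Unique L → L ↭ us → (is : List (Fin (length us))) → {True (unique? is)} → {True (covers? is)} →
          L ↭ sel us is
  sel-↭ {us = us} uL p is {d₁} {d₂} =
    ⊆-antisym-↭ (sel-Unique (Unique-resp-↭ p uL) is {d₁}) uL
      (λ x∈ → ∈-resp-↭ (↭-sym p) (sel-⊆ us is x∈)) (λ x∈ → ⊆-sel us is {d₂} (∈-resp-↭ p x∈))

  -- Degrees and edge counts

  dg : List V → V → ℕ
  dg L v = length (filter (v ~?_) L)

  e : List V → ℕ
  e []      = 0
  e (v ∷ L) = dg L v + e L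

  ~⇒≢ : ∀ {u v} → u ~ v → u ≢ v
  ~⇒≢ u~v u≡v = ~-irr u≡v u~v

  dg-↭ : ∀ {L M} v → L ↭ M → dg L v ≡ dg M v
  dg-↭ v p = ↭-length (filter-↭ (v ~?_) p)

  dg-++ : ∀ L {M} v → dg (L ++ M) v ≡ dg L v + dg M v
  dg-++ L v = ≡.trans (cong length (filter-++ (v ~?_) L _)) (length-++ (filter (v ~?_) L))

  dg-≤ : ∀ L v → dg L v ≤ length L
  dg-≤ L v = length-filter (v ~?_) L

  dg-yes : ∀ {L v x} → v ~ x → dg (x ∷ L) v ≡ suc (dg L v)
  dg-yes v~x = cong length (filter-accept (_ ~?_) v~x)

  dg-no : ∀ {L v x} → ¬ v ~ x → dg (x ∷ L) v ≡ dg L v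
  dg-no v≁x = cong length (filter-reject (_ ~?_) v≁x)

  dg-self : ∀ {L v} → dg (v ∷ L) v ≡ dg L v
  dg-self = dg-no (~-irr refl)

  pick : ∀ {L v} xs → Unique L → length xs < dg L v → ∃[ u ] u ∈ L × v ~ u × u ∉ xs
  pick {L} {v} xs uL lt with any? (λ u → ¬? (u ∈? xs)) (filter (v ~?_) L)
  ... | yes a with u , u∈ , u∉ ← find a
              with u∈L , v~u ← ∈-filter⁻ (v ~?_) {xs = L} u∈ = u , u∈L , v~u , u∉
  ... | no ¬a = contradiction (Unique-⊆-length (Unique-filter⁺ (v ~?_) uL) sub) (<⇒≱ lt)
    where
    sub : filter (v ~?_) L ⊆ xs
    sub {u} u∈ with u ∈? xs
    ... | yes p = p
    ... | no ¬p = ⊥-elim (All¬⇒¬Any (¬Any⇒All¬ _ ¬a) (Any.map (λ { refl → ¬p }) u∈))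

  dg-full : ∀ {L v} → length L ≤ dg L v → ∀ {x} → x ∈ L → v ~ x
  dg-full {y ∷ L} {v} le x∈ with v ~? y
  ... | no v≁y = contradiction (≤-trans le (dg-≤ L v)) (<⇒≱ ≤-refl)
  dg-full le 1st | yes v~y = v~y
  dg-full (s≤s le) (there x∈) | yes v~y = dg-full le x∈

  dg-nbrs : ∀ {L v} xs → Unique L → (∀ {u} → u ∈ L → v ~ u → u ∈ xs) → dg L v ≤ length xs
  dg-nbrs {L} {v} xs uL h = Unique-⊆-length (Unique-filter⁺ (v ~?_) uL) λ u∈ →
    let u∈L , v~u = ∈-filter⁻ (v ~?_) {xs = L} u∈ in h u∈L v~u

  dg-≥ : ∀ {L v} xs → Unique xs → xs ⊆ L → (∀ {u} → u ∈ xs → v ~ u) → length xs ≤ dg L v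
  dg-≥ {L} {v} xs uxs sub h = Unique-⊆-length uxs λ u∈ → ∈-filter⁺ (v ~?_) (sub u∈) (h u∈)

  -- Each edge is counted at whichever endpoint comes first in the list. A swap of two consecutive
  -- entries only moves the edge between them, if there is one, to its other endpoint.
  e-↭ : ∀ {L M} → L ↭ M → e L ≡ e M
  e-↭ refl = refl
  e-↭ (prep x p) = cong₂ _+_ (dg-↭ x p) (e-↭ p)
  e-↭ (trans p q) = ≡.trans (e-↭ p) (e-↭ q)
  e-↭ {_} {_ ∷ _ ∷ M} (swap {L} x y p) with x ~? y
  ... | yes x~y rewrite dg-yes {M} (~-sym x~y) | e-↭ p | dg-↭ x p | dg-↭ y p =
    solve 3 (λ a b c → con 1 :+ a :+ (b :+ c) := con 1 :+ b :+ (a :+ c)) refl (dg M x) (dg M y) (e M)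
    where open +-*-Solver
  ... | no x≁y rewrite dg-no {M} (x≁y ∘ ~-sym) | e-↭ p | dg-↭ x p | dg-↭ y p =
    solve 3 (λ a b c → a :+ (b :+ c) := b :+ (a :+ c)) refl (dg M x) (dg M y) (e M)
    where open +-*-Solver

  e-≤ : ∀ L → e L ≤ tri (length L)
  e-≤ []      = z≤n
  e-≤ (v ∷ L) = +-mono-≤ (dg-≤ L v) (e-≤ L)

  Complete : List V → Set
  Complete L = ∀ {x y} → x ∈ L → y ∈ L → x ≢ y → x ~ y

  crossing : List V → List V → ℕ
  crossing []       M = 0
  crossing (x ∷ L) M = dg M x + crossing L M

  e-++ : ∀ L {M} → e (L ++ M) ≡ e L + crossing L M + e M
  e-++ []          = refl
  e-++ (x ∷ L) {M} rewrite dg-++ L {M} x | e-++ L {M} =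
    solve 5 (λ a b c d f → (a :+ b) :+ (c :+ d :+ f) := a :+ c :+ (b :+ d) :+ f) refl
      (dg L x) (dg M x) (e L) (crossing L M) (e M)
    where open +-*-Solver

  crossing-≤ : ∀ L {M} k → (∀ {x} → x ∈ L → dg M x ≤ k) → crossing L M ≤ length L * k
  crossing-≤ []      k h = z≤n
  crossing-≤ (x ∷ L) k h = +-mono-≤ (h 1st) (crossing-≤ L k (h ∘ there))

  crossing-none : ∀ L {M} → (∀ {x y} → x ∈ L → y ∈ M → ¬ x ~ y) → crossing L M ≡ 0
  crossing-none L {M} h = n≤0⇒n≡0 (≤-trans (crossing-≤ L 0 λ x∈ → dg0 M (λ y∈ → h x∈ y∈)) (≤-reflexive (*-zeroʳ (length L))))
    where
    dg0 : ∀ M {x} → (∀ {y} → y ∈ M → ¬ x ~ y) → dg M x ≤ 0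
    dg0 []      _ = z≤n
    dg0 (y ∷ M) h = ≤-trans (≤-reflexive (dg-no {M} (h 1st))) (dg0 M (h ∘ there))

  sumdg : List V → List V → ℕ
  sumdg M []      = 0
  sumdg M (x ∷ L) = dg M x + sumdg M L

  private
    sumdg-∷ : ∀ {M v} L → sumdg (v ∷ M) L ≡ dg L v + sumdg M L
    sumdg-∷ [] = refl
    sumdg-∷ {M} {v} (x ∷ L) with v ~? x
    ... | yes v~x rewrite dg-yes {M} (~-sym v~x) | sumdg-∷ {M} {v} L =
      solve 3 (λ a b c → con 1 :+ a :+ (b :+ c) := con 1 :+ b :+ (a :+ c)) refl (dg M x) (dg L v) (sumdg M L)
      where open +-*-Solver
    ... | no v≁x rewrite dg-no {M} (v≁x ∘ ~-sym) | sumdg-∷ {M} {v} L =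
      solve 3 (λ a b c → a :+ (b :+ c) := b :+ (a :+ c)) refl (dg M x) (dg L v) (sumdg M L)
      where open +-*-Solver

  handshake : ∀ L → sumdg L L ≡ 2 * e L
  handshake [] = refl
  handshake (x ∷ L) rewrite dg-self {L} {x} | sumdg-∷ {L} {x} L | handshake L =
    solve 2 (λ a b → a :+ (a :+ (con 2 :* b)) := con 2 :* (a :+ b)) refl (dg L x) (e L)
    where open +-*-Solver

  sumdg-≤ : ∀ {M} L k → (∀ {x} → x ∈ L → dg M x ≤ k) → sumdg M L ≤ length L * k
  sumdg-≤ []      k h = z≤n
  sumdg-≤ (x ∷ L) k h = +-mono-≤ (h 1st) (sumdg-≤ L k (h ∘ there))

  -- Colourings

  Colour : Set
  Colour = V → V → Bool

  -- On a trivial walk the first colour α is arbitrary.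
  data AP (c : Colour) : Bool → V → V → List V → Set where
    []   : ∀ {α v} → AP c α v v [ v ]
    step : ∀ {α u w v ws} → u ~ w → c u w ≡ α → AP c (not α) w v ws → AP c α u v (u ∷ ws)

  Route : Colour → List V → Bool → V → V → Set
  Route c S α u v = ∃[ vs ] AP c α u v vs × Unique vs × vs ⊆ S

  Symmetric-colour : Colour → Set
  Symmetric-colour c = ∀ x y → c x y ≡ c y x

  ProperOn : Colour → List V → Set
  ProperOn c S = ∀ {u v} → u ∈ S → v ∈ S → ∃[ α ] Route c S α u v

  PC : List V → Set
  PC S = ∃[ c ] Symmetric-colour c × ProperOn c S

  PC-⊆ : ∀ {S S′} → S ⊆ S′ → S′ ⊆ S → PC S → PC S′
  PC-⊆ sub sup (c , c-sym , pr) = c , c-sym , λ u∈ v∈ →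
    let α , vs , p , uniq , vs⊆ = pr (sup u∈) (sup v∈) in α , vs , p , uniq , sub ∘ vs⊆

  AP-start : ∀ {c α u v vs} → AP c α u v vs → u ∈ vs
  AP-start []           = 1st
  AP-start (step _ _ _) = 1st

  AP-end : ∀ {c α u v vs} → AP c α u v vs → v ∈ vs
  AP-end []           = 1st
  AP-end (step _ _ p) = there (AP-end p)

  -- New vertices get their colours by overriding every pair at `z`. As `z` lies on none of the
  -- earlier paths, these keep their colours.
  recolour : Colour → V → (V → Bool) → Colour
  recolour c z f x y with x ≟ z
  ... | yes _ = f y
  ... | no _ with y ≟ z
  ...   | yes _ = f x
  ...   | no _  = c x y

  recolourˡ : ∀ c z f y → recolour c z f z y ≡ f y
  recolourˡ c z f y with z ≟ z
  ... | yes _  = refl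
  ... | no z≢z = contradiction refl z≢z

  recolourʳ : ∀ c z f x → recolour c z f x z ≡ f x
  recolourʳ c z f x with x ≟ z
  ... | yes refl = refl
  ... | no _ with z ≟ z
  ...   | yes _  = refl
  ...   | no z≢z = contradiction refl z≢z

  recolour-≢ : ∀ c z f {x y} → x ≢ z → y ≢ z → recolour c z f x y ≡ c x y
  recolour-≢ c z f {x} {y} x≢z y≢z with x ≟ z
  ... | yes x≡z = contradiction x≡z x≢z
  ... | no _ with y ≟ z
  ...   | yes y≡z = contradiction y≡z y≢z
  ...   | no _    = refl

  recolour-sym : ∀ {c} z f → Symmetric-colour c → Symmetric-colour (recolour c z f)
  recolour-sym {c} z f c-sym x y = go (x ≟ z) (y ≟ z)
    where
    go : ∀ {x y} → Dec (x ≡ z) → Dec (y ≡ z) → recolour c z f x y ≡ recolour c z f y x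
    go {y = y} (yes refl) _          = ≡.trans (recolourˡ c z f y) (sym (recolourʳ c z f y))
    go {x}     (no _)     (yes refl) = ≡.trans (recolourʳ c z f x) (sym (recolourˡ c z f x))
    go {x} {y} (no x≢z)   (no y≢z)   =
      ≡.trans (recolour-≢ c z f x≢z y≢z) (≡.trans (c-sym x y) (sym (recolour-≢ c z f y≢z x≢z)))

  AP-recolour : ∀ {c α u v vs} z f → z ∉ vs → AP c α u v vs → AP (recolour c z f) α u v vs
  AP-recolour z f z∉ []                  = []
  AP-recolour z f z∉ (step u~w c≡α p) =
    step u~w
      (≡.trans (recolour-≢ _ z f (λ u≡z → z∉ (here (sym u≡z)))
                                 (λ w≡z → z∉ (there (subst (_∈ _) w≡z (AP-start p))))) c≡α)
      (AP-recolour z f (z∉ ∘ there) p)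

  Route-recolour : ∀ {c S α u v} z f → z ∉ S → Route c S α u v → Route (recolour c z f) S α u v
  Route-recolour z f z∉ (vs , p , uniq , sub) = vs , AP-recolour z f (z∉ ∘ sub) p , uniq , sub

  Route-⊆ : ∀ {c S S′ α u v} → S ⊆ S′ → Route c S α u v → Route c S′ α u v
  Route-⊆ S⊆ (vs , p , uniq , sub) = vs , p , uniq , S⊆ ∘ sub

  AP-not² : ∀ {c α u v vs} → AP c α u v vs → AP c (not (not α)) u v vs
  AP-not² {c} {α} = subst (λ β → AP c β _ _ _) (sym (not-involutive α))

  module _ {c : Colour} (c-sym : Symmetric-colour c) where

    private
      back : ∀ {γ u v w bs} → AP c γ u v bs → u ~ w → c u w ≡ not γ → AP c (not γ) w v (w ∷ bs)
      back p u~w c≡ = step (~-sym u~w) (≡.trans (c-sym _ _) c≡) (AP-not² p)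

      -- A list reversal with accumulator: `bs` is the part already reversed and `ws` the part still
      -- to come. Both start at `u`, with opposite colours, so moving the first edge of `ws` over to
      -- `bs` keeps both alternating.
      reverse-onto : ∀ {γ u v w bs ws} → AP c γ u v bs → AP c (not γ) u w ws →
                     Unique bs → Unique ws → (∀ {x} → x ∈ ws → x ∈ bs → x ≡ u) →
                     ∃[ β ] ∃[ vs ] AP c β w v vs × Unique vs × (∀ {x} → x ∈ vs → x ∈ bs ⊎ x ∈ ws)
      reverse-onto p [] ubs _ _ = _ , _ , p , ubs , inj₁
      reverse-onto {bs = bs} {ws = u ∷ ws} p (step u~w c≡ q) ubs (u≢ ∷ uws) disj =
        let w∉ : _ ∉ bs
            w∉ = λ w∈ → All.lookup u≢ (AP-start q) (sym (disj (there (AP-start q)) w∈))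
            β , vs , r , uvs , sub = reverse-onto (back p u~w c≡) q (∷-Unique w∉ ubs) uws λ where
              x∈ws (here x≡w) → x≡w
              x∈ws (there x∈bs) → contradiction (sym (disj (there x∈ws) x∈bs)) (All.lookup u≢ x∈ws)
        in β , vs , r , uvs , λ x∈ → [ (λ { 1st → inj₂ (there (AP-start q)) ; (there x∈bs) → inj₁ x∈bs })
                                     , inj₂ ∘ there ]′ (sub x∈)

    Route-reverse : ∀ {S α u v} → Route c S α u v → ∃[ β ] Route c S β v u
    Route-reverse {α = α} (vs , p , uvs , sub) =
      -- The accumulator starts as the trivial path, whose first colour can be chosen as `not α`.
      let β , ws , q , uws , ws⊆ = reverse-onto {γ = not α} [] (AP-not² p) ([] ∷ []) uvs λ { _ (here x≡u) → x≡u }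
      in β , ws , q , uws , λ x∈ → [ (λ { 1st → sub (AP-start p) }) , sub ]′ (ws⊆ x∈)

    -- An alternating walk that leaves v along bs and comes back to v along fs:
    -- each of its other vertices reaches v along both directions, hence with
    -- either first colour.
    both-ways : ∀ {γ y v bs fs} → AP c γ y v bs → AP c (not γ) y v fs → y ≢ v → Unique bs → Unique fs →
                (∀ {x} → x ∈ fs → x ∈ bs → x ≡ y ⊎ x ≡ v) →
                ∀ {x} → x ∈ fs → x ≢ v → ∀ δ →
                ∃[ vs ] AP c δ x v vs × Unique vs × (∀ {w} → w ∈ vs → w ∈ bs ⊎ w ∈ fs)
    both-ways p [] y≢v _ _ _ _ _ _ = contradiction refl y≢v
    both-ways {γ} p q@(step _ _ _) y≢v ubs ufs disj 1st x≢v δ with γ ≟ᵇ δ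
    ... | yes refl = _ , p , ubs , inj₁
    ... | no γ≢δ   = _ , subst (λ β → AP c β _ _ _) (sym (¬-not (γ≢δ ∘ sym))) q , ufs , inj₂
    both-ways {v = v} {bs = bs} p (step {w = w} {ws = ws} y~w c≡ q) y≢v ubs (y≢ ∷ ufs) disj (there x∈) x≢v δ with w ≟ v
    both-ways p (step y~w c≡ []) y≢v ubs (y≢ ∷ ufs) disj 2nd x≢v δ | yes refl = contradiction refl x≢v
    both-ways p (step y~w c≡ (step _ _ q)) y≢v ubs (y≢ ∷ (w≢ ∷ _)) disj (there x∈) x≢v δ | yes refl =
      contradiction refl (All.lookup w≢ (AP-end q))
    ... | no w≢v =
      let vs , r , uvs , sub = both-ways (back p y~w c≡) q w≢v (∷-Unique w∉ ubs) ufs disj′ x∈ x≢v δ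
      in vs , r , uvs , λ u∈ → [ (λ { 1st → inj₂ (there (AP-start q)) ; (there u∈bs) → inj₁ u∈bs })
                               , inj₂ ∘ there ]′ (sub u∈)
      where
      w∉ : w ∉ bs
      w∉ w∈ = [ (λ w≡y → All.lookup y≢ (AP-start q) (sym w≡y)) , w≢v ]′ (disj (there (AP-start q)) w∈)
      disj′ : ∀ {x} → x ∈ ws → x ∈ w ∷ bs → x ≡ w ⊎ x ≡ v
      disj′ _     (here x≡w)   = inj₁ x≡w
      disj′ x∈ws (there x∈bs) =
        [ (λ x≡y → contradiction (sym x≡y) (All.lookup y≢ x∈ws)) , inj₂ ]′ (disj (there x∈ws) x∈bs)

  -- A walk towards a set X from which v is reached with either first colour
  -- can be cut at its first vertex in X.
  attach : ∀ {c S X N α u x₀ v vs} →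
           (∀ {x} → x ∈ X → ∀ δ → ∃[ ws ] AP c δ x v ws × Unique ws × (∀ {w} → w ∈ ws → w ∈ X ⊎ w ∈ N)) →
           (∀ {x} → x ∈ N → x ∉ S) → X ⊆ S →
           AP c α u x₀ vs → Unique vs → vs ⊆ S → x₀ ∈ X → Route c (N ++ S) α u v
  attach {c} {S} {X} {N} {v = v} access N∉S X⊆S p uvs vs⊆S x₀∈X =
    let ws , q , uws , sub = go p uvs vs⊆S x₀∈X
    in ws , q , uws , λ w∈ → [ ∈-++⁺ʳ N ∘ vs⊆S , [ ∈-++⁺ʳ N ∘ X⊆S , ∈-++⁺ˡ ]′ ]′ (sub w∈)
    where
    go : ∀ {α u x₀ vs} → AP c α u x₀ vs → Unique vs → vs ⊆ S → x₀ ∈ X →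
         ∃[ ws ] AP c α u v ws × Unique ws × (∀ {w} → w ∈ ws → w ∈ vs ⊎ w ∈ X ⊎ w ∈ N)
    go {α} {u} p uvs vs⊆ x₀∈ with u ∈? X
    ... | yes u∈X = let ws , q , uws , sub = access u∈X α in ws , q , uws , inj₂ ∘ sub
    go [] uvs vs⊆ x₀∈ | no u∉X = contradiction x₀∈ u∉X
    go {u = u} (step u~w c≡ p) (u≢ ∷ uvs) vs⊆ x₀∈ | no u∉X =
      let ws , q , uws , sub = go p uvs (vs⊆ ∘ there) x₀∈
          u∉ws : u ∉ ws
          u∉ws = λ u∈ → [ (λ u∈vs → All.lookup u≢ u∈vs refl)
                        , [ u∉X , (λ u∈N → N∉S u∈N (vs⊆ 1st)) ]′ ]′ (sub u∈)
      in u ∷ ws , step u~w c≡ q , ∷-Unique u∉ws uws , λ where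
           1st → inj₁ 1st
           (there w∈)  → [ inj₁ ∘ there , inj₂ ]′ (sub w∈)

  -- The colour that a further edge at the end must have for a path with first colour `α` to go on
  -- alternating.
  final : Bool → List V → Bool
  final α []           = α
  final α (_ ∷ [])     = α
  final α (_ ∷ y ∷ ys) = final (not α) (y ∷ ys)

  AP-snoc : ∀ {c α u v w vs} → AP c α u v vs → v ~ w → c v w ≡ final α vs → AP c α u w (vs ++ [ w ])
  AP-snoc []                          v~w c≡ = step v~w c≡ []
  AP-snoc (step u~ c≡′ [])            v~w c≡ = step u~ c≡′ (AP-snoc [] v~w c≡)
  AP-snoc (step u~ c≡′ p@(step _ _ _)) v~w c≡ = step u~ c≡′ (AP-snoc p v~w c≡)

  -- Every vertex of the path `ps` from `a` to `b` reaches `v` along both directions of the closed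
  -- cycle, hence with either first colour. A route from anywhere in `S` to `a` can therefore turn
  -- off at its first vertex on `ps`, whatever its colour there.
  PC-∷ : ∀ {S v a b} → PC S → a ∈ S → b ∈ S → a ≢ b → v ∉ S → v ~ a → v ~ b → PC (v ∷ S)
  PC-∷ {S} {v} {a} {b} (c , c-sym , pr) a∈ b∈ a≢b v∉ v~a v~b
    with α , ps , p , ups , ps⊆ ← pr a∈ b∈ = c′ , c′-sym , proper
    where
    -- At `a` the cycle continues with `α` along `ps` and with `not α` to `v`; at `b` the edge to
    -- `v` takes the colour that prolongs `ps`.
    f : V → Bool
    f x with x ≟ a
    ... | yes _ = not α
    ... | no _  = final α ps

    f-a : f a ≡ not α
    f-a with a ≟ a
    ... | yes _  = refl
    ... | no a≢a = contradiction refl a≢a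

    f-b : f b ≡ final α ps
    f-b with b ≟ a
    ... | yes b≡a = contradiction (sym b≡a) a≢b
    ... | no _    = refl

    c′ : Colour
    c′ = recolour c v f

    c′-sym : Symmetric-colour c′
    c′-sym = recolour-sym v f c-sym

    old : ∀ {u w} → u ∈ S → w ∈ S → ∃[ β ] Route c′ S β u w
    old u∈ w∈ = let β , r = pr u∈ w∈ in β , Route-recolour v f v∉ r

    v∉ps : v ∉ ps
    v∉ps = v∉ ∘ ps⊆

    access : ∀ {x} → x ∈ ps → ∀ δ → ∃[ ws ] AP c′ δ x v ws × Unique ws × (∀ {w} → w ∈ ws → w ∈ ps ⊎ w ∈ [ v ])
    access {x} x∈ δ =
      let ws , q , uws , sub = both-ways c′-sym {γ = not α}
            (step (~-sym v~a) (≡.trans (recolourʳ c v f a) f-a) [])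
            (AP-not² (AP-snoc (AP-recolour v f v∉ps p) (~-sym v~b) (≡.trans (recolourʳ c v f b) f-b)))
            (λ { refl → v∉ a∈ })
            (∷-Unique (λ { 1st → v∉ a∈ }) ([] ∷ []))
            (Unique-++⁺ ups ([] ∷ []) (λ { (w∈ , 1st) → v∉ps w∈ }))
            (λ { _ (here w≡a) → inj₁ w≡a ; _ (there (here w≡v)) → inj₂ w≡v })
            (∈-++⁺ˡ x∈) (λ { refl → v∉ps x∈ }) δ
      in ws , q , uws , λ w∈ → [ (λ { 1st → inj₁ (AP-start p) ; (there w∈v) → inj₂ w∈v }) , ∈-++⁻ ps ]′ (sub w∈)

    to-v : ∀ {u} → u ∈ S → ∃[ β ] Route c′ (v ∷ S) β u v
    to-v u∈ = let β , vs , q , uvs , sub = old u∈ a∈ in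
      β , attach access (λ { 1st → v∉ }) ps⊆ q uvs sub (AP-start p)

    proper : ProperOn c′ (v ∷ S)
    proper 1st 1st = true , [ v ] , [] , [] ∷ [] , λ { 1st → 1st }
    proper 1st (there w∈)  = let _ , r = to-v w∈ in Route-reverse c′-sym r
    proper (there u∈)  1st = to-v u∈
    proper (there u∈)  (there w∈)  = let β , r = old u∈ w∈ in β , Route-⊆ there r

  -- An even cycle can alternate all the way round, so `a` reaches each of `p`, `q`, `r` with either
  -- first colour. Every route to `a` then extends to the new vertices, whatever the colour of its
  -- last edge.
  PC-4-cycle : ∀ {S a p q r} → PC S → a ∈ S → Unique (p ∷ q ∷ r ∷ S) →
               a ~ p → p ~ q → q ~ r → r ~ a → PC (p ∷ q ∷ r ∷ S)
  PC-4-cycle {S} {a} {p} {q} {r} (c , c-sym , pr) a∈ uniq@(p≢ ∷ q≢ ∷ r≢ ∷ _) a~p p~q q~r r~a =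
    c′ , c′-sym , proper
    where
    p∉ : p ∉ q ∷ r ∷ S
    p∉ = Unique[x∷xs]⇒x∉xs uniq
    q∉ : q ∉ r ∷ S
    q∉ = Unique[x∷xs]⇒x∉xs (tail-Unique uniq)
    r∉ : r ∉ S
    r∉ = Unique[x∷xs]⇒x∉xs (tail-Unique (tail-Unique uniq))

    -- Used with `true` for `r` and with `false` for `p`, this colours the edges `ap`, `pq`, `qr`,
    -- `ra` in turn `true`, `false`, `true`, `false`.
    at-q : Bool → V → Bool
    at-q β x with x ≟ q
    ... | yes _ = β
    ... | no _  = not β

    at-q-q : ∀ β → at-q β q ≡ β
    at-q-q β with q ≟ q
    ... | yes _  = refl
    ... | no q≢q = contradiction refl q≢q

    at-q-a : ∀ β → at-q β a ≡ not β
    at-q-a β with a ≟ q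
    ... | yes refl = contradiction (there a∈) q∉
    ... | no _     = refl

    c₁ c′ : Colour
    c₁ = recolour c r (at-q true)
    c′ = recolour c₁ p (at-q false)

    c′-sym : Symmetric-colour c′
    c′-sym = recolour-sym p _ (recolour-sym r _ c-sym)

    ap : c′ a p ≡ true
    ap = ≡.trans (recolourʳ c₁ p _ a) (at-q-a false)
    pq : c′ p q ≡ false
    pq = ≡.trans (recolourˡ c₁ p _ q) (at-q-q false)
    qr : c′ q r ≡ true
    qr = ≡.trans (recolour-≢ c₁ p _ (λ { refl → p∉ 1st }) (λ { refl → p∉ 2nd }))
                 (≡.trans (recolourʳ c r _ q) (at-q-q true))
    ra : c′ r a ≡ false
    ra = ≡.trans (recolour-≢ c₁ p _ (λ { refl → p∉ 2nd }) (λ { refl → p∉ (there (there a∈)) }))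
                 (≡.trans (recolourˡ c r _ a) (at-q-a true))

    a≢p : a ≢ p
    a≢p refl = p∉ (there (there a∈))
    a≢q : a ≢ q
    a≢q refl = q∉ (there a∈)
    a≢r : a ≢ r
    a≢r refl = r∉ a∈
    p≢q : p ≢ q
    p≢q refl = p∉ 1st
    p≢r : p ≢ r
    p≢r refl = p∉ 2nd
    q≢r : q ≢ r
    q≢r refl = q∉ 1st

    N : List V
    N = p ∷ q ∷ r ∷ []

    rev : ∀ {x y β} → c′ x y ≡ β → c′ y x ≡ β
    rev {x} {y} eq = ≡.trans (c′-sym y x) eq

    Access : V → Set
    Access v = ∀ {x} → x ∈ [ a ] → ∀ δ →
               ∃[ ws ] AP c′ δ x v ws × Unique ws × (∀ {w} → w ∈ ws → w ∈ [ a ] ⊎ w ∈ N)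

    in-cycle : ∀ {w} → w ∈ a ∷ p ∷ q ∷ r ∷ [] → w ∈ [ a ] ⊎ w ∈ N
    in-cycle 1st = inj₁ 1st
    in-cycle (there w∈)  = inj₂ w∈

    access-p : Access p
    access-p 1st true = a ∷ p ∷ [] , step a~p ap [] , (a≢p ∷ []) ∷ [] ∷ [] ,
      λ { 1st → inj₁ 1st ; 2nd → inj₂ 1st }
    access-p 1st false = a ∷ r ∷ q ∷ p ∷ [] ,
      step (~-sym r~a) (rev ra) (step (~-sym q~r) (rev qr) (step (~-sym p~q) (rev pq) [])) ,
      (a≢r ∷ a≢q ∷ a≢p ∷ []) ∷ (q≢r ∘ sym ∷ p≢r ∘ sym ∷ []) ∷ (p≢q ∘ sym ∷ []) ∷ [] ∷ [] ,
      λ { 1st → inj₁ 1st ; 2nd → inj₂ 3rd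
        ; 3rd → inj₂ 2nd ; 4th → inj₂ 1st }

    access-q : Access q
    access-q 1st true = a ∷ p ∷ q ∷ [] , step a~p ap (step p~q pq []) ,
      (a≢p ∷ a≢q ∷ []) ∷ (p≢q ∷ []) ∷ [] ∷ [] ,
      λ { 1st → inj₁ 1st ; 2nd → inj₂ 1st
        ; 3rd → inj₂ 2nd }
    access-q 1st false = a ∷ r ∷ q ∷ [] , step (~-sym r~a) (rev ra) (step (~-sym q~r) (rev qr) []) ,
      (a≢r ∷ a≢q ∷ []) ∷ (q≢r ∘ sym ∷ []) ∷ [] ∷ [] ,
      λ { 1st → inj₁ 1st ; 2nd → inj₂ 3rd
        ; 3rd → inj₂ 2nd }

    access-r : Access r
    access-r 1st true = a ∷ p ∷ q ∷ r ∷ [] , step a~p ap (step p~q pq (step q~r qr [])) ,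
      (a≢p ∷ a≢q ∷ a≢r ∷ []) ∷ (p≢q ∷ p≢r ∷ []) ∷ (q≢r ∷ []) ∷ [] ∷ [] , in-cycle
    access-r 1st false = a ∷ r ∷ [] , step (~-sym r~a) (rev ra) [] , (a≢r ∷ []) ∷ [] ∷ [] ,
      λ { 1st → inj₁ 1st ; 2nd → inj₂ 3rd }

    N∉S : ∀ {x} → x ∈ N → x ∉ S
    N∉S 1st                 = p∉ ∘ there ∘ there
    N∉S 2nd         = q∉ ∘ there
    N∉S 3rd = r∉

    old : ∀ {u w} → u ∈ S → w ∈ S → ∃[ β ] Route c′ S β u w
    old u∈ w∈ = let β , ρ = pr u∈ w∈ in
      β , Route-recolour p _ (p∉ ∘ there ∘ there) (Route-recolour r _ r∉ ρ)

    to : ∀ {v} → Access v → ∀ {u} → u ∈ S → ∃[ β ] Route c′ (p ∷ q ∷ r ∷ S) β u v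
    to access u∈ = let β , vs , ρ , uvs , sub = old u∈ a∈ in
      β , attach {X = [ a ]} access N∉S (λ { 1st → a∈ }) ρ uvs sub 1st

    ends : ∀ {v} → v ∈ N → Access v
    ends 1st                 = access-p
    ends 2nd         = access-q
    ends 3rd = access-r

    within : ∀ {u v} → u ∈ N → v ∈ N → ∃[ β ] Route c′ N β u v
    within 1st 1st = true , [ p ] , [] , [] ∷ [] , λ { 1st → 1st }
    within 1st 2nd = false , p ∷ q ∷ [] , step p~q pq [] , (p≢q ∷ []) ∷ [] ∷ [] ,
      λ { 1st → 1st ; 2nd → 2nd }
    within 1st 3rd = false , N , step p~q pq (step q~r qr []) ,
      (p≢q ∷ p≢r ∷ []) ∷ (q≢r ∷ []) ∷ [] ∷ [] , λ w∈ → w∈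
    within 2nd 2nd = true , [ q ] , [] , [] ∷ [] , λ { 1st → 2nd }
    within 2nd 3rd = true , q ∷ r ∷ [] , step q~r qr [] , (q≢r ∷ []) ∷ [] ∷ [] , there
    within 3rd 3rd =
      true , [ r ] , [] , [] ∷ [] , λ { 1st → 3rd }
    within 2nd 1st = Route-reverse c′-sym (proj₂ (within 1st 2nd))
    within 3rd 1st =
      Route-reverse c′-sym (proj₂ (within 1st 3rd))
    within 3rd 2nd =
      Route-reverse c′-sym (proj₂ (within 2nd 3rd))

    proper : ProperOn c′ (p ∷ q ∷ r ∷ S)
    proper {u} {v} u∈ v∈ with ∈-++⁻ N {ys = S} u∈ | ∈-++⁻ N {ys = S} v∈
    ... | inj₁ u∈N | inj₁ v∈N = let β , ρ = within u∈N v∈N in β , Route-⊆ (∈-++⁺ˡ {ys = S}) ρ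
    ... | inj₁ u∈N | inj₂ v∈S = Route-reverse c′-sym (proj₂ (to (ends u∈N) v∈S))
    ... | inj₂ u∈S | inj₁ v∈N = to (ends v∈N) u∈S
    ... | inj₂ u∈S | inj₂ v∈S = let β , ρ = old u∈S v∈S in β , Route-⊆ (∈-++⁺ʳ N) ρ

  -- Paths and their alternating colourings

  infixr 5 _◅_
  data Path : V → V → List V → Set where
    stop : ∀ v → Path v v (v ∷ [])
    _◅_  : ∀ {u w v ws} → u ~ w → Path w v ws → Path u v (u ∷ ws)

  Path-start : ∀ {u v vs} → Path u v vs → u ∈ vs
  Path-start (stop _) = 1st
  Path-start (_ ◅ _)  = 1st

  Path-end : ∀ {u v vs} → Path u v vs → v ∈ vs
  Path-end (stop _) = 1st
  Path-end (_ ◅ p)  = there (Path-end p)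

  Path-++ : ∀ {u v w z xs ys} → Path u v xs → v ~ w → Path w z ys → Path u z (xs ++ ys)
  Path-++ (stop _) v~w q = v~w ◅ q
  Path-++ (u~ ◅ p) v~w q = u~ ◅ Path-++ p v~w q

  Path-reverse : ∀ {u v vs} → Path u v vs → ∃[ ws ] Path v u ws × vs ↭ ws
  Path-reverse (stop v) = _ , stop v , ↭-refl
  Path-reverse (_◅_ {u} {w} {v} {vs} u~w p) =
    let ws , q , π = Path-reverse p
    in ws ++ u ∷ [] , Path-++ q (~-sym u~w) (stop u) , ↭-trans (prep u π) (++-comm (u ∷ []) ws)

  PC-path : ∀ {u v vs} → Path u v vs → Unique vs → PC vs
  PC-path p uvs = let c , c-sym , _ , pr , _ = rooted p uvs in c , c-sym , pr
    where
    -- The induction needs one colour `γ` with which all routes from the start `u` begin: a new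
    -- first edge of colour `not γ` then prolongs all of them.
    rooted : ∀ {u v vs} → Path u v vs → Unique vs →
             ∃[ c ] Symmetric-colour c × ∃[ γ ] ProperOn c vs × (∀ {w} → w ∈ vs → Route c vs γ u w)
    rooted (stop v) _ = (λ _ _ → true) , (λ _ _ → refl) , true ,
      (λ { 1st 1st → true , trivial }) , λ { 1st → trivial }
      where
      trivial : Route _ (v ∷ []) true v v
      trivial = v ∷ [] , [] , [] ∷ [] , λ v∈ → v∈
    rooted (_◅_ {u} {w} {v} {vs} u~w p) (u≢ ∷ uvs)
      with c , c-sym , γ , pr , from ← rooted p uvs =
      c′ , c′-sym , not γ , proper , from-u
      where
      u∉ : u ∉ vs
      u∉ u∈ = All.lookup u≢ u∈ refl
      c′ : Colour
      c′ = recolour c u (λ _ → not γ)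
      c′-sym : Symmetric-colour c′
      c′-sym = recolour-sym u _ c-sym
      from-u : ∀ {x} → x ∈ u ∷ vs → Route c′ (u ∷ vs) (not γ) u x
      from-u 1st = u ∷ [] , [] , [] ∷ [] , λ { 1st → 1st }
      from-u (there x∈) = let ws , q , uws , sub = from x∈ in
        u ∷ ws , step u~w (recolourˡ c u _ w) (AP-not² (AP-recolour u _ (u∉ ∘ sub) q)) ,
        ∷-Unique (u∉ ∘ sub) uws , λ { 1st → 1st ; (there y∈) → there (sub y∈) }
      proper : ProperOn c′ (u ∷ vs)
      proper 1st y∈          = not γ , from-u y∈
      proper (there x∈)  1st = Route-reverse c′-sym (from-u (there x∈))
      proper (there x∈)  (there y∈)  = let β , ρ = pr x∈ y∈ in β , Route-⊆ there (Route-recolour u _ u∉ ρ)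

  -- Connectivity

  -- Connectedness of the subgraph induced on `L`, in terms of cuts. As `X` is an arbitrary list, it
  -- can be the set built so far, and an edge that leaves this set comes out.
  Conn : List V → Set
  Conn L = ∀ X {a b} → a ∈ L → a ∈ X → b ∈ L → b ∉ X →
           ∃[ x ] ∃[ y ] x ∈ L × y ∈ L × x ∈ X × y ∉ X × x ~ y

  Conn-⊆ : ∀ {L M} → L ⊆ M → M ⊆ L → Conn L → Conn M
  Conn-⊆ sub sup cn X a∈ a∈X b∈ b∉X =
    let x , y , x∈ , y∈ , rest = cn X (sup a∈) a∈X (sup b∈) b∉X in x , y , sub x∈ , sub y∈ , rest

  Conn-↭ : ∀ {L M} → L ↭ M → Conn L → Conn M
  Conn-↭ p = Conn-⊆ (∈-resp-↭ p) (∈-resp-↭ (↭-sym p))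

  Conn-[] : ∀ v → Conn [ v ]
  Conn-[] v X 1st a∈X 1st b∉X = contradiction a∈X b∉X

  Conn-∷ : ∀ {X w x} → Conn X → x ∈ X → w ~ x → Conn (w ∷ X)
  Conn-∷ {X} {w} {x} cn x∈ w~x Y a∈ a∈Y b∈ b∉Y with w ∈? Y | x ∈? Y
  ... | yes w∈ | no x∉  = w , x , 1st , there x∈ , w∈ , x∉ , w~x
  ... | no w∉  | yes x∈Y = x , w , there x∈ , 1st , x∈Y , w∉ , ~-sym w~x
  ... | yes w∈ | yes x∈Y =
    let p , q , p∈ , q∈ , rest = cn Y x∈ x∈Y (∈-tail b∈ λ { refl → b∉Y w∈ }) b∉Y
    in p , q , there p∈ , there q∈ , rest
  ... | no w∉  | no x∉ =
    let p , q , p∈ , q∈ , rest = cn Y (∈-tail a∈ λ { refl → w∉ a∈Y }) a∈Y x∈ x∉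
    in p , q , there p∈ , there q∈ , rest

  PC⇒Conn : ∀ {S} → PC S → Conn S
  PC⇒Conn {S} (c , _ , pr) X a∈ a∈X b∈ b∉X =
    let _ , vs , p , _ , sub = pr a∈ b∈ in cross p sub a∈X b∉X
    where
    cross : ∀ {α u v vs} → AP c α u v vs → vs ⊆ S → u ∈ X → v ∉ X →
            ∃[ x ] ∃[ y ] x ∈ S × y ∈ S × x ∈ X × y ∉ X × x ~ y
    cross [] _ u∈ v∉ = contradiction u∈ v∉
    cross (step {w = w} u~w _ p) sub u∈ v∉ with w ∈? X
    ... | yes w∈ = cross p (sub ∘ there) w∈ v∉
    ... | no w∉  = _ , w , sub 1st , sub (there (AP-start p)) , u∈ , w∉ , u~w

  outside : ∀ {L X T : List V} {y} → L ↭ X ++ T → y ∈ L → y ∉ X → y ∈ T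
  outside {X = X} p y∈ y∉ = [ (λ y∈X → contradiction y∈X y∉) , (λ y∈T → y∈T) ]′ (∈-++⁻ X (∈-resp-↭ p y∈))

  move : ∀ {L : List V} X {T T′ y} → L ↭ X ++ T → T ↭ y ∷ T′ → L ↭ (y ∷ X) ++ T′
  move X {T′ = T′} {y} p q = ↭-trans p (↭-trans (++⁺ˡ X q) (shift y X T′))

  -- The vertex added last when X is grown to L by adjacent vertices.
  noncut : ∀ {L X T} → Unique L → Conn L → Conn X → L ↭ X ++ T → ∃[ a ] a ∈ X → 1 ≤ length T →
           ∃[ w ] ∃[ L′ ] w ∈ T × L ↭ w ∷ L′ × Conn L′
  noncut {L} {X} {T} uL cn = go (length T) ≤-refl
    where
    go : ∀ k {X T} → length T ≤ k → Conn X → L ↭ X ++ T → ∃[ a ] a ∈ X → 1 ≤ length T →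
         ∃[ w ] ∃[ L′ ] w ∈ T × L ↭ w ∷ L′ × Conn L′
    go (suc k) {X} {t ∷ T} len cX p (a , a∈) _
      with x , y , x∈ , y∈ , x∈X , y∉X , x~y ← cn X (∈-resp-↭ (↭-sym p) (∈-++⁺ˡ a∈)) a∈
             (∈-resp-↭ (↭-sym p) (∈-++⁺ʳ X 1st))
             (λ t∈X → ++-disjoint X (Unique-resp-↭ p uL) t∈X 1st)
      with y∈T ← outside p y∈ y∉X
      with T′ , q ← extract y∈T
      with T′
    ... | [] = y , X , y∈T , ↭-trans (move X p q) (↭-reflexive (++-identityʳ (y ∷ X))) , cX
    ... | t′ ∷ T″ =
      let w , L′ , w∈ , r , cL′ = go k (s≤s⁻¹ (≤-trans (≤-reflexive (sym (↭-length q))) len))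
                                   (Conn-∷ cX x∈X (~-sym x~y)) (move X p q) (y , 1st) (s≤s z≤n)
      in w , L′ , ∈-resp-↭ (↭-sym q) (there w∈) , r , cL′

  Split : List V → Set
  Split L = ∃[ A ] ∃[ B ] L ↭ A ++ B × (∃[ a ] a ∈ A) × (∃[ b ] b ∈ B) × (∀ {x y} → x ∈ A → y ∈ B → ¬ x ~ y)

  -- A connected set is grown from `v` by adjacent vertices. If it stops short of `L`, no edge
  -- leaves it, so it and the remaining vertices form the split.
  conn? : ∀ {L v} → Unique L → v ∈ L → Conn L ⊎ Split L
  conn? {L} {v} uL v∈ = let T , p = extract v∈ in go (length T) ≤-refl (Conn-[] v) p (v , 1st)
    where
    go : ∀ k {X T} → length T ≤ k → Conn X → L ↭ X ++ T → ∃[ a ] a ∈ X → Conn L ⊎ Split L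
    go _ {X} {[]} _ cX p _ = inj₁ (Conn-↭ (↭-sym (↭-trans p (↭-reflexive (++-identityʳ X)))) cX)
    go (suc k) {X} {t ∷ T} len cX p (a , a∈) with any? (λ y → any? (λ x → y ~? x) X) (t ∷ T)
    ... | no none = inj₂ (X , t ∷ T , p , (a , a∈) , (t , 1st) , λ x∈ y∈ x~y →
                      none (lose y∈ (lose x∈ (~-sym x~y))))
    ... | yes some with y , y∈ , hit ← find some with x , x∈ , y~x ← find hit with T′ , q ← extract y∈ =
      go k (s≤s⁻¹ (≤-trans (≤-reflexive (sym (↭-length q))) len)) (Conn-∷ cX x∈ y~x) (move X p q) (y , 1st)

  -- Closure under vertices with two neighbours in the set

  record Closure (L S₀ : List V) : Set where
    field
      S      : List V
      S₀⊆    : S₀ ⊆ S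
      unique : Unique S
      S⊆     : S ⊆ L
      pc     : PC S
      closed : ∀ {t} → t ∈ L → t ∉ S → dg S t ≤ 1

  close : ∀ {L S₀} → Unique L → Unique S₀ → S₀ ⊆ L → PC S₀ → Closure L S₀
  close {L} {S₀} uL uS₀ S₀⊆L = go (length L) (m≤m+n _ _) uS₀ S₀⊆L (λ x∈ → x∈)
    where
    -- The fuel `k` is at least the number of vertices of `L` outside `S`. It cannot run out while
    -- some `t` is left, since `t ∷ S` is a duplicate-free part of `L`.
    go : ∀ k {S} → length L ≤ k + length S → Unique S → S ⊆ L → S₀ ⊆ S → PC S → Closure L S₀
    go k {S} len uS sub sup pc with any? (λ t → ¬? (t ∈? S) ×-dec (2 ≤? dg S t)) L
    ... | no none = record { S = S ; S₀⊆ = sup ; unique = uS ; S⊆ = sub ; pc = pc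
                           ; closed = λ t∈ t∉ → ≮⇒≥ λ lt → none (lose t∈ (t∉ , lt)) }
    ... | yes some with t , t∈ , t∉ , two ← find some
      with a , a∈ , t~a , _ ← pick [] uS (≤-trans (n≤1+n _) two)
      with b , b∈ , t~b , b∉ ← pick [ a ] uS two
      with k
    ... | zero = contradiction (Unique-⊆-length (∷-Unique t∉ uS) λ { 1st → t∈ ; (there x∈) → sub x∈ }) (≤⇒≯ len)
    ... | suc k = go k (≤-trans len (≤-reflexive (sym (+-suc k _)))) (∷-Unique t∉ uS)
                    (λ { 1st → t∈ ; (there x∈) → sub x∈ }) (there ∘ sup)
                    (PC-∷ pc a∈ b∈ (λ { refl → b∉ 1st }) t∉ t~a t~b)

  dg-mono : ∀ {L M v} → Unique L → (∀ {u} → u ∈ L → v ~ u → u ∈ M) → dg L v ≤ dg M v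
  dg-mono {L} {M} {v} uL h = Unique-⊆-length (Unique-filter⁺ (v ~?_) uL) λ u∈ →
    let u∈L , v~u = ∈-filter⁻ (v ~?_) {xs = L} u∈ in ∈-filter⁺ (v ~?_) (h u∈L v~u) v~u

  -- Long paths from minimum degree

  cut-path : ∀ {u v x vs} → Path u v vs → x ∈ vs →
             x ≡ u ⊎ ∃[ r ] ∃[ A ] ∃[ B ] vs ≡ A ++ B × Path u r A × Path x v B
  cut-path p 1st = inj₁ (start p)
    where
    start : ∀ {u v x vs} → Path u v (x ∷ vs) → x ≡ u
    start (stop _) = refl
    start (_ ◅ _)  = refl
  cut-path (_◅_ {u} u~w p) (there x∈) with cut-path p x∈
  ... | inj₁ refl = inj₂ (u , [ u ] , _ , refl , stop u , p)
  ... | inj₂ (r , A , B , refl , q , s) = inj₂ (r , u ∷ A , B , refl , u~w ◅ q , s)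

  rotate : ∀ {u v x vs} → Path u v vs → v ~ u → x ∈ vs → ∃[ z ] ∃[ ws ] Path x z ws × vs ↭ ws
  rotate p v~u x∈ with cut-path p x∈
  ... | inj₁ refl = _ , _ , p , ↭-refl
  ... | inj₂ (r , A , B , refl , q , s) = r , B ++ A , Path-++ s v~u q , ++-comm A B

  private
    one : V → V → ℕ
    one x w = dg [ w ] x

    not-both : ∀ x w y w′ → (x ~ w × y ~ w′) ⊎ one x w + one y w′ ≤ 1
    not-both x w y w′ with x ~? w | y ~? w′
    ... | yes x~w | yes y~w′ = inj₁ (x~w , y~w′)
    ... | yes _   | no _     = inj₂ ≤-refl
    ... | no _    | yes _    = inj₂ ≤-refl
    ... | no _    | no _     = inj₂ z≤n

  -- If no two consecutive vertices `w`, `w′` have both `y ~ w` and `x ~ w′`, each such pair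
  -- accounts for at most one adjacency. The first vertex as a neighbour of `x` and the last one as
  -- a neighbour of `y` belong to no pair, hence the two correction terms; these vanish when `x` and
  -- `y` are the ends of the path.
  crossing-pair : ∀ {w v qs} x y → Path w v qs →
    (∃[ p ] ∃[ q ] ∃[ A ] ∃[ B ] qs ≡ A ++ B × Path w p A × Path q v B × y ~ p × x ~ q)
    ⊎ suc (dg qs x + dg qs y) ≤ length qs + (one x w + one y v)
  crossing-pair x y (stop v) = inj₂ ≤-refl
  crossing-pair {w} {v} x y (_◅_ {w = w′} {ws = qs} w~w′ path) with crossing-pair x y path
  ... | inj₁ (p , q , A , B , refl , α , β , y~p , x~q) =
        inj₁ (p , q , w ∷ A , B , refl , w~w′ ◅ α , β , y~p , x~q)
  ... | inj₂ few with not-both y w x w′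
  ...   | inj₁ (y~w , x~w′) = inj₁ (w , w′ , [ w ] , qs , refl , stop w , path , y~w , x~w′)
  ...   | inj₂ at-most-one = inj₂ (begin
    suc (dg (w ∷ qs) x + dg (w ∷ qs) y)
      ≡⟨ cong suc (cong₂ _+_ (dg-++ [ w ] {qs} x) (dg-++ [ w ] {qs} y)) ⟩
    suc ((one x w + dg qs x) + (one y w + dg qs y))
      ≡⟨ solve 4 (λ a b c d → con 1 :+ ((a :+ b) :+ (c :+ d)) := (a :+ c) :+ (con 1 :+ (b :+ d))) refl
           (one x w) (dg qs x) (one y w) (dg qs y) ⟩
    (one x w + one y w) + suc (dg qs x + dg qs y)
      ≤⟨ +-monoʳ-≤ (one x w + one y w) few ⟩
    (one x w + one y w) + (length qs + (one x w′ + one y v))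
      ≡⟨ solve 5 (λ a b l c d → (a :+ b) :+ (l :+ (c :+ d)) := (b :+ c) :+ (l :+ (a :+ d))) refl
           (one x w) (one y w) (length qs) (one x w′) (one y v) ⟩
    (one y w + one x w′) + (length qs + (one x w + one y v))
      ≤⟨ +-monoˡ-≤ _ at-most-one ⟩
    suc (length qs + (one x w + one y v)) ∎)
    where open ≤-Reasoning
          open +-*-Solver

  one-self : ∀ v → one v v ≡ 0
  one-self v = dg-self {[]} {v}

  escape : ∀ L ps → (L ⊆ ps) ⊎ (∃[ t ] t ∈ L × t ∉ ps)
  escape L ps with any? (λ t → ¬? (t ∈? ps)) L
  ... | yes some = inj₂ (find some)
  ... | no none = inj₁ λ {x} x∈ → case (x ∈? ps) x∈
    where
    case : ∀ {x} → Dec (x ∈ ps) → x ∈ L → x ∈ ps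
    case (yes p) _  = p
    case (no x∉) x∈ = contradiction (lose x∈ x∉) none

  escape-nbr : ∀ L w ps → (∀ {u} → u ∈ L → w ~ u → u ∈ ps) ⊎ (∃[ t ] t ∈ L × t ∉ ps × w ~ t)
  escape-nbr L w ps with any? (λ t → ¬? (t ∈? ps) ×-dec (w ~? t)) L
  ... | yes some with t , t∈ , t∉ , w~t ← find some = inj₂ (t , t∈ , t∉ , w~t)
  ... | no none = inj₁ λ {x} x∈ w~x → case (x ∈? ps) x∈ w~x
    where
    case : ∀ {x} → Dec (x ∈ ps) → x ∈ L → w ~ x → x ∈ ps
    case (yes p) _  _    = p
    case (no x∉) x∈ w~x = contradiction (lose x∈ (x∉ , w~x)) none

  -- Dirac's rotation argument: if all neighbours of both ends lie on the path,
  -- a crossing pair turns it into a cycle, which connectivity opens up into a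
  -- longer path.
  long-path : ∀ {L v₀} d → Unique L → Conn L → v₀ ∈ L → (∀ {v} → v ∈ L → d ≤ dg L v) →
    ∃[ u ] ∃[ v ] ∃[ ps ] Path u v ps × Unique ps × ps ⊆ L × (L ⊆ ps ⊎ suc (d + d) ≤ length ps)
  long-path {L} {v₀} d uL cn v₀∈ deg = go (length L) (m≤m+n _ _) (stop v₀) ([] ∷ []) λ { 1st → v₀∈ }
    where
    Long : Set
    Long = ∃[ u ] ∃[ v ] ∃[ ps ] Path u v ps × Unique ps × ps ⊆ L × (L ⊆ ps ⊎ suc (d + d) ≤ length ps)

    go : ∀ k {u v ps} → length L ≤ k + length ps → Path u v ps → Unique ps → ps ⊆ L → Long

    extend : ∀ k {t u v ps} → length L ≤ k + length ps → Path u v ps → Unique ps → ps ⊆ L →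
             t ∈ L → t ∉ ps → t ~ u → Long
    extend zero    len p ups sub t∈ t∉ t~u =
      contradiction (Unique-⊆-length (∷-Unique t∉ ups) λ { 1st → t∈ ; (there x∈) → sub x∈ }) (≤⇒≯ len)
    extend (suc k) len p ups sub t∈ t∉ t~u =
      go k (≤-trans len (≤-reflexive (sym (+-suc k _)))) (t~u ◅ p) (∷-Unique t∉ ups)
         λ { 1st → t∈ ; (there x∈) → sub x∈ }

    go k {u} {v} {ps} len p ups sub with escape L ps
    ... | inj₁ all = u , v , ps , p , ups , sub , inj₁ all
    ... | inj₂ (t , t∈ , t∉) with escape-nbr L u ps | escape-nbr L v ps
    ...   | inj₂ (t′ , t′∈ , t′∉ , u~t′) | _ = extend k len p ups sub t′∈ t′∉ (~-sym u~t′)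
    ...   | inj₁ _ | inj₂ (t′ , t′∈ , t′∉ , v~t′) =
      let ws , q , π = Path-reverse p in
      extend k (subst (λ n → length L ≤ k + n) (↭-length π) len) q (Unique-resp-↭ π ups)
        (sub ∘ ∈-resp-↭ (↭-sym π)) t′∈ (t′∉ ∘ ∈-resp-↭ (↭-sym π)) (~-sym v~t′)
    ...   | inj₁ u-in | inj₁ v-in with crossing-pair u v p
    ...     | inj₂ few = u , v , ps , p , ups , sub , inj₂ (begin
      suc (d + d)                           ≤⟨ s≤s (+-mono-≤ (big (sub (Path-start p)) u-in) (big (sub (Path-end p)) v-in)) ⟩
      suc (dg ps u + dg ps v)               ≤⟨ few ⟩
      length ps + (one u u + one v v)       ≡⟨ cong₂ (λ a b → length ps + (a + b)) (one-self u) (one-self v) ⟩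
      length ps + 0                         ≡⟨ +-identityʳ _ ⟩
      length ps                             ∎)
      where
      open ≤-Reasoning
      big : ∀ {w} → w ∈ L → (∀ {x} → x ∈ L → w ~ x → x ∈ ps) → d ≤ dg ps w
      big w∈ w-in = ≤-trans (deg w∈) (dg-mono uL w-in)
    -- The cycle runs from `u` along `A` to `a`, over an edge to `v`, back along `B` to `b`, and
    -- over an edge to `u`. It is opened at the vertex `x` that has a neighbour `y` off the path.
    ...     | inj₁ (a , b , A , B , refl , α , β , v~a , u~b)
      with x , y , x∈ , y∈ , x∈ps , y∉ , x~y ← cn (A ++ B) (sub (Path-start p)) (Path-start p) t∈ t∉
      with ws , β′ , π ← Path-reverse β
      with z , cs , γ , σ ← rotate (Path-++ α (~-sym v~a) β′) (~-sym u~b)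
                              (∈-resp-↭ (++⁺ˡ A π) x∈ps) =
      let τ = ↭-trans (++⁺ˡ A π) σ in
      extend k (subst (λ n → length L ≤ k + n) (↭-length τ) len) γ (Unique-resp-↭ τ ups)
        (sub ∘ ∈-resp-↭ (↭-sym τ)) y∈ (y∉ ∘ ∈-resp-↭ (↭-sym τ)) (~-sym x~y)

  -- Cut vertices of degree two

  MinDeg : ℕ → List V → Set
  MinDeg d L = ∀ {v} → v ∈ L → d ≤ dg L v

  -- Besides itself, `t` misses all but at most one vertex of `S`, which makes at least `length S`
  -- vertices.
  closed-miss : ∀ {L S t} → Unique L → Unique S → S ⊆ L → t ∈ L → t ∉ S → dg S t ≤ 1 →
                dg L t + length S ≤ length L
  closed-miss {L} {S} {t} uL uS sub t∈ t∉ few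
    with T , p ← complement uS sub
    with T′ , q ← extract (outside p t∈ t∉) = begin
    dg L t + length S                ≡⟨ cong (_+ length S) (dg-↭ t (↭-trans p (++⁺ˡ S q))) ⟩
    dg (S ++ t ∷ T′) t + length S    ≡⟨ cong (_+ length S) (dg-++ S {t ∷ T′} t) ⟩
    dg S t + dg (t ∷ T′) t + length S ≡⟨ cong (λ d → dg S t + d + length S) (dg-self {T′} {t}) ⟩
    dg S t + dg T′ t + length S      ≤⟨ +-monoˡ-≤ (length S) (+-mono-≤ few (dg-≤ T′ t)) ⟩
    suc (length T′) + length S       ≡⟨ +-comm (suc (length T′)) (length S) ⟩
    length S + length (t ∷ T′)       ≡⟨ length-++ S ⟨
    length (S ++ t ∷ T′)             ≡⟨ ↭-length (↭-trans p (++⁺ˡ S q)) ⟨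
    length L                         ∎
    where open ≤-Reasoning

  -- With minimum degree 2 there is a path through all vertices or through at least five. By
  -- `closed-miss`, a vertex outside the closure of the latter would require `2 + 5` vertices.
  PC-small : ∀ {L v₀} → Unique L → Conn L → v₀ ∈ L → MinDeg 2 L → length L ≤ 6 → PC L
  PC-small {L} uL cn v₀∈ deg small with long-path 2 uL cn v₀∈ deg
  ... | _ , _ , ps , p , ups , sub , inj₁ all  = PC-⊆ sub all (PC-path p ups)
  ... | _ , _ , ps , p , ups , sub , inj₂ five = all-of-it (close uL ups sub (PC-path p ups))
    where
    all-of-it : Closure L ps → PC L
    all-of-it closure with escape L (Closure.S closure)
    ... | inj₁ all            = PC-⊆ (Closure.S⊆ closure) all (Closure.pc closure)
    ... | inj₂ (t , t∈ , t∉) = contradiction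
            (≤-trans (+-mono-≤ (deg t∈) (≤-trans five (Unique-⊆-length ups S₀⊆)))
              (closed-miss uL unique S⊆ t∈ t∉ (closed t∈ t∉)))
            (<⇒≱ (s≤s small))
      where open Closure closure

  -- The class of the induction. The minimum degree is only bounded below, so that it can survive
  -- the removal of a vertex, and the size starts where `PC-small` ends.
  record Good (L : List V) : Set where
    field
      uniq  : Unique L
      conn  : Conn L
      deg   : MinDeg 2 L
      size  : 7 ≤ length L
      edges : threshold (length L) ≤ e L

  Arm : V → List V → Set
  Arm v A = ∃[ x ] x ∈ A × x ~ v × ∃[ x′ ] ∃[ x″ ] x′ ∈ A × x″ ∈ A × x ~ x′ × x′ ~ x″ × x ≢ x′ × x ≢ x″ × x′ ≢ x″

  module Cut {L v A B} (good : Good L) (dv : dg L v ≤ 2) (perm : L ↭ v ∷ A ++ B)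
             (none : ∀ {x y} → x ∈ A → y ∈ B → ¬ x ~ y) where
    open Good good

    private
      u′ : Unique (v ∷ A ++ B)
      u′ = Unique-resp-↭ perm uniq

      A⊆L : A ⊆ L
      A⊆L x∈ = ∈-resp-↭ (↭-sym perm) (there (∈-++⁺ˡ x∈))

      A∌B : ∀ {x} → x ∈ A → x ∉ B
      A∌B = ++-disjoint A (tail-Unique u′)

      cases : ∀ {x} → x ∈ L → x ≡ v ⊎ x ∈ A ⊎ x ∈ B
      cases x∈ with ∈-resp-↭ perm x∈
      ... | here x≡v  = inj₁ x≡v
      ... | there x∈′ = inj₂ (∈-++⁻ A x∈′)

    attached : ∃[ a ] a ∈ A → ∃[ x ] x ∈ A × x ~ v
    attached (a , a∈)
      with x , y , _ , y∈ , x∈A , y∉A , x~y ← conn A (A⊆L a∈) a∈ (∈-resp-↭ (↭-sym perm) 1st)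
             (Unique[x∷xs]⇒x∉xs u′ ∘ ∈-++⁺ˡ) with cases y∈
    ... | inj₁ refl       = x , x∈A , x~y
    ... | inj₂ (inj₁ y∈A) = contradiction y∈A y∉A
    ... | inj₂ (inj₂ y∈B) = contradiction x~y (none x∈A y∈B)

    -- If `x′` led only back to `v`, then `x`, `x′` and `y` would be three neighbours of `v`, which
    -- has at most two.
    arm : ∃[ x ] x ∈ A × x ~ v → ∃[ y ] y ∈ B × y ~ v → Arm v A
    arm (x , x∈A , x~v) (y , y∈B , y~v)
      with x′ , x′∈ , x~x′ , x′∉ ← pick [ v ] uniq (deg (A⊆L x∈A)) with cases x′∈
    ... | inj₁ refl = contradiction 1st x′∉
    ... | inj₂ (inj₂ x′∈B) = contradiction x~x′ (none x∈A x′∈B)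
    ... | inj₂ (inj₁ x′∈A)
      with x″ , x″∈ , x′~x″ , x″∉ ← pick [ x ] uniq (deg x′∈) with cases x″∈
    ...   | inj₂ (inj₂ x″∈B) = contradiction x′~x″ (none x′∈A x″∈B)
    ...   | inj₂ (inj₁ x″∈A) = x , x∈A , x~v , x′ , x″ , x′∈A , x″∈A , x~x′ , x′~x″ ,
                               ~⇒≢ x~x′ , (λ { refl → x″∉ 1st }) , ~⇒≢ x′~x″
    ...   | inj₁ refl = contradiction
      (dg-≥ (x ∷ x′ ∷ y ∷ []) ((~⇒≢ x~x′ ∷ (λ { refl → A∌B x∈A y∈B }) ∷ []) ∷ ((λ { refl → A∌B x′∈A y∈B }) ∷ []) ∷ [] ∷ [])
        (λ { 1st → A⊆L x∈A ; 2nd → x′∈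
           ; 3rd → ∈-resp-↭ (↭-sym perm) (there (∈-++⁺ʳ A y∈B)) })
        (λ { 1st → ~-sym x~v ; 2nd → ~-sym x′~x″ ; 3rd → ~-sym y~v }))
      (<⇒≱ (s≤s dv))

  -- If a closed set misses a vertex on one side of a cut vertex of degree 2,
  -- then it misses two, and the whole graph has too few edges.
  side : ∀ {L v A B S} → Good L → dg L v ≤ 2 → L ↭ v ∷ A ++ B → (∀ {x y} → x ∈ A → y ∈ B → ¬ x ~ y) →
         v ∈ S → (∀ {t} → t ∈ L → t ∉ S → dg S t ≤ 1) → 3 ≤ length B →
         ∀ xs → length xs ≡ 3 → Unique xs → xs ⊆ A → xs ⊆ S → A ⊆ S
  side {L} {v} {A} {B} {S} good dv perm none v∈S closed three xs len uxs xs⊆A xs⊆S {t} t∈A with t ∈? S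
  ... | yes t∈S = t∈S
  ... | no t∉S = contradiction edges (<⇒≱ few)
    where
    open Good good
    in? = λ z → z ∈? S
    out? = λ z → ¬? (z ∈? S)
    SA TA : List V
    SA = filter in? A
    TA = filter out? A

    u′ : Unique (v ∷ A ++ B)
    u′ = Unique-resp-↭ perm uniq
    uA : Unique A
    uA = ++-Uniqueˡ A (tail-Unique u′)
    A⊆L : A ⊆ L
    A⊆L x∈ = ∈-resp-↭ (↭-sym perm) (there (∈-++⁺ˡ x∈))

    split : A ↭ TA ++ SA
    split = ⊆-antisym-↭
      (Unique-++⁺ (Unique-filter⁺ out? uA) (Unique-filter⁺ in? uA)
        λ (z∈ , z∈′) → proj₂ (∈-filter⁻ out? {xs = A} z∈) (proj₂ (∈-filter⁻ in? {xs = A} z∈′)))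
      uA
      (λ z∈ → [ (λ z∈T → proj₁ (∈-filter⁻ out? z∈T)) , (λ z∈S → proj₁ (∈-filter⁻ in? z∈S)) ]′ (∈-++⁻ TA z∈))
      (λ {z} z∈ → place z∈ (z ∈? S))
      where
      place : ∀ {z} → z ∈ A → Dec (z ∈ S) → z ∈ TA ++ SA
      place z∈ (yes z∈S) = ∈-++⁺ʳ TA (∈-filter⁺ in? z∈ z∈S)
      place z∈ (no z∉S)  = ∈-++⁺ˡ (∈-filter⁺ out? z∈ z∉S)

    s≥3 : 3 ≤ length SA
    s≥3 = subst (_≤ length SA) len (Unique-⊆-length uxs λ z∈ → ∈-filter⁺ in? (xs⊆A z∈) (xs⊆S z∈))

    -- `t` has two neighbours but at most one in `S`. The other one is not `v`, which lies in `S`,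
    -- and not in `B`, so it is a second vertex of `A` outside `S`.
    m≥2 : 2 ≤ length TA
    m≥2 with escape-nbr L t S
    ... | inj₁ all = contradiction (≤-trans (deg (A⊆L t∈A)) (dg-mono uniq all)) (<⇒≱ (s≤s (closed (A⊆L t∈A) t∉S)))
    ... | inj₂ (u , u∈ , u∉ , t~u) with ∈-resp-↭ perm u∈
    ...   | 1st = contradiction v∈S u∉
    ...   | there u∈′ with ∈-++⁻ A u∈′
    ...     | inj₂ u∈B = contradiction t~u (none t∈A u∈B)
    ...     | inj₁ u∈A = Unique-⊆-length {t ∷ u ∷ []} ((~⇒≢ t~u ∷ []) ∷ [] ∷ [])
                λ { 1st → ∈-filter⁺ out? t∈A t∉S ; 2nd → ∈-filter⁺ out? u∈A u∉ }

    eA : e A ≤ tri (length TA) + length TA * 1 + tri (length SA)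
    eA = begin
      e A                                    ≡⟨ e-↭ split ⟩
      e (TA ++ SA)                           ≡⟨ e-++ TA ⟩
      e TA + crossing TA SA + e SA           ≤⟨ +-mono-≤ (+-mono-≤ (e-≤ TA) (crossing-≤ TA 1 thin)) (e-≤ SA) ⟩
      tri (length TA) + length TA * 1 + tri (length SA) ∎
      where
      open ≤-Reasoning
      thin : ∀ {z} → z ∈ TA → dg SA z ≤ 1
      thin z∈ = let z∈A , z∉S = ∈-filter⁻ out? {xs = A} z∈ in
        ≤-trans (dg-mono (Unique-filter⁺ in? uA) (λ u∈ _ → proj₂ (∈-filter⁻ in? {xs = A} u∈)))
                (closed (A⊆L z∈A) z∉S)

    eL : e L ≤ 2 + (tri (length TA) + length TA * 1 + tri (length SA) + 0 + tri (length B))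
    eL = begin
      e L                              ≡⟨ e-↭ perm ⟩
      dg (A ++ B) v + e (A ++ B)       ≤⟨ +-mono-≤ dv′ (≤-reflexive (e-++ A)) ⟩
      2 + (e A + crossing A B + e B)   ≤⟨ +-monoʳ-≤ 2 (+-mono-≤ (+-mono-≤ eA (≤-reflexive (crossing-none A none))) (e-≤ B)) ⟩
      2 + (tri (length TA) + length TA * 1 + tri (length SA) + 0 + tri (length B)) ∎
      where
      open ≤-Reasoning
      dv′ : dg (A ++ B) v ≤ 2
      dv′ = ≤-trans (≤-reflexive (≡.trans (sym (dg-self {A ++ B} {v})) (sym (dg-↭ v perm)))) dv

    lenL : length L ≡ suc (length TA + length SA + length B)
    lenL = ≡.trans (↭-length perm) (cong suc (≡.trans (length-++ A)
             (cong (_+ length B) (≡.trans (↭-length split) (length-++ TA)))))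

    -- The summands are the edges at `v`, within `TA`, from `TA` to `SA`, within `SA`, across (none)
    -- and within `B`. With `k = q + p + r` they add up to at most `11 + 3k + tri k`, whereas the
    -- threshold is `13 + 4k + tri k`.
    bound : ∀ {m s b} → 2 ≤ m → 3 ≤ s → 3 ≤ b →
            2 + (tri m + m * 1 + tri s + 0 + tri b) < threshold (suc (m + s + b))
    bound (s≤s (s≤s {n = q} z≤n)) (s≤s (s≤s (s≤s {n = p} z≤n))) (s≤s (s≤s (s≤s {n = r} z≤n))) = begin-strict
      2 + (tri (2 + q) + (2 + q) * 1 + tri (3 + p) + 0 + tri (3 + r))
        ≡⟨ solve 6 (λ q p r Q P R → con 2 :+ (((con 1 :+ q) :+ (q :+ Q)) :+ (con 2 :+ q) :* con 1
             :+ ((con 2 :+ p) :+ ((con 1 :+ p) :+ (p :+ P))) :+ con 0 :+ ((con 2 :+ r) :+ ((con 1 :+ r) :+ (r :+ R))))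
             := con 11 :+ con 3 :* (q :+ p :+ r) :+ (Q :+ P :+ R)) refl q p r (tri q) (tri p) (tri r) ⟩
      11 + 3 * (q + p + r) + (tri q + tri p + tri r)
        ≤⟨ +-monoʳ-≤ (11 + 3 * (q + p + r)) (≤-trans (+-monoˡ-≤ (tri r) (tri-+ q p)) (tri-+ (q + p) r)) ⟩
      11 + 3 * (q + p + r) + tri (q + p + r)
        <⟨ s≤s (≤-trans (m≤m+n _ (suc (q + p + r))) (≤-reflexive (solve 2 (λ k K → con 11 :+ con 3 :* k :+ K :+ (con 1 :+ k)
             := con 3 :+ k :+ (con 2 :+ k :+ (con 1 :+ k :+ (k :+ K))) :+ con 6) refl (q + p + r) (tri (q + p + r))))) ⟩
      suc (tri (4 + (q + p + r)) + 6)
        ≡⟨ +-suc (tri (4 + (q + p + r))) 6 ⟨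
      threshold (9 + (q + p + r))
        ≡⟨ cong threshold (solve 3 (λ q p r → con 9 :+ (q :+ p :+ r) := con 1 :+ ((con 2 :+ q) :+ (con 3 :+ p) :+ (con 3 :+ r))) refl q p r) ⟩
      threshold (suc ((2 + q) + (3 + p) + (3 + r))) ∎
      where
      open ≤-Reasoning
      open +-*-Solver

    few : e L < threshold (length L)
    few = subst (λ n → e L < threshold n) (sym lenL) (≤-<-trans eL (bound m≥2 s≥3 three))

  -- The edge between `u` and `u′` takes up one unit of both degrees, so at most three edges meet
  -- the pair.
  e-pair : ∀ {L u u′ M} → dg L u ≤ 2 → dg L u′ ≤ 2 → u ~ u′ → Unique (u ∷ u′ ∷ M) → u ∷ u′ ∷ M ⊆ L →
           e (u ∷ u′ ∷ M) ≤ 3 + e M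
  e-pair {L} {u} {u′} {M} du du′ u~u′ uniq@((_ ∷ u≢M) ∷ (u′≢M ∷ uM)) sub = begin
    dg (u′ ∷ M) u + (dg M u′ + e M)  ≤⟨ +-mono-≤ (≤-trans (inside (tail-Unique uniq) (sub ∘ there)) du)
                                          (+-monoˡ-≤ (e M) (≤-pred (≤-trans (≤-reflexive (sym (dg-yes {M} (~-sym u~u′))))
                                            (≤-trans (inside (u≢M ∷ uM) (λ { 1st → sub 1st ; (there z∈) → sub (there (there z∈)) })) du′)))) ⟩
    2 + (1 + e M)                    ∎
    where
    open ≤-Reasoning
    inside : ∀ {M v} → Unique M → M ⊆ L → dg M v ≤ dg L v
    inside uM M⊆ = dg-mono uM λ z∈ _ → M⊆ z∈

  -- An arm on either side gives a path of seven vertices with `v` in the middle. Three vertices on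
  -- each side are what `side` requires in order to show that the closure contains both sides.
  PC-cut : ∀ {L v A B} → Good L → dg L v ≤ 2 → L ↭ v ∷ A ++ B → ∃[ a ] a ∈ A → ∃[ b ] b ∈ B →
           (∀ {x y} → x ∈ A → y ∈ B → ¬ x ~ y) → PC L
  PC-cut {L} {v} {A} {B} good dv perm a∈ b∈ none = go (SideA.arm x∈ y∈ , SideB.arm y∈ x∈)
    where
    perm′ : L ↭ v ∷ B ++ A
    perm′ = ↭-trans perm (prep v (++-comm A B))
    none′ : ∀ {y x} → y ∈ B → x ∈ A → ¬ y ~ x
    none′ y∈ x∈ = none x∈ y∈ ∘ ~-sym
    module SideA = Cut good dv perm none
    module SideB = Cut good dv perm′ none′
    x∈ : ∃[ x ] x ∈ A × x ~ v
    x∈ = SideA.attached a∈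
    y∈ : ∃[ y ] y ∈ B × y ~ v
    y∈ = SideB.attached b∈
    go : Arm v A × Arm v B → PC L
    go ((x , x∈ , x~v , x′ , x″ , x′∈ , x″∈ , x~x′ , x′~x″ , x≢x′ , x≢x″ , x′≢x″) ,
        (y , y∈ , y~v , y′ , y″ , y′∈ , y″∈ , y~y′ , y′~y″ , y≢y′ , y≢y″ , y′≢y″)) =
      covered (close uniq uniq₀ (∈-resp-↭ (↭-sym perm) ∘ sub) (PC-path path uniq₀))
      where
      open Good good
      xs ys : List V
      xs = x″ ∷ x′ ∷ x ∷ []
      ys = y ∷ y′ ∷ y″ ∷ []

      uxs : Unique xs
      uxs = (x′≢x″ ∘ sym ∷ x≢x″ ∘ sym ∷ []) ∷ (x≢x′ ∘ sym ∷ []) ∷ [] ∷ []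
      uys : Unique ys
      uys = (y≢y′ ∷ y≢y″ ∷ []) ∷ (y′≢y″ ∷ []) ∷ [] ∷ []
      xs⊆ : xs ⊆ A
      xs⊆ 1st                 = x″∈
      xs⊆ 2nd         = x′∈
      xs⊆ 3rd = x∈
      ys⊆ : ys ⊆ B
      ys⊆ 1st                 = y∈
      ys⊆ 2nd         = y′∈
      ys⊆ 3rd = y″∈

      u′ : Unique (v ∷ A ++ B)
      u′ = Unique-resp-↭ perm uniq
      sub : xs ++ v ∷ ys ⊆ v ∷ A ++ B
      sub z∈ with ∈-++⁻ xs z∈
      ... | inj₁ z∈xs         = there (∈-++⁺ˡ (xs⊆ z∈xs))
      ... | inj₂ 1st  = 1st
      ... | inj₂ (there z∈ys) = there (∈-++⁺ʳ A (ys⊆ z∈ys))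

      v∉ys : v ∉ ys
      v∉ys v∈ = Unique[x∷xs]⇒x∉xs u′ (∈-++⁺ʳ A (ys⊆ v∈))

      uniq₀ : Unique (xs ++ v ∷ ys)
      uniq₀ = Unique-++⁺ uxs (∷-Unique v∉ys uys) λ where
        (z∈xs , 1st)  → Unique[x∷xs]⇒x∉xs u′ (∈-++⁺ˡ (xs⊆ z∈xs))
        (z∈xs , there z∈ys) → ++-disjoint A (tail-Unique u′) (xs⊆ z∈xs) (ys⊆ z∈ys)

      path : Path x″ y″ (xs ++ v ∷ ys)
      path = ~-sym x′~x″ ◅ ~-sym x~x′ ◅ x~v
           ◅ ~-sym y~v ◅ y~y′ ◅ y′~y″ ◅ stop y″

      covered : Closure L (xs ++ v ∷ ys) → PC L
      covered closure = PC-⊆ S⊆ L⊆S pc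
        where
        open Closure closure
        v∈S : v ∈ S
        v∈S = S₀⊆ (∈-++⁺ʳ xs 1st)
        A⊆S : A ⊆ S
        A⊆S = side good dv perm none v∈S closed (Unique-⊆-length uys ys⊆) xs refl uxs xs⊆ (S₀⊆ ∘ ∈-++⁺ˡ)
        B⊆S : B ⊆ S
        B⊆S = side good dv perm′ none′ v∈S closed
                (Unique-⊆-length uxs xs⊆) ys refl uys ys⊆ (S₀⊆ ∘ ∈-++⁺ʳ xs ∘ there)
        L⊆S : L ⊆ S
        L⊆S z∈ with ∈-resp-↭ perm z∈
        ... | 1st = v∈S
        ... | there z∈′ = [ A⊆S , B⊆S ]′ (∈-++⁻ A z∈′)

  -- The exceptional graphs

  -- The common part of the two exceptional graphs: two triangles that share `c` and are otherwise
  -- attached to nothing. The rest `R` is a third edge joined to `c` in `G₁` and the clique in `Gₙ`.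
  record Bowtie (L : List V) : Set where
    field
      {c p q p′ q′} : V
      {R}  : List V
      perm : L ↭ p ∷ q ∷ p′ ∷ q′ ∷ c ∷ R
      pq   : p ~ q
      pc   : p ~ c
      qc   : q ~ c
      pq′  : p′ ~ q′
      pc′  : p′ ~ c
      qc′  : q′ ~ c
      dp   : dg L p ≤ 2
      dq   : dg L q ≤ 2
      dp′  : dg L p′ ≤ 2
      dq′  : dg L q′ ≤ 2

  -- A clique `R` of one or two vertices at the end of the bridge would contain a vertex of degree
  -- 1, hence the bound on its length.
  ThirdTriangle Bridge : ∀ {L} → Bowtie L → Set
  ThirdTriangle b = ∃[ r ] ∃[ s ] R ≡ r ∷ s ∷ [] × r ~ s × r ~ c × s ~ c
    where open Bowtie b
  Bridge b = ∃[ r₀ ] r₀ ∈ R × c ~ r₀ × (∀ {r} → r ∈ R → c ~ r → r ≡ r₀) × Complete R × 3 ≤ length R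
    where open Bowtie b

  Exc : List V → Set
  Exc L = Σ[ b ∈ Bowtie L ] (ThirdTriangle b ⊎ Bridge b)

  finish : ∀ {L S₀} → Unique L → Unique S₀ → S₀ ⊆ L → PC S₀ →
           (∀ {t} → t ∈ L → t ∈ S₀ ⊎ ∃[ a ] ∃[ b ] a ≢ b × a ∈ S₀ × b ∈ S₀ × t ~ a × t ~ b) → PC L
  finish {L} uL uS₀ sub pc₀ near = PC-⊆ S⊆ (λ {t} → all {t}) pc
    where
    open Closure (close uL uS₀ sub pc₀)
    all : L ⊆ S
    all {t} t∈ with near t∈
    ... | inj₁ t∈S₀ = S₀⊆ t∈S₀
    ... | inj₂ (a , b , a≢b , a∈ , b∈ , t~a , t~b) with t ∈? S
    ...   | yes t∈S = t∈S
    ...   | no t∉S = contradiction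
      (dg-≥ (a ∷ b ∷ []) ((a≢b ∷ []) ∷ [] ∷ []) (λ { 1st → S₀⊆ a∈ ; 2nd → S₀⊆ b∈ })
            (λ { 1st → t~a ; 2nd → t~b }))
      (<⇒≱ (s≤s (closed t∈ t∉S)))

  finish-complete : ∀ {L us S₀ R r s} → Unique L → L ↭ us ++ R → us ⊆ S₀ → S₀ ⊆ us → Unique S₀ → PC S₀ →
                    r ∈ us → s ∈ us → r ≢ s → (∀ {t} → t ∈ R → t ~ r × t ~ s) → PC L
  finish-complete {us = us} uL p sup sub uS₀ pc₀ r∈ s∈ r≢s near =
    finish uL uS₀ (∈-resp-↭ (↭-sym p) ∘ ∈-++⁺ˡ ∘ sub) pc₀ λ t∈ → case (∈-++⁻ us (∈-resp-↭ p t∈))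
    where
    case : ∀ {t} → t ∈ us ⊎ t ∈ _ → t ∈ _ ⊎ _
    case (inj₁ t∈us) = inj₁ (sup t∈us)
    case (inj₂ t∈R)  = let t~r , t~s = near t∈R in inj₂ (_ , _ , r≢s , sup r∈ , sup s∈ , t~r , t~s)

  -- An exceptional graph together with a new vertex `w`. Every vertex of `R` is adjacent to `r` and
  -- to `s`, so it suffices to connect the eight named vertices. Each lemma does this by a path
  -- through all of them, or by a path through five of them and a 4-cycle through `c`.
  module Lifts {L w p q p′ q′ c r s R} (uL : Unique L)
           (perm : L ↭ (w ∷ p ∷ q ∷ p′ ∷ q′ ∷ c ∷ r ∷ s ∷ []) ++ R)
           (pq : p ~ q) (pc : p ~ c) (qc : q ~ c) (pq′ : p′ ~ q′) (pc′ : p′ ~ c) (qc′ : q′ ~ c)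
           (rs : r ~ s) (near : ∀ {t} → t ∈ R → t ~ r × t ~ s) where

    private
      us : List V
      us = w ∷ p ∷ q ∷ p′ ∷ q′ ∷ c ∷ r ∷ s ∷ []

      uus : Unique us
      uus = ++-Uniqueˡ us (Unique-resp-↭ perm uL)

      done : ∀ is → {True (unique? is)} →
             {True (covers? is)} → PC (sel us is) → PC L
      done is {d₁} {d₂} pc₀ = finish-complete {r = r} {s = s} uL perm (⊆-sel us is {d₂}) (sel-⊆ us is) (sel-Unique uus is {d₁}) pc₀
        7th
        8th (~⇒≢ rs) near

      path : ∀ is → {True (unique? is)} →
             ∀ {u v} → Path u v (sel us is) → PC (sel us is)
      path is {d} p = PC-path p (sel-Unique uus is {d})

    -- The vertices of us are numbered in order: w is 0, p is 1, ..., s is 7.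
    lift-q : c ~ r → w ~ p → w ~ q → PC L
    lift-q cr wp wq = done (1F ∷ 0F ∷ 2F ∷ 4F ∷ 3F ∷ 5F ∷ 6F ∷ 7F ∷ [])
      (PC-4-cycle {a = c} (path (4F ∷ 3F ∷ 5F ∷ 6F ∷ 7F ∷ []) (~-sym pq′ ◅ pc′ ◅ cr ◅ rs ◅ stop s))
        3rd (sel-Unique uus (1F ∷ 0F ∷ 2F ∷ 4F ∷ 3F ∷ 5F ∷ 6F ∷ 7F ∷ [])) (~-sym pc) (~-sym wp) wq qc)

    lift-c : c ~ r → w ~ p → w ~ c → PC L
    lift-c cr wp wc = done (2F ∷ 1F ∷ 0F ∷ 4F ∷ 3F ∷ 5F ∷ 6F ∷ 7F ∷ [])
      (PC-4-cycle {a = c} (path (4F ∷ 3F ∷ 5F ∷ 6F ∷ 7F ∷ []) (~-sym pq′ ◅ pc′ ◅ cr ◅ rs ◅ stop s))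
        3rd (sel-Unique uus (2F ∷ 1F ∷ 0F ∷ 4F ∷ 3F ∷ 5F ∷ 6F ∷ 7F ∷ [])) (~-sym qc) (~-sym pq) (~-sym wp) wc)

    lift-p′ : c ~ r → w ~ p → w ~ p′ → PC L
    lift-p′ cr wp wp′ = done (2F ∷ 1F ∷ 0F ∷ 3F ∷ 4F ∷ 5F ∷ 6F ∷ 7F ∷ [])
      (path (2F ∷ 1F ∷ 0F ∷ 3F ∷ 4F ∷ 5F ∷ 6F ∷ 7F ∷ []) (~-sym pq ◅ ~-sym wp ◅ wp′ ◅ pq′ ◅ qc′ ◅ cr ◅ rs ◅ stop s))

    lift-q′ : c ~ r → w ~ p → w ~ q′ → PC L
    lift-q′ cr wp wq′ = done (2F ∷ 1F ∷ 0F ∷ 4F ∷ 3F ∷ 5F ∷ 6F ∷ 7F ∷ [])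
      (path (2F ∷ 1F ∷ 0F ∷ 4F ∷ 3F ∷ 5F ∷ 6F ∷ 7F ∷ []) (~-sym pq ◅ ~-sym wp ◅ wq′ ◅ ~-sym pq′ ◅ pc′ ◅ cr ◅ rs ◅ stop s))

    lift-r : w ~ p → w ~ r → PC L
    lift-r wp wr = done (4F ∷ 3F ∷ 5F ∷ 2F ∷ 1F ∷ 0F ∷ 6F ∷ 7F ∷ [])
      (path (4F ∷ 3F ∷ 5F ∷ 2F ∷ 1F ∷ 0F ∷ 6F ∷ 7F ∷ []) (~-sym pq′ ◅ pc′ ◅ ~-sym qc ◅ ~-sym pq ◅ ~-sym wp ◅ wr ◅ rs ◅ stop s))

    lift-cr : c ~ r → w ~ c → w ~ s → PC L
    lift-cr cr wc ws = done (0F ∷ 7F ∷ 6F ∷ 2F ∷ 1F ∷ 5F ∷ 3F ∷ 4F ∷ [])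
      (PC-4-cycle {a = c} (path (2F ∷ 1F ∷ 5F ∷ 3F ∷ 4F ∷ []) (~-sym pq ◅ pc ◅ ~-sym pc′ ◅ pq′ ◅ stop q′))
        3rd (sel-Unique uus (0F ∷ 7F ∷ 6F ∷ 2F ∷ 1F ∷ 5F ∷ 3F ∷ 4F ∷ [])) (~-sym wc) ws (~-sym rs) (~-sym cr))

  swap-in swap-across : ∀ {L} → Bowtie L → Bowtie L
  swap-in b = record
    { perm = ↭-trans perm (swap p q ↭-refl) ; pq = ~-sym pq ; pc = qc ; qc = pc
    ; pq′ = pq′ ; pc′ = pc′ ; qc′ = qc′ ; dp = dq ; dq = dp ; dp′ = dp′ ; dq′ = dq′ }
    where open Bowtie b
  swap-across b = record
    { perm = ↭-trans perm (++⁺ʳ _ (++-comm (p ∷ q ∷ []) (p′ ∷ q′ ∷ [])))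
    ; pq = pq′ ; pc = pc′ ; qc = qc′ ; pq′ = pq ; pc′ = pc ; qc′ = qc ; dp = dp′ ; dq = dq′ ; dp′ = dp ; dq′ = dq }
    where open Bowtie b

  -- Three edges for each triangle and one for the bridge: this is the constant `7` of the edge
  -- bound.
  e-bowtie : ∀ {L} → Unique L → (b : Bowtie L) → Bridge b → e L ≤ 7 + tri (length (Bowtie.R b))
  e-bowtie {L} uL b (r₀ , _ , _ , only , _) = begin
    e L                                  ≡⟨ e-↭ perm ⟩
    e (p ∷ q ∷ p′ ∷ q′ ∷ c ∷ R)          ≤⟨ e-pair dp dq pq u′ sub ⟩
    3 + e (p′ ∷ q′ ∷ c ∷ R)              ≤⟨ +-monoʳ-≤ 3 (e-pair dp′ dq′ pq′ (tail-Unique (tail-Unique u′)) (sub ∘ there ∘ there)) ⟩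
    6 + (dg R c + e R)                   ≤⟨ +-monoʳ-≤ 6 (+-mono-≤ (dg-nbrs [ r₀ ] uR λ u∈ c~u → here (only u∈ c~u)) (e-≤ R)) ⟩
    7 + tri (length R)                   ∎
    where
    open Bowtie b
    open ≤-Reasoning
    u′ : Unique (p ∷ q ∷ p′ ∷ q′ ∷ c ∷ R)
    u′ = Unique-resp-↭ perm uL
    uR : Unique R
    uR = ++-Uniqueʳ (p ∷ q ∷ p′ ∷ q′ ∷ c ∷ []) u′
    sub : p ∷ q ∷ p′ ∷ q′ ∷ c ∷ R ⊆ L
    sub = ∈-resp-↭ (↭-sym perm)

  lift-three : ∀ {L w p q p′ q′ c r s} → Unique L → L ↭ w ∷ p ∷ q ∷ p′ ∷ q′ ∷ c ∷ r ∷ s ∷ [] → 2 ≤ dg L w → w ~ p →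
               p ~ q → p ~ c → q ~ c → p′ ~ q′ → p′ ~ c → q′ ~ c → r ~ s → r ~ c → s ~ c → PC L
  lift-three {L} {w} {p} uL perm dw wp pq pc qc pq′ pc′ qc′ rs rc sc
    with u , u∈ , w~u , u∉ ← pick [ p ] uL dw with ∈-resp-↭ perm u∈
  ... | 1st = contradiction refl (~⇒≢ w~u)
  ... | 2nd = contradiction 1st u∉
  ... | 3rd = Lifts.lift-q {R = []} uL perm pq pc qc pq′ pc′ qc′ rs (λ ()) (~-sym rc) wp w~u
  ... | 4th = Lifts.lift-p′ {R = []} uL perm pq pc qc pq′ pc′ qc′ rs (λ ()) (~-sym rc) wp w~u
  ... | 5th = Lifts.lift-q′ {R = []} uL perm pq pc qc pq′ pc′ qc′ rs (λ ()) (~-sym rc) wp w~u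
  ... | 6th = Lifts.lift-c {R = []} uL perm pq pc qc pq′ pc′ qc′ rs (λ ()) (~-sym rc) wp w~u
  -- The roles of the second and the third triangle are exchanged.
  ... | 7th =
    Lifts.lift-p′ {R = []} uL (sel-↭ uL perm (0F ∷ 1F ∷ 2F ∷ 6F ∷ 7F ∷ 5F ∷ 3F ∷ 4F ∷ [])) pq pc qc rs rc sc pq′ (λ ()) (~-sym pc′) wp w~u
  ... | 8th =
    Lifts.lift-q′ {R = []} uL (sel-↭ uL perm (0F ∷ 1F ∷ 2F ∷ 6F ∷ 7F ∷ 5F ∷ 3F ∷ 4F ∷ [])) pq pc qc rs rc sc pq′ (λ ()) (~-sym pc′) wp w~u

  lift-third : ∀ {L w L′} → Unique L → L ↭ w ∷ L′ → 2 ≤ dg L w → (b : Bowtie L′) → ThirdTriangle b → PC L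
  lift-third {L} {w} uL perm dw b (r , s , refl , rs , rc , sc) = go
    where
    open Bowtie b renaming (perm to perm′)
    full : L ↭ w ∷ p ∷ q ∷ p′ ∷ q′ ∷ c ∷ r ∷ s ∷ []
    full = ↭-trans perm (prep w perm′)
    go : PC L
    go with u , u∈ , w~u , u∉ ← pick [ c ] uL dw with ∈-resp-↭ full u∈
    ... | 1st = contradiction refl (~⇒≢ w~u)
    ... | 2nd = lift-three uL full dw w~u pq pc qc pq′ pc′ qc′ rs rc sc
    ... | 3rd =
      lift-three uL (sel-↭ uL full (0F ∷ 2F ∷ 1F ∷ 3F ∷ 4F ∷ 5F ∷ 6F ∷ 7F ∷ [])) dw w~u (~-sym pq) qc pc pq′ pc′ qc′ rs rc sc
    ... | 4th =
      lift-three uL (sel-↭ uL full (0F ∷ 3F ∷ 4F ∷ 1F ∷ 2F ∷ 5F ∷ 6F ∷ 7F ∷ [])) dw w~u pq′ pc′ qc′ pq pc qc rs rc sc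
    ... | 5th =
      lift-three uL (sel-↭ uL full (0F ∷ 4F ∷ 3F ∷ 1F ∷ 2F ∷ 5F ∷ 6F ∷ 7F ∷ [])) dw w~u (~-sym pq′) qc′ pc′ pq pc qc rs rc sc
    ... | 6th = contradiction 1st u∉
    ... | 7th =
      lift-three uL (sel-↭ uL full (0F ∷ 6F ∷ 7F ∷ 1F ∷ 2F ∷ 5F ∷ 3F ∷ 4F ∷ [])) dw w~u rs rc sc pq pc qc pq′ pc′ qc′
    ... | 8th =
      lift-three uL (sel-↭ uL full (0F ∷ 7F ∷ 6F ∷ 1F ∷ 2F ∷ 5F ∷ 3F ∷ 4F ∷ [])) dw w~u (~-sym rs) sc rc pq pc qc pq′ pc′ qc′

  another : ∀ {R : List V} {r} → Unique R → 2 ≤ length R → r ∈ R → ∃[ s ] s ∈ R × s ≢ r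
  another {_ ∷ []}    _ (s≤s ()) 1st
  another {a ∷ b ∷ _} (a≢ ∷ _) _ 1st = b , 2nd , λ { refl → All.lookup a≢ 1st refl }
  another {a ∷ _}     (a≢ ∷ _) _ (there r∈)  = a , 1st , All.lookup a≢ r∈

  two-first : ∀ {R : List V} {r s} → r ∈ R → s ∈ R → s ≢ r → ∃[ R′ ] R ↭ r ∷ s ∷ R′
  two-first r∈ s∈ s≢r with R₁ , p ← extract r∈ with R₂ , q ← extract (∈-tail (∈-resp-↭ p s∈) s≢r) =
    R₂ , ↭-trans p (prep _ q)

  -- The second neighbour of `w` decides which lemma of `Lifts` applies. If it lies in the clique,
  -- it takes the role of `r` in place of `r₀`.
  lift-bridge-outer : ∀ {L w L′} → Unique L → L ↭ w ∷ L′ → 2 ≤ dg L w → (b : Bowtie L′) → Bridge b → w ~ Bowtie.p b → PC L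
  lift-bridge-outer {L} {w} {L′} uL perm dw b (r₀ , r₀∈ , c~r₀ , only , comp , big) wp = go
    where
    open Bowtie b renaming (perm to perm′)
    u′ : Unique (w ∷ p ∷ q ∷ p′ ∷ q′ ∷ c ∷ R)
    u′ = Unique-resp-↭ (↭-trans perm (prep w perm′)) uL
    uR : Unique R
    uR = ++-Uniqueʳ (w ∷ p ∷ q ∷ p′ ∷ q′ ∷ c ∷ []) u′

    module Front {r} (r∈ : r ∈ R) where
      private
        A = another uR (≤-trans (n≤1+n _) big) r∈
      s : V
      s = proj₁ A
      s∈ : s ∈ R
      s∈ = proj₁ (proj₂ A)
      s≢r : s ≢ r
      s≢r = proj₂ (proj₂ A)
      private
        F = two-first r∈ s∈ s≢r
      R′ : List V
      R′ = proj₁ F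
      RF : R ↭ r ∷ s ∷ R′
      RF = proj₂ F
      full : L ↭ (w ∷ p ∷ q ∷ p′ ∷ q′ ∷ c ∷ r ∷ s ∷ []) ++ R′
      full = ↭-trans perm (prep w (↭-trans perm′ (++⁺ˡ (p ∷ q ∷ p′ ∷ q′ ∷ c ∷ []) RF)))
      rs : r ~ s
      rs = comp r∈ s∈ (s≢r ∘ sym)
      u″ : Unique (r ∷ s ∷ R′)
      u″ = Unique-resp-↭ RF uR
      near : ∀ {t} → t ∈ R′ → t ~ r × t ~ s
      near t∈ = comp t∈R r∈ (λ { refl → Unique[x∷xs]⇒x∉xs u″ (there t∈) })
              , comp t∈R s∈ (λ { refl → Unique[x∷xs]⇒x∉xs (tail-Unique u″) t∈ })
        where
        t∈R : _ ∈ R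
        t∈R = ∈-resp-↭ (↭-sym RF) (there (there t∈))

    go : PC L
    go with u , u∈ , w~u , u∉ ← pick [ p ] uL dw with ∈-resp-↭ (↭-trans perm (prep w perm′)) u∈
    ... | 1st = contradiction refl (~⇒≢ w~u)
    ... | 2nd = contradiction 1st u∉
    ... | 3rd = Lifts.lift-q uL full pq pc qc pq′ pc′ qc′ rs near c~r₀ wp w~u
      where open Front r₀∈
    ... | 4th = Lifts.lift-p′ uL full pq pc qc pq′ pc′ qc′ rs near c~r₀ wp w~u
      where open Front r₀∈
    ... | 5th = Lifts.lift-q′ uL full pq pc qc pq′ pc′ qc′ rs near c~r₀ wp w~u
      where open Front r₀∈
    ... | 6th = Lifts.lift-c uL full pq pc qc pq′ pc′ qc′ rs near c~r₀ wp w~u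
      where open Front r₀∈
    ... | there (there (there (there (there (there u∈R))))) = Lifts.lift-r uL full pq pc qc pq′ pc′ qc′ rs near wp w~u
      where open Front u∈R

  Res : List V → Set
  Res L = PC L ⊎ Exc L

  -- In the bridge case the edge bound forces `w` to have at least `length R` neighbours. If none of
  -- them lies on the two triangles, `w` is adjacent to the whole clique and joins it, which gives
  -- the next larger `Gₙ`. In all other cases a lemma of `Lifts` applies.
  lift : ∀ {L w L′} → Unique L → L ↭ w ∷ L′ → 2 ≤ dg L w → threshold (length L) ≤ e L → Exc L′ → Res L
  lift uL perm dw ed (b , inj₁ third) = inj₁ (lift-third uL perm dw b third)
  lift {L} {w} {L′} uL perm dw ed (b , inj₂ br@(r₀ , r₀∈ , c~r₀ , only , comp , big)) =
    go (w ~? p) (w ~? q) (w ~? p′) (w ~? q′) (w ~? c)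
    where
    open Bowtie b renaming (perm to perm′)
    full : L ↭ w ∷ p ∷ q ∷ p′ ∷ q′ ∷ c ∷ R
    full = ↭-trans perm (prep w perm′)
    u′ : Unique (w ∷ p ∷ q ∷ p′ ∷ q′ ∷ c ∷ R)
    u′ = Unique-resp-↭ full uL
    uR : Unique R
    uR = ++-Uniqueʳ (w ∷ p ∷ q ∷ p′ ∷ q′ ∷ c ∷ []) u′
    uL′ : Unique L′
    uL′ = tail-Unique (Unique-resp-↭ perm uL)

    dL′ : dg L w ≡ dg L′ w
    dL′ = ≡.trans (dg-↭ w perm) (dg-self {L′} {w})

    many : length R ≤ dg L w
    many = +-cancelʳ-≤ (7 + tri (length R)) (length R) (dg L w) (begin
      length R + (7 + tri (length R))
        ≡⟨ solve 2 (λ a b → a :+ (con 7 :+ b) := (a :+ b) :+ con 7) refl (length R) (tri (length R)) ⟩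
      threshold (6 + length R)           ≡⟨ cong threshold (↭-length full) ⟨
      threshold (length L)               ≤⟨ ed ⟩
      e L                        ≡⟨ e-↭ perm ⟩
      dg L′ w + e L′             ≡⟨ cong (_+ e L′) dL′ ⟨
      dg L w + e L′              ≤⟨ +-monoʳ-≤ (dg L w) (e-bowtie uL′ b br) ⟩
      dg L w + (7 + tri (length R)) ∎)
      where
      open ≤-Reasoning
      open +-*-Solver

    kept : ∀ {v} → v ∈ L′ → ¬ w ~ v → dg L′ v ≤ 2 → dg L v ≤ 2
    kept v∈ w≁v = ≤-trans (≤-reflexive (≡.trans (dg-↭ _ perm) (dg-no {L′} (w≁v ∘ ~-sym))))

    at : ∀ {v} → v ∈ p ∷ q ∷ p′ ∷ q′ ∷ c ∷ R → v ∈ L′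
    at = ∈-resp-↭ (↭-sym perm′)

    go : Dec (w ~ p) → Dec (w ~ q) → Dec (w ~ p′) → Dec (w ~ q′) → Dec (w ~ c) → Res L
    go (yes wp) _ _ _ _ = inj₁ (lift-bridge-outer uL perm dw b br wp)
    go _ (yes wq) _ _ _ = inj₁ (lift-bridge-outer uL perm dw (swap-in b) br wq)
    go _ _ (yes wp′) _ _ = inj₁ (lift-bridge-outer uL perm dw (swap-across b) br wp′)
    go _ _ _ (yes wq′) _ = inj₁ (lift-bridge-outer uL perm dw (swap-in (swap-across b)) br wq′)
    -- `w` has at least `length R ≥ 3` neighbours, so one of them is neither `c` nor `r₀`. It lies
    -- in the clique and closes the 4-cycle through `c`, `w` and `r₀`.
    go (no np) (no nq) (no np′) (no nq′) (yes wc)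
      with u , u∈ , w~u , u∉ ← pick (c ∷ r₀ ∷ []) uL (≤-trans big many) with ∈-resp-↭ full u∈
    ... | 1st = contradiction refl (~⇒≢ w~u)
    ... | 2nd = contradiction w~u np
    ... | 3rd = contradiction w~u nq
    ... | 4th = contradiction w~u np′
    ... | 5th = contradiction w~u nq′
    ... | 6th = contradiction 1st u∉
    ... | there (there (there (there (there (there u∈R)))))
      with R′ , RF ← two-first r₀∈ u∈R (λ { refl → u∉ 2nd }) =
      inj₁ (Lifts.lift-cr uL (↭-trans full (++⁺ˡ (w ∷ p ∷ q ∷ p′ ∷ q′ ∷ c ∷ []) RF)) pq pc qc pq′ pc′ qc′
             (comp r₀∈ u∈R (λ { refl → u∉ 2nd })) (near RF) c~r₀ wc w~u)
      where
      near : ∀ {R′} → R ↭ r₀ ∷ u ∷ R′ → ∀ {t} → t ∈ R′ → t ~ r₀ × t ~ u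
      near RF t∈ = comp t∈R r₀∈ (λ { refl → Unique[x∷xs]⇒x∉xs u″ (there t∈) })
                 , comp t∈R u∈R (λ { refl → Unique[x∷xs]⇒x∉xs (tail-Unique u″) t∈ })
        where
        t∈R : _ ∈ R
        t∈R = ∈-resp-↭ (↭-sym RF) (there (there t∈))
        u″ = Unique-resp-↭ RF uR
    go (no np) (no nq) (no np′) (no nq′) (no nc) = inj₂ (record
      { perm = ↭-trans full (↭-sym (shift-to-end)) ; pq = pq ; pc = pc ; qc = qc ; pq′ = pq′ ; pc′ = pc′ ; qc′ = qc′
      ; dp  = kept (at 1st) np dp
      ; dq  = kept (at 2nd) nq dq
      ; dp′ = kept (at 3rd) np′ dp′
      ; dq′ = kept (at 4th) nq′ dq′ }
      , inj₂ (r₀ , there r₀∈ , c~r₀ ,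
          (λ { 1st c~w → contradiction (~-sym c~w) nc ; (there r∈) → only r∈ }) ,
          (λ { 1st 1st ne → contradiction refl ne
             ; 1st (there y∈) _  → w~R y∈
             ; (there x∈) 1st _  → ~-sym (w~R x∈)
             ; (there x∈) (there y∈)     → comp x∈ y∈ }) ,
          ≤-trans big (n≤1+n _)))
      where
      shift-to-end : p ∷ q ∷ p′ ∷ q′ ∷ c ∷ w ∷ R ↭ w ∷ p ∷ q ∷ p′ ∷ q′ ∷ c ∷ R
      shift-to-end = shift w (p ∷ q ∷ p′ ∷ q′ ∷ c ∷ []) R
      in-R : ∀ {u} → u ∈ L → w ~ u → u ∈ R
      in-R u∈ w~u with ∈-resp-↭ full u∈
      ... | 1st = contradiction refl (~⇒≢ w~u)
      ... | 2nd = contradiction w~u np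
      ... | 3rd = contradiction w~u nq
      ... | 4th = contradiction w~u np′
      ... | 5th = contradiction w~u nq′
      ... | 6th = contradiction w~u nc
      ... | there (there (there (there (there (there u∈R))))) = u∈R
      w~R : ∀ {x} → x ∈ R → w ~ x
      w~R = dg-full (≤-trans many (dg-mono uL in-R))

  nonempty : ∀ {T : List V} {t} → t ∈ T → 1 ≤ length T
  nonempty (here _)  = s≤s z≤n
  nonempty (there _) = s≤s z≤n

  -- The induction step: removable vertices

  module Induction {L : List V} (good : Good L) (IH : ∀ {L′} → length L′ < length L → Good L′ → Res L′) where

    open Good good public

    n : ℕ
    n = length L

    Big Small : V → Set
    Big v   = 3 ≤ dg L v
    Small v = dg L v ≤ 2

    big? : ∀ v → Small v ⊎ Big v
    big? v with dg L v ≤? 2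
    ... | yes s = inj₁ s
    ... | no ¬s = inj₂ (≰⇒> ¬s)

    ¬both : ∀ {v} {A : Set} → Small v → Big v → A
    ¬both s b = contradiction b (<⇒≱ (s≤s s))

    not-small : ∀ {v} → ¬ Small v → Big v
    not-small ¬s = ≰⇒> ¬s

    -- A neighbour of degree at least 3 keeps degree at least 2, and `w` is absorbed again through
    -- two of its neighbours. For `n ≤ 7` at most six vertices remain, which is the case of
    -- `PC-small`; otherwise the bound on the degree of `w` carries the edge bound over to `L′`.
    reduce : ∀ {w L′} → L ↭ w ∷ L′ → Conn L′ → (∀ {u} → u ∈ L → w ~ u → Big u) → n ≤ 7 ⊎ dg L w + 6 ≤ n → Res L
    reduce {w} {L′} perm cn′ nbrs-big size-ok = go (length L′ ≤? 6) size-ok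
      where
      w∈ : w ∈ L
      w∈ = ∈-resp-↭ (↭-sym perm) 1st
      len : n ≡ suc (length L′)
      len = ↭-length perm
      u′ : Unique (w ∷ L′)
      u′ = Unique-resp-↭ perm uniq
      L′⊆ : L′ ⊆ L
      L′⊆ = ∈-resp-↭ (↭-sym perm) ∘ there

      deg′ : MinDeg 2 L′
      deg′ {v} v∈ with v ~? w
      ... | yes v~w = ≤-pred (≤-trans (nbrs-big (L′⊆ v∈) (~-sym v~w))
                        (≤-reflexive (≡.trans (dg-↭ v perm) (dg-yes {L′} v~w))))
      ... | no v≁w = ≤-trans (deg (L′⊆ v∈)) (≤-reflexive (≡.trans (dg-↭ v perm) (dg-no {L′} v≁w)))

      some : ∃[ v ] v ∈ L′
      some with a , a∈ , w~a , _ ← pick [] uniq (≤-trans (s≤s z≤n) (deg w∈)) =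
        a , ∈-tail (∈-resp-↭ perm a∈) (~⇒≢ w~a ∘ sym)

      attachW : PC L′ → PC L
      attachW pc
        with a , a∈ , w~a , _ ← pick [] uniq (≤-trans (s≤s z≤n) (deg w∈))
        with b , b∈ , w~b , b∉ ← pick [ a ] uniq (deg w∈) =
        PC-⊆ (∈-resp-↭ (↭-sym perm)) (∈-resp-↭ perm)
          (PC-∷ pc (∈-tail (∈-resp-↭ perm a∈) (~⇒≢ w~a ∘ sym)) (∈-tail (∈-resp-↭ perm b∈) (~⇒≢ w~b ∘ sym))
            (λ { refl → b∉ 1st }) (Unique[x∷xs]⇒x∉xs u′) w~a w~b)

      edges′ : ∀ m → n ≡ 8 + m → dg L w + 6 ≤ n → threshold (7 + m) ≤ e L′
      edges′ m n≡ room = +-cancelˡ-≤ (dg L′ w) _ _ (begin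
        dg L′ w + threshold (7 + m)                 ≤⟨ +-monoˡ-≤ (threshold (7 + m)) dw ⟩
        (2 + m) + (tri (2 + m) + 7)         ≡⟨ +-assoc (2 + m) (tri (2 + m)) 7 ⟨
        threshold (8 + m)                           ≡⟨ cong threshold n≡ ⟨
        threshold n                                 ≤⟨ edges ⟩
        e L                                 ≡⟨ e-↭ perm ⟩
        dg L′ w + e L′                      ∎)
        where
        open ≤-Reasoning
        dw : dg L′ w ≤ 2 + m
        dw = +-cancelʳ-≤ 6 _ _ (≤-trans (≤-reflexive (cong (_+ 6) (sym (≡.trans (dg-↭ w perm) (dg-self {L′} {w})))))
               (≤-trans room (≤-reflexive (≡.trans n≡ (+-comm 6 (2 + m))))))

      go : Dec (length L′ ≤ 6) → n ≤ 7 ⊎ dg L w + 6 ≤ n → Res L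
      go (yes small) _ = inj₁ (attachW (PC-small (tail-Unique u′) cn′ (proj₂ some) deg′ small))
      go (no large) (inj₁ n≤7) = contradiction (≤-trans (≤-reflexive (sym len)) n≤7) (<⇒≱ (s≤s (≰⇒> large)))
      go (no large) (inj₂ room) with k , eq ← m≤n⇒∃[o]m+o≡n (≰⇒> large) with IH (≤-reflexive (sym len)) record
        { uniq = tail-Unique u′ ; conn = cn′ ; deg = deg′ ; size = ≰⇒> large
        ; edges = subst (λ l → threshold l ≤ e L′) eq (edges′ k (≡.trans len (cong suc (sym eq))) room) }
      ... | inj₁ pc  = inj₁ (attachW pc)
      ... | inj₂ exc = lift uniq perm (deg w∈) edges exc

    single : ∀ {v} → v ∈ L → Small v → (∀ {u} → u ∈ L → v ~ u → Big u) → Res L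
    single {v} v∈ sv nbrs-big
      with L′ , perm ← extract v∈
      with a , a∈ , v~a , _ ← pick [] uniq (≤-trans (s≤s z≤n) (deg v∈))
      with conn? (tail-Unique (Unique-resp-↭ perm uniq)) (∈-tail (∈-resp-↭ perm a∈) (~⇒≢ v~a ∘ sym))
    ... | inj₁ cn′ = reduce perm cn′ nbrs-big (room (n ≤? 7))
      where
      room : Dec (n ≤ 7) → n ≤ 7 ⊎ dg L v + 6 ≤ n
      room (yes n≤7) = inj₁ n≤7
      room (no n≰7)  = inj₂ (≤-trans (+-monoˡ-≤ 6 sv) (≰⇒> n≰7))
    ... | inj₂ (A , B , split , a∈ , b∈ , none) = inj₁ (PC-cut good sv (↭-trans perm (prep v split)) a∈ b∈ none)

    -- A closed set of six vertices leaves out only vertices that miss five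
    -- others, so outside of S₀ and bs some vertex can be removed.
    absorb : ∀ {S₀} bs → ∃[ x ] x ∈ S₀ → Unique S₀ → S₀ ⊆ L → PC S₀ → n ≤ 7 ⊎ 6 ≤ length S₀ →
             length bs ≤ 2 → bs ⊆ L → (∀ {b} → b ∈ bs → Big b) → (∀ {b} → b ∈ bs → ∃[ x ] x ∈ S₀ × b ~ x) →
             (∀ {v u} → v ∈ L → Small v → u ∈ L → v ~ u → u ∈ S₀ ⊎ u ∈ bs) → Res L
    absorb {S₀} bs some₀ uS₀ sub₀ pc₀ size-ok bs≤2 bs⊆ bs-big bs-adj near = go
      where
      open Closure (close uniq uS₀ sub₀ pc₀)

      -- The removed vertex is taken outside `X`. Besides `S` this set holds `bs`, the neighbours of
      -- small vertices that `S₀` may miss, so that the removed vertex has no small neighbour.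
      in-X? : Decidable (_∈ bs ++ S)
      in-X? x = x ∈? (bs ++ S)

      X : List V
      X = filter in-X? L

      bs++S⊆L : bs ++ S ⊆ L
      bs++S⊆L x∈ = [ bs⊆ , S⊆ ]′ (∈-++⁻ bs x∈)

      cX : Conn X
      cX = Conn-⊆ (λ x∈ → ∈-filter⁺ in-X? (bs++S⊆L x∈) x∈) (λ x∈ → proj₂ (∈-filter⁻ in-X? {xs = L} x∈)) (add bs bs-adj)
        where
        add : ∀ bs → (∀ {b} → b ∈ bs → ∃[ x ] x ∈ S₀ × b ~ x) → Conn (bs ++ S)
        add []       _ = PC⇒Conn pc
        add (b ∷ bs) h = let x , x∈ , b~x = h 1st in
          Conn-∷ (add bs (h ∘ there)) (∈-++⁺ʳ bs (S₀⊆ x∈)) b~x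

      uX : Unique X
      uX = Unique-filter⁺ in-X? uniq

      X⊆L : X ⊆ L
      X⊆L x∈ = proj₁ (∈-filter⁻ in-X? x∈)

      inX : ∀ {x} → x ∈ bs ++ S → x ∈ X
      inX x∈ = ∈-filter⁺ in-X? (bs++S⊆L x∈) x∈

      -- A vertex left outside `S` belongs to `bs` and is big. It would have at most one neighbour
      -- in `S` and, as `bs` has at most two entries, at most one more: this is the reason for
      -- `length bs ≤ 2`.
      covered : L ⊆ X → Res L
      covered L⊆X with escape L S
      ... | inj₁ L⊆S = inj₁ (PC-⊆ S⊆ L⊆S pc)
      ... | inj₂ (t , t∈ , t∉)
        with R , p ← complement unique S⊆
        with R′ , q ← extract (outside p t∈ t∉) = contradiction (begin
          3                          ≤⟨ bs-big (out-bs 1st) ⟩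
          dg L t                     ≡⟨ dg-↭ t (↭-trans p (++⁺ˡ S q)) ⟩
          dg (S ++ t ∷ R′) t         ≡⟨ dg-++ S {t ∷ R′} t ⟩
          dg S t + dg (t ∷ R′) t     ≤⟨ +-mono-≤ (closed t∈ t∉) (≤-trans (≤-reflexive (dg-self {R′} {t})) (dg-≤ R′ t)) ⟩
          suc (length R′)            ≤⟨ Unique-⊆-length (++-Uniqueʳ S u′) out-bs ⟩
          length bs                  ≤⟨ bs≤2 ⟩
          2                          ∎) (<⇒≱ ≤-refl)
        where
        open ≤-Reasoning
        u′ : Unique (S ++ t ∷ R′)
        u′ = Unique-resp-↭ (↭-trans p (++⁺ˡ S q)) uniq
        out-bs : t ∷ R′ ⊆ bs
        out-bs {z} z∈ with ∈-++⁻ bs (proj₂ (∈-filter⁻ in-X? {xs = L} (L⊆X (∈-resp-↭ (↭-sym (↭-trans p (++⁺ˡ S q))) (∈-++⁺ʳ S z∈)))))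
        ... | inj₁ z∈bs = z∈bs
        ... | inj₂ z∈S  = contradiction z∈ (++-disjoint S u′ z∈S)

      go : Res L
      go with escape L X
      ... | inj₁ L⊆X = covered L⊆X
      ... | inj₂ (t , t∈ , t∉)
        with T , p ← complement uX X⊆L
        with w , L′ , w∈ , perm , cn′ ← noncut uniq conn cX p (_ , inX (∈-++⁺ʳ bs (S₀⊆ (proj₂ some₀)))) (nonempty (outside p t∈ t∉)) =
        reduce perm cn′ nbrs-big (room size-ok)
        where
        w∈L : w ∈ L
        w∈L = ∈-resp-↭ (↭-sym perm) 1st
        w∉X : w ∉ X
        w∉X w∈X = ++-disjoint X (Unique-resp-↭ p uniq) w∈X w∈
        nbrs-big : ∀ {u} → u ∈ L → w ~ u → Big u
        nbrs-big {u} u∈ w~u with big? u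
        ... | inj₂ b = b
        ... | inj₁ s = contradiction
          ([ (λ w∈S₀ → inX (∈-++⁺ʳ bs (S₀⊆ w∈S₀))) , (λ w∈bs → inX (∈-++⁺ˡ w∈bs)) ]′ (near u∈ s w∈L (~-sym w~u))) w∉X
        w∉S : w ∉ S
        w∉S = w∉X ∘ inX ∘ ∈-++⁺ʳ bs
        room : n ≤ 7 ⊎ 6 ≤ length S₀ → n ≤ 7 ⊎ dg L w + 6 ≤ n
        room (inj₁ n≤7) = inj₁ n≤7
        room (inj₂ six) = inj₂ (≤-trans (+-monoʳ-≤ (dg L w) (≤-trans six (Unique-⊆-length uS₀ S₀⊆)))
                            (closed-miss uniq unique S⊆ w∈L w∉S (closed w∈L w∉S)))

    no-small : (∀ {v} → v ∈ L → Big v) → ∀ {v₀} → v₀ ∈ L → Res L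
    no-small all-big v₀∈ with long-path 3 uniq conn v₀∈ all-big
    ... | _ , _ , ps , p , ups , sub , inj₁ all = inj₁ (PC-⊆ sub all (PC-path p ups))
    ... | _ , _ , ps , p , ups , sub , inj₂ seven =
      absorb [] (_ , Path-start p) ups sub (PC-path p ups) (inj₂ (≤-trans (n≤1+n _) seven)) z≤n (λ ()) (λ ()) (λ ())
        (λ v∈ s → ¬both s (all-big v∈))

    -- Ears: finding paths of vertices of degree 2

    other-neighbour : ∀ {v a} → Small v → v ∈ L → a ∈ L → v ~ a →
      ∃[ z ] z ∈ L × v ~ z × z ≢ a × (∀ {u} → u ∈ L → v ~ u → u ≡ a ⊎ u ≡ z)
    other-neighbour {v} {a} sv v∈ a∈ v~a with z , z∈ , v~z , z∉ ← pick [ a ] uniq (deg v∈) =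
      z , z∈ , v~z , (λ z≡a → z∉ (here z≡a)) , λ {u} u∈ v~u → only u∈ v~u (u ≟ a) (u ≟ z)
      where
      only : ∀ {u} → u ∈ L → v ~ u → Dec (u ≡ a) → Dec (u ≡ z) → u ≡ a ⊎ u ≡ z
      only u∈ v~u (yes u≡a) _ = inj₁ u≡a
      only u∈ v~u _ (yes u≡z) = inj₂ u≡z
      only {u} u∈ v~u (no u≢a) (no u≢z) = contradiction
        (dg-≥ (u ∷ a ∷ z ∷ []) ((u≢a ∷ u≢z ∷ []) ∷ ((λ a≡z → z∉ (here (sym a≡z))) ∷ []) ∷ [] ∷ [])
          (λ { 1st → u∈ ; 2nd → a∈ ; 3rd → z∈ })
          (λ { 1st → v~u ; 2nd → v~a ; 3rd → v~z }))
        (<⇒≱ (s≤s sv))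

    -- An ear: a maximal path Q of vertices of degree 2, from x to y, whose ends
    -- are attached to the vertices a and b of larger degree, possibly equal.
    record Ear : Set where
      field
        {a b x y} : V
        {Q}   : List V
        path  : Path x y Q
        a~x   : a ~ x
        y~b   : y ~ b
        uQ    : Unique Q
        Q⊆    : Q ⊆ L
        two   : 2 ≤ length Q
        small : ∀ {v} → v ∈ Q → Small v
        a∈    : a ∈ L
        b∈    : b ∈ L
        big-a : Big a
        big-b : Big b
        nbrs  : ∀ {v u} → v ∈ Q → u ∈ L → v ~ u → u ∈ Q ⊎ u ≡ a ⊎ u ≡ b

      big∉ : ∀ {v} → Big v → v ∉ Q
      big∉ bv v∈ = ¬both (small v∈) bv

      x∈Q : x ∈ Q
      x∈Q = Path-start path

      y∈Q : y ∈ Q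
      y∈Q = Path-end path

    ear-reverse : (E : Ear) → Σ[ E′ ∈ Ear ] Ear.a E′ ≡ Ear.b E × Ear.b E′ ≡ Ear.a E × Ear.Q E ↭ Ear.Q E′
    ear-reverse E with ws , q , π ← Path-reverse (Ear.path E) = record
      { path = q ; a~x = ~-sym y~b ; y~b = ~-sym a~x ; uQ = Unique-resp-↭ π uQ
      ; Q⊆ = Q⊆ ∘ ∈-resp-↭ (↭-sym π) ; two = subst (2 ≤_) (↭-length π) two
      ; small = small ∘ ∈-resp-↭ (↭-sym π) ; a∈ = b∈ ; b∈ = a∈ ; big-a = big-b ; big-b = big-a
      ; nbrs = λ v∈ u∈ v~u → [ (λ u∈Q → inj₁ (∈-resp-↭ π u∈Q)) , [ inj₂ ∘ inj₂ , inj₂ ∘ inj₁ ]′ ]′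
                               (nbrs (∈-resp-↭ (↭-sym π) v∈) u∈ v~u) } , refl , refl , π
      where open Ear E

    private
      module Er = Ear

    -- Satisfied by unions of ears. A path of small vertices that starts outside `Z` can never enter
    -- it.
    Separate : List V → Set
    Separate Z = ∀ {z u} → z ∈ Z → u ∈ L → z ~ u → u ∈ Z ⊎ Big u

    Avoiding : List V → Set
    Avoiding Z = Σ[ E ∈ Ear ] (∀ {v} → v ∈ Ear.Q E → v ∉ Z)

    -- From `a` through `x₁`, each small vertex is left by its other neighbour until a big vertex is
    -- met. The walk cannot run into itself, because the earlier vertices have their neighbours on
    -- the path or equal to `a`. If it ends at once, both neighbours of `x₁` are big, which is the
    -- case of `single`.
    follow : ∀ {Z a x₁} → Separate Z → a ∈ L → Big a → x₁ ∈ L → Small x₁ → x₁ ∉ Z → x₁ ~ a → Res L ⊎ Avoiding Z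
    follow {Z} {a} {x₁} sep a∈ big-a x₁∈ small₁ x₁∉ x₁~a =
      go n (m≤m+n n 1) (stop x₁) ([] ∷ []) (λ { 1st → x₁∈ }) (λ { 1st → small₁ }) (λ { 1st → x₁∉ })
         a∈ x₁~a (inj₂ refl) (λ { 1st x~x → contradiction refl (~⇒≢ x~x) })
         (λ { 1st v≢x → contradiction refl v≢x }) (inj₁ refl)
      where
      go : ∀ k {x prev Q} → n ≤ k + length Q → Path x x₁ Q → Unique Q → Q ⊆ L → (∀ {v} → v ∈ Q → Small v) →
           (∀ {v} → v ∈ Q → v ∉ Z) → prev ∈ L → x ~ prev → prev ∈ Q ⊎ prev ≡ a →
           (∀ {v} → v ∈ Q → v ~ x → v ≡ prev) →
           (∀ {v u} → v ∈ Q → v ≢ x → u ∈ L → v ~ u → u ∈ Q ⊎ u ≡ a) →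
           prev ≡ a ⊎ 2 ≤ length Q → Res L ⊎ Avoiding Z
      go k {x} {prev} {Q} len p uQ Q⊆ small ∉Z prev∈ x~prev prev-ok only-prev nbrs long
        with z , z∈ , x~z , z≢prev , only ← other-neighbour (small (Path-start p)) (Q⊆ (Path-start p)) prev∈ x~prev
        with big? z
      ... | inj₂ big-z = end long
        where
        end : prev ≡ a ⊎ 2 ≤ length Q → Res L ⊎ Avoiding Z
        -- The path was built from its far end, so the last vertex `z` becomes the first attachment
        -- of the ear and the starting point `a` the second.
        end (inj₂ two) = inj₂ (record
          { path = p ; a~x = ~-sym x~z ; y~b = x₁~a ; uQ = uQ ; Q⊆ = Q⊆ ; two = two ; small = small
          ; a∈ = z∈ ; b∈ = a∈ ; big-a = big-z ; big-b = big-a ; nbrs = all-nbrs } , ∉Z)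
          where
          all-nbrs : ∀ {v u} → v ∈ Q → u ∈ L → v ~ u → u ∈ Q ⊎ u ≡ z ⊎ u ≡ a
          all-nbrs {v} v∈ u∈ v~u with v ≟ x
          ... | no v≢x = [ inj₁ , inj₂ ∘ inj₂ ]′ (nbrs v∈ v≢x u∈ v~u)
          ... | yes refl with only u∈ v~u
          ...   | inj₁ refl = [ inj₁ , inj₂ ∘ inj₂ ]′ prev-ok
          ...   | inj₂ refl = inj₂ (inj₁ refl)
        end (inj₁ refl) = inj₁ (single (Q⊆ (Path-start p)) (small (Path-start p)) λ u∈ x~u →
          [ (λ { refl → big-a }) , (λ { refl → big-z }) ]′ (only u∈ x~u))
      ... | inj₁ small-z with k
      ...   | zero = contradiction (Unique-⊆-length (∷-Unique z∉Q uQ) λ { 1st → z∈ ; (there v∈) → Q⊆ v∈ }) (≤⇒≯ len)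
        where
        z∉Q : z ∉ Q
        z∉Q z∈Q = z≢prev (only-prev z∈Q (~-sym x~z))
      ...   | suc k = go k (≤-trans len (≤-reflexive (sym (+-suc k _)))) (~-sym x~z ◅ p) (∷-Unique z∉Q uQ)
          (λ { 1st → z∈ ; (there v∈) → Q⊆ v∈ })
          (λ { 1st → small-z ; (there v∈) → small v∈ })
          (λ { 1st → z∉Z ; (there v∈) → ∉Z v∈ })
          (Q⊆ (Path-start p)) (~-sym x~z) (inj₁ (there (Path-start p))) only-x nbrs′ (inj₂ (s≤s (nonempty (Path-start p))))
        where
        z∉Q : z ∉ Q
        z∉Q z∈Q = z≢prev (only-prev z∈Q (~-sym x~z))
        z∉Z : z ∉ Z
        z∉Z z∈Z = [ ∉Z (Path-start p) , (λ bx → ¬both (small (Path-start p)) bx) ]′ (sep z∈Z (Q⊆ (Path-start p)) (~-sym x~z))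
        only-x : ∀ {v} → v ∈ z ∷ Q → v ~ z → v ≡ x
        only-x 1st z~z = contradiction refl (~⇒≢ z~z)
        only-x {v} (there v∈) v~z with v ≟ x
        ... | yes v≡x = v≡x
        ... | no v≢x = [ (λ z∈Q → contradiction z∈Q z∉Q) , (λ { refl → ¬both small-z big-a }) ]′ (nbrs v∈ v≢x z∈ v~z)
        nbrs′ : ∀ {v u} → v ∈ z ∷ Q → v ≢ z → u ∈ L → v ~ u → u ∈ z ∷ Q ⊎ u ≡ a
        nbrs′ 1st v≢z _ _ = contradiction refl v≢z
        nbrs′ {v} (there v∈) v≢z u∈ v~u with v ≟ x
        ... | no v≢x = [ inj₁ ∘ there , inj₂ ]′ (nbrs v∈ v≢x u∈ v~u)
        ... | yes refl with only u∈ v~u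
        ...   | inj₁ refl = [ inj₁ ∘ there , inj₂ ]′ prev-ok
        ...   | inj₂ refl = inj₁ 1st

    -- Not all vertices are small: the graph would have at most `n` edges, fewer than `threshold n`.
    -- Connectivity thus gives an edge that leaves the small vertices outside `Z`, and by `Separate`
    -- it ends at a big vertex, from which `follow` starts.
    find-ear : ∀ Z → Separate Z → (∀ {v} → v ∈ L → Small v → v ∈ Z) ⊎ Res L ⊎ Avoiding Z
    find-ear Z sep with any? (λ v → (dg L v ≤? 2) ×-dec ¬? (v ∈? Z)) L
    ... | no none = inj₁ λ {v} v∈ sv → inside v∈ sv (v ∈? Z)
      where
      inside : ∀ {v} → v ∈ L → Small v → Dec (v ∈ Z) → v ∈ Z
      inside v∈ sv (yes v∈Z) = v∈Z
      inside v∈ sv (no v∉Z)  = contradiction (lose v∈ (sv , v∉Z)) none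
    ... | yes some with v , v∈ , sv , v∉ ← find some = inj₂ (start (escape L X))
      where
      in-X? : Decidable (λ u → Small u × u ∉ Z)
      in-X? u = (dg L u ≤? 2) ×-dec ¬? (u ∈? Z)
      X : List V
      X = filter in-X? L
      start : L ⊆ X ⊎ (∃[ t ] t ∈ L × t ∉ X) → Res L ⊎ Avoiding Z
      start (inj₁ L⊆X) = contradiction all-small (<⇒≱ too-big)
        where
        all-small : 2 * e L ≤ n * 2
        all-small = ≤-trans (≤-reflexive (sym (handshake L)))
          (sumdg-≤ L 2 λ u∈ → proj₁ (proj₂ (∈-filter⁻ in-X? {xs = L} (L⊆X u∈))))
        too-big : n * 2 < 2 * e L
        too-big with k , eq ← m≤n⇒∃[o]m+o≡n size = subst (λ m → m * 2 < 2 * e L) eq (begin-strict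
          (7 + k) * 2         ≡⟨ *-comm (7 + k) 2 ⟩
          2 * (7 + k)         <⟨ *-monoʳ-< 2 (≤-trans (s≤s (s≤s (≤-trans (≤-reflexive (+-comm 6 k)) (+-monoˡ-≤ 6 (m≤m+n k (tri k)))))) more) ⟩
          2 * threshold (7 + k)       ≤⟨ *-monoʳ-≤ 2 (≤-trans (≤-reflexive (cong threshold eq)) edges) ⟩
          2 * e L             ∎)
          where
          open ≤-Reasoning
          open +-*-Solver
          more : 2 + ((k + tri k) + 6) ≤ threshold (7 + k)
          more = ≤-trans (m≤m+n _ k) (≤-reflexive (solve 2 (λ k t → con 2 :+ ((k :+ t) :+ con 6) :+ k
                   := (con 1 :+ k) :+ (k :+ t) :+ con 7) refl k (tri k)))
      start (inj₂ (t , t∈ , t∉))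
        with x , y , x∈ , y∈ , x∈X , y∉X , x~y ← conn X v∈ (∈-filter⁺ in-X? v∈ (sv , v∉)) t∈ t∉
        with _ , sx , x∉Z ← ∈-filter⁻ in-X? {xs = L} x∈X with big? y
      ... | inj₂ big-y = follow sep y∈ big-y x∈ sx x∉Z x~y
      ... | inj₁ small-y with y ∈? Z
      ...   | no y∉Z = contradiction (∈-filter⁺ in-X? y∈ (small-y , y∉Z)) y∉X
      ...   | yes y∈Z = [ (λ x∈Z → contradiction x∈Z x∉Z) , (λ bx → ¬both sx bx) ]′ (sep y∈Z x∈ (~-sym x~y))

    absorb-path : ∀ {u v ps} bs → Path u v ps → Unique ps → ps ⊆ L → n ≤ 7 ⊎ 6 ≤ length ps →
                  length bs ≤ 2 → bs ⊆ L → (∀ {b} → b ∈ bs → Big b) → (∀ {b} → b ∈ bs → ∃[ x ] x ∈ ps × b ~ x) →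
                  (∀ {v u} → v ∈ L → Small v → u ∈ L → v ~ u → u ∈ ps ⊎ u ∈ bs) → Res L
    absorb-path bs p ups sub = absorb bs (_ , Path-start p) ups sub (PC-path p ups)

    -- One ear

    module OneEar (E : Ear) (all : ∀ {v} → v ∈ L → Small v → v ∈ Ear.Q E) where
      open Ear E

      X : List V
      X = a ∷ b ∷ Q

      step-out : ∀ {v u} → v ∈ L → v ∉ Q → v ≢ a → v ≢ b → u ∈ L → v ~ u → u ∉ Q
      step-out v∈ v∉ v≢a v≢b u∈ v~u u∈Q = [ v∉ , [ v≢a , v≢b ]′ ]′ (nbrs u∈Q v∈ (~-sym v~u))

      -- The ear is prolonged by `a` and three vertices beyond it, which makes at least six. Big
      -- vertices leave enough choice to avoid those already used, and beyond `a` and `b` no vertex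
      -- is adjacent to the ear. Only `b` may be a neighbour of a small vertex off the path, so it
      -- goes into `bs`.
      from-a : ∀ {u₁} → u₁ ∈ L → u₁ ∉ X → a ~ u₁ → Res L
      from-a {u₁} u₁∈ u₁∉ a~u₁
        with u₂ , u₂∈ , u₁~u₂ , u₂∉ ← pick (a ∷ b ∷ []) uniq (not-small λ s → u₁∉ (there (there (all u₁∈ s))))
        with u₂∉Q ← step-out u₁∈ (u₁∉ ∘ there ∘ there) (u₁∉ ∘ here) (u₁∉ ∘ there ∘ here) u₂∈ u₁~u₂
        with u₃ , u₃∈ , u₂~u₃ , u₃∉ ← pick (a ∷ u₁ ∷ []) uniq (not-small λ s → u₂∉Q (all u₂∈ s))
        with u₃∉Q ← step-out u₂∈ u₂∉Q (u₂∉ ∘ here) (u₂∉ ∘ there ∘ here) u₃∈ u₂~u₃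
        with Q′ , q , π ← Path-reverse path =
        absorb-path [ b ] p uP P⊆ (inj₂ long) (s≤s z≤n) (λ { 1st → b∈ }) (λ { 1st → big-b })
          (λ { 1st → y , ∈-++⁺ˡ (∈-resp-↭ π y∈Q) , ~-sym y~b })
          (λ v∈ sv u∈ v~u → [ (λ u∈Q → inj₁ (∈-++⁺ˡ (∈-resp-↭ π u∈Q)))
                            , [ (λ { refl → inj₁ (∈-++⁺ʳ Q′ 1st) }) , (λ { refl → inj₂ 1st }) ]′ ]′
                            (nbrs (all v∈ sv) u∈ v~u))
        where
        tl : List V
        tl = a ∷ u₁ ∷ u₂ ∷ u₃ ∷ []
        p : Path y u₃ (Q′ ++ tl)
        p = Path-++ q (~-sym a~x) (a~u₁ ◅ u₁~u₂ ◅ u₂~u₃ ◅ stop u₃)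
        tl∉ : ∀ {z} → z ∈ tl → z ∉ Q
        tl∉ 1st                         = big∉ big-a
        tl∉ 2nd                 = u₁∉ ∘ there ∘ there
        tl∉ 3rd         = u₂∉Q
        tl∉ 4th = u₃∉Q
        utl : Unique tl
        utl = (~⇒≢ a~u₁ ∷ (λ a≡u₂ → u₂∉ (here (sym a≡u₂))) ∷ (λ a≡u₃ → u₃∉ (here (sym a≡u₃))) ∷ [])
            ∷ (~⇒≢ u₁~u₂ ∷ (λ u₁≡u₃ → u₃∉ (there (here (sym u₁≡u₃)))) ∷ []) ∷ (~⇒≢ u₂~u₃ ∷ []) ∷ [] ∷ []
        uP : Unique (Q′ ++ tl)
        uP = Unique-++⁺ (Unique-resp-↭ π uQ) utl λ (z∈Q′ , z∈tl) → tl∉ z∈tl (∈-resp-↭ (↭-sym π) z∈Q′)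
        P⊆ : Q′ ++ tl ⊆ L
        P⊆ z∈ with ∈-++⁻ Q′ z∈
        ... | inj₁ z∈Q′ = Q⊆ (∈-resp-↭ (↭-sym π) z∈Q′)
        ... | inj₂ 1st = a∈
        ... | inj₂ 2nd = u₁∈
        ... | inj₂ 3rd = u₂∈
        ... | inj₂ 4th = u₃∈
        long : 6 ≤ length (Q′ ++ tl)
        long = ≤-trans (+-monoˡ-≤ 4 (≤-trans two (≤-reflexive (↭-length π)))) (≤-reflexive (sym (length-++ Q′)))

      spanning : L ⊆ X → Res L
      spanning L⊆X with a ≟ b
      ... | yes refl = inj₁ (PC-⊆ (λ { 1st → a∈ ; (there z∈) → Q⊆ z∈ })
              (λ z∈ → [ here , [ here , there ]′ ]′ (uncons (L⊆X z∈)))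
              (PC-path (a~x ◅ path) (∷-Unique (big∉ big-a) uQ)))
        where
        uncons : ∀ {z} → z ∈ X → z ≡ a ⊎ z ≡ b ⊎ z ∈ Q
        uncons (here p) = inj₁ p
        uncons (there (here p)) = inj₂ (inj₁ p)
        uncons (there (there p)) = inj₂ (inj₂ p)
      ... | no a≢b = inj₁ (PC-⊆ sub sup (PC-path (Path-++ (a~x ◅ path) y~b (stop b))
              (Unique-++⁺ (∷-Unique (big∉ big-a) uQ) ([] ∷ [])
                λ { (1st , 1st) → a≢b refl ; (there b∈Q , 1st) → big∉ big-b b∈Q })))
        where
        sub : (a ∷ Q) ++ [ b ] ⊆ L
        sub z∈ with ∈-++⁻ (a ∷ Q) z∈
        ... | inj₁ 1st = a∈
        ... | inj₁ (there z∈Q) = Q⊆ z∈Q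
        ... | inj₂ 1st = b∈
        sup : L ⊆ (a ∷ Q) ++ [ b ]
        sup z∈ with L⊆X z∈
        ... | 1st = 1st
        ... | 2nd = ∈-++⁺ʳ (a ∷ Q) 1st
        ... | there (there z∈Q) = there (∈-++⁺ˡ z∈Q)

    one-ear : (E : Ear) → (∀ {v} → v ∈ L → Small v → v ∈ Ear.Q E) → Res L
    one-ear E all with escape L (OneEar.X E all)
    ... | inj₁ L⊆X = OneEar.spanning E all L⊆X
    ... | inj₂ (t , t∈ , t∉) with conn (OneEar.X E all) (Ear.a∈ E) 1st t∈ t∉
    ...   | s , u , s∈ , u∈ , 1st , u∉ , s~u = OneEar.from-a E all u∈ u∉ s~u
    ...   | s , u , s∈ , u∈ , 2nd , u∉ , s~u with ear-reverse E
    ...     | E′ , refl , refl , π = OneEar.from-a E′ (λ v∈ sv → ∈-resp-↭ π (all v∈ sv)) u∈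
                (λ { 1st → u∉ 2nd ; 2nd → u∉ 1st
                   ; (there (there u∈Q)) → u∉ (there (there (∈-resp-↭ (↭-sym π) u∈Q))) }) s~u
    one-ear E all | inj₂ (t , t∈ , t∉) | s , u , s∈ , u∈ , there (there s∈Q) , u∉ , s~u with Ear.nbrs E s∈Q u∈ s~u
    ... | inj₁ u∈Q        = contradiction (there (there u∈Q)) u∉
    ... | inj₂ (inj₁ refl) = contradiction 1st u∉
    ... | inj₂ (inj₂ refl) = contradiction 2nd u∉

    -- Two ears

    module Chain (E₁ E₂ : Ear) (disj : ∀ {v} → v ∈ Er.Q E₂ → v ∉ Er.Q E₁)
                 {ms} (mid : Path (Er.a E₂) (Er.a E₁) ms) (ums : Unique ms) (ms⊆ : ms ⊆ L)
                 (ms∉₁ : ∀ {v} → v ∈ ms → v ∉ Er.Q E₁) (ms∉₂ : ∀ {v} → v ∈ ms → v ∉ Er.Q E₂) where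
      open Ear E₁ using () renaming (Q to Q₁; a to a₁; b to b₁; x to x₁; y to y₁)
      open Ear E₂ using () renaming (Q to Q₂; a to a₂; b to b₂; x to x₂; y to y₂)
      private
        R₂ = Path-reverse (Er.path E₂)
      Q₂′ : List V
      Q₂′ = proj₁ R₂
      π : Q₂ ↭ Q₂′
      π = proj₂ (proj₂ R₂)
      ps : List V
      ps = Q₂′ ++ (ms ++ Q₁)
      path : Path y₂ y₁ ps
      path = Path-++ (proj₁ (proj₂ R₂)) (~-sym (Er.a~x E₂)) (Path-++ mid (Er.a~x E₁) (Er.path E₁))
      ups : Unique ps
      ups = Unique-++⁺ (Unique-resp-↭ π (Er.uQ E₂))
              (Unique-++⁺ ums (Er.uQ E₁) λ (z∈ms , z∈Q₁) → ms∉₁ z∈ms z∈Q₁)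
              λ (z∈Q₂′ , z∈) → [ (λ z∈ms → ms∉₂ z∈ms (∈-resp-↭ (↭-sym π) z∈Q₂′)) , disj (∈-resp-↭ (↭-sym π) z∈Q₂′) ]′ (∈-++⁻ ms z∈)
      ps⊆ : ps ⊆ L
      ps⊆ z∈ with ∈-++⁻ Q₂′ z∈
      ... | inj₁ z∈Q₂′ = Er.Q⊆ E₂ (∈-resp-↭ (↭-sym π) z∈Q₂′)
      ... | inj₂ z∈ = [ ms⊆ , Er.Q⊆ E₁ ]′ (∈-++⁻ ms z∈)
      Q₁-in : Q₁ ⊆ ps
      Q₁-in = ∈-++⁺ʳ Q₂′ ∘ ∈-++⁺ʳ ms
      Q₂-in : Q₂ ⊆ ps
      Q₂-in = ∈-++⁺ˡ ∘ ∈-resp-↭ π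
      ms-in : ms ⊆ ps
      ms-in = ∈-++⁺ʳ Q₂′ ∘ ∈-++⁺ˡ
      len : length ps ≡ length Q₂ + (length ms + length Q₁)
      len = ≡.trans (length-++ Q₂′) (cong₂ _+_ (sym (↭-length π)) (length-++ ms))

    Covered : Ear → Ear → Set
    Covered E₁ E₂ = ∀ {v} → v ∈ L → Small v → v ∈ Er.Q E₁ ++ Er.Q E₂

    module TwoEars (E₁ E₂ : Ear) (disj : ∀ {v} → v ∈ Er.Q E₂ → v ∉ Er.Q E₁) (all : Covered E₁ E₂) where
      open Ear E₁ using () renaming (Q to Q₁; a to a₁; b to b₁; x to x₁; y to y₁)
      open Ear E₂ using () renaming (Q to Q₂; a to a₂; b to b₂; x to x₂; y to y₂)

      big∉₁ : ∀ {v} → Big v → v ∉ Q₁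
      big∉₁ = Er.big∉ E₁
      big∉₂ : ∀ {v} → Big v → v ∉ Q₂
      big∉₂ = Er.big∉ E₂

      around : ∀ {v u} → v ∈ L → Small v → u ∈ L → v ~ u →
               u ∈ Q₁ ⊎ u ∈ Q₂ ⊎ u ∈ a₁ ∷ a₂ ∷ b₁ ∷ b₂ ∷ []
      around v∈ sv u∈ v~u with ∈-++⁻ Q₁ (all v∈ sv)
      ... | inj₁ v∈Q₁ = [ inj₁ , [ inj₂ ∘ inj₂ ∘ here , inj₂ ∘ inj₂ ∘ there ∘ there ∘ here ]′ ]′ (Er.nbrs E₁ v∈Q₁ u∈ v~u)
      ... | inj₂ v∈Q₂ = [ inj₂ ∘ inj₁ , [ inj₂ ∘ inj₂ ∘ there ∘ here , inj₂ ∘ inj₂ ∘ there ∘ there ∘ there ∘ here ]′ ]′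
                          (Er.nbrs E₂ v∈Q₂ u∈ v~u)

      -- Two vertices from each ear and the distinct `a₁` and `a₂` make six. The other attachments
      -- `b₁` and `b₂` may be missed by the path and fill `bs`.
      apart : ∀ {ms} → Path a₂ a₁ ms → Unique ms → ms ⊆ L → (∀ {v} → v ∈ ms → v ∉ Q₁) → (∀ {v} → v ∈ ms → v ∉ Q₂) →
              a₁ ≢ a₂ → Res L
      apart {ms} mid ums ms⊆ ms∉₁ ms∉₂ a₁≢a₂ =
        absorb-path (b₁ ∷ b₂ ∷ []) path ups ps⊆ (inj₂ long) ≤-refl
          (λ { 1st → Er.b∈ E₁ ; 2nd → Er.b∈ E₂ })
          (λ { 1st → Er.big-b E₁ ; 2nd → Er.big-b E₂ })
          (λ { 1st → y₁ , Q₁-in (Er.y∈Q E₁) , ~-sym (Er.y~b E₁)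
             ; 2nd → y₂ , Q₂-in (Er.y∈Q E₂) , ~-sym (Er.y~b E₂) })
          (λ v∈ sv u∈ v~u → place (around v∈ sv u∈ v~u))
        where
        open Chain E₁ E₂ disj mid ums ms⊆ ms∉₁ ms∉₂
        place : ∀ {u} → u ∈ Q₁ ⊎ u ∈ Q₂ ⊎ u ∈ a₁ ∷ a₂ ∷ b₁ ∷ b₂ ∷ [] → u ∈ ps ⊎ u ∈ b₁ ∷ b₂ ∷ []
        place (inj₁ u∈)                                = inj₁ (Q₁-in u∈)
        place (inj₂ (inj₁ u∈))                         = inj₁ (Q₂-in u∈)
        place (inj₂ (inj₂ 1st))                = inj₁ (ms-in (Path-end mid))
        place (inj₂ (inj₂ 2nd))        = inj₁ (ms-in (Path-start mid))
        place (inj₂ (inj₂ (there (there u∈))))         = inj₂ u∈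
        long : 6 ≤ length ps
        long = ≤-trans (+-mono-≤ (Er.two E₂) (+-mono-≤
                 (Unique-⊆-length {a₁ ∷ a₂ ∷ []} ((a₁≢a₂ ∷ []) ∷ [] ∷ [])
                   λ { 1st → Path-end mid ; 2nd → Path-start mid }) (Er.two E₁)))
                 (≤-reflexive (sym len))

      module Shared (a₂≡a₁ : a₂ ≡ a₁) where
        mid : Path a₂ a₁ [ a₁ ]
        mid = subst (λ v → Path v a₁ [ a₁ ]) (sym a₂≡a₁) (stop a₁)
        open Chain E₁ E₂ disj mid ([] ∷ []) (All.lookup (Er.a∈ E₁ ∷ []))
               (All.lookup (big∉₁ (Er.big-a E₁) ∷ [])) (All.lookup (big∉₂ (Er.big-a E₁) ∷ [])) public

        -- The path Q₂, a₁, Q₁, b₁.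
        distinct : b₁ ≢ a₁ → Res L
        distinct b₁≢a₁ =
          absorb-path [ b₂ ] (Path-++ path (Er.y~b E₁) (stop b₁))
            (Unique-++⁺ ups ([] ∷ []) λ { (b₁∈ , 1st) → b₁∉ b₁∈ })
            (λ z∈ → [ ps⊆ , (λ { 1st → Er.b∈ E₁ }) ]′ (∈-++⁻ ps z∈))
            (inj₂ long) (s≤s z≤n) (λ { 1st → Er.b∈ E₂ }) (λ { 1st → Er.big-b E₂ })
            (λ { 1st → y₂ , ∈-++⁺ˡ (Q₂-in (Er.y∈Q E₂)) , ~-sym (Er.y~b E₂) })
            (λ v∈ sv u∈ v~u → place (around v∈ sv u∈ v~u))
          where
          b₁∉ : b₁ ∉ ps
          b₁∉ b₁∈ with ∈-++⁻ Q₂′ b₁∈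
          ... | inj₁ b₁∈Q₂ = big∉₂ (Er.big-b E₁) (∈-resp-↭ (↭-sym π) b₁∈Q₂)
          ... | inj₂ (here b₁≡a₁) = b₁≢a₁ b₁≡a₁
          ... | inj₂ (there b₁∈Q₁) = big∉₁ (Er.big-b E₁) b₁∈Q₁
          place : ∀ {u} → u ∈ Q₁ ⊎ u ∈ Q₂ ⊎ u ∈ a₁ ∷ a₂ ∷ b₁ ∷ b₂ ∷ [] → u ∈ ps ++ [ b₁ ] ⊎ u ∈ [ b₂ ]
          place (inj₁ u∈)                                      = inj₁ (∈-++⁺ˡ (Q₁-in u∈))
          place (inj₂ (inj₁ u∈))                               = inj₁ (∈-++⁺ˡ (Q₂-in u∈))
          place (inj₂ (inj₂ 1st))                      = inj₁ (∈-++⁺ˡ (ms-in 1st))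
          place (inj₂ (inj₂ 2nd))              = inj₁ (∈-++⁺ˡ (ms-in (here a₂≡a₁)))
          place (inj₂ (inj₂ 3rd))      = inj₁ (∈-++⁺ʳ ps 1st)
          place (inj₂ (inj₂ (there (there (there u∈)))))       = inj₂ u∈
          long : 6 ≤ length (ps ++ [ b₁ ])
          long = ≤-trans (+-monoˡ-≤ 1 (≤-trans (+-mono-≤ (Er.two E₂) (+-monoʳ-≤ 1 (Er.two E₁))) (≤-reflexive (sym len))))
                   (≤-reflexive (sym (length-++ ps)))

        -- All four attachments coincide, so the path through both ears contains every neighbour of
        -- a small vertex. It can be too short only if each ear is a single edge, that is, for two
        -- triangles at `c`.
        module Same (b₁≡a₁ : b₁ ≡ a₁) (b₂≡a₁ : b₂ ≡ a₁) where
          c : V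
          c = a₁

          near : ∀ {v u} → v ∈ L → Small v → u ∈ L → v ~ u → u ∈ ps
          near v∈ sv u∈ v~u with around v∈ sv u∈ v~u
          ... | inj₁ u∈Q                                       = Q₁-in u∈Q
          ... | inj₂ (inj₁ u∈Q)                                = Q₂-in u∈Q
          ... | inj₂ (inj₂ 1st)                        = ms-in 1st
          ... | inj₂ (inj₂ 2nd)                = ms-in (here a₂≡a₁)
          ... | inj₂ (inj₂ 3rd)        = ms-in (here b₁≡a₁)
          ... | inj₂ (inj₂ 4th) = ms-in (here b₂≡a₁)

          enough : n ≤ 7 ⊎ 6 ≤ length ps → Res L
          enough ok = absorb-path [] path ups ps⊆ ok z≤n (λ ()) (λ ()) (λ ()) (λ v∈ sv u∈ v~u → inj₁ (near v∈ sv u∈ v~u))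

          Universal : V → Set
          Universal w = ∀ {u} → u ∈ L → u ∉ Q₁ → u ∉ Q₂ → u ≢ w → w ~ u

          away : ∀ {w u} → w ∈ L → w ∉ ps → u ∈ L → w ~ u → Big u
          away {u = u} w∈ w∉ u∈ w~u with big? u
          ... | inj₂ b = b
          ... | inj₁ s = contradiction (near u∈ s w∈ (~-sym w~u)) w∉

          -- A vertex `w` that can be split off without disconnecting the graph fails to be
          -- removable only if its degree is at least `n - 5`. It has no neighbour among the four
          -- vertices of the ears, so it is then adjacent to all the others.
          next : length Q₁ ≡ 2 → length Q₂ ≡ 2 → ∀ {X} → Unique X → X ⊆ L → Conn X → ps ⊆ X → length X < n →
                 Res L ⊎ ∃[ w ] w ∈ L × w ∉ X × Universal w
          next len₁ len₂ {X} uX X⊆ cX ps⊆X few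
            with T , p ← complement uX X⊆
            with w , L′ , w∈T , perm , cn′ ← noncut uniq conn cX p (_ , ps⊆X (Path-start path))
                   (+-cancelˡ-≤ (length X) 1 (length T) (≤-trans (≤-reflexive (+-comm (length X) 1))
                     (≤-trans few (≤-reflexive (≡.trans (↭-length p) (length-++ X))))))
            = go (dg L w + 6 ≤? n)
            where
            w∈ : w ∈ L
            w∈ = ∈-resp-↭ (↭-sym perm) 1st
            w∉X : w ∉ X
            w∉X w∈X = ++-disjoint X (Unique-resp-↭ p uniq) w∈X w∈T
            nbr-big : ∀ {u} → u ∈ L → w ~ u → Big u
            nbr-big = away w∈ (w∉X ∘ ps⊆X)
            go : Dec (dg L w + 6 ≤ n) → Res L ⊎ ∃[ w ] w ∈ L × w ∉ X × Universal w
            go (yes room) = inj₁ (reduce perm cn′ nbr-big (inj₂ room))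
            go (no tight) = inj₂ (w , w∈ , w∉X , universal (complement ubad bad⊆))
              where
              bad : List V
              bad = w ∷ (Q₁ ++ Q₂)
              ubad : Unique bad
              ubad = ∷-Unique (λ w∈Q → w∉X (ps⊆X ([ Q₁-in , Q₂-in ]′ (∈-++⁻ Q₁ w∈Q))))
                       (Unique-++⁺ (Er.uQ E₁) (Er.uQ E₂) λ (z∈₁ , z∈₂) → disj z∈₂ z∈₁)
              bad⊆ : bad ⊆ L
              bad⊆ 1st = w∈
              bad⊆ (there z∈)  = [ Er.Q⊆ E₁ , Er.Q⊆ E₂ ]′ (∈-++⁻ Q₁ z∈)
              universal : ∃[ R ] L ↭ bad ++ R → Universal w
              universal (R , split) u∈ u∉₁ u∉₂ u≢w = dg-full full (outside {X = bad} split u∈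
                λ { (here u≡w) → u≢w u≡w ; (there u∈Q) → [ u∉₁ , u∉₂ ]′ (∈-++⁻ Q₁ u∈Q) })
                where
                into-R : ∀ {u} → u ∈ L → w ~ u → u ∈ R
                into-R u∈ w~u = outside {X = bad} split u∈ λ where
                  1st → ~⇒≢ w~u refl
                  (there u∈Q) → [ (λ u∈₁ → ¬both (Er.small E₁ u∈₁) (nbr-big u∈ w~u))
                                , (λ u∈₂ → ¬both (Er.small E₂ u∈₂) (nbr-big u∈ w~u)) ]′ (∈-++⁻ Q₁ u∈Q)
                lenR : n ≡ 5 + length R
                lenR = ≡.trans (↭-length split) (≡.trans (length-++ bad)
                         (cong (λ k → suc k + length R) (≡.trans (length-++ Q₁) (cong₂ _+_ len₁ len₂))))
                full : length R ≤ dg R w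
                full = ≤-trans (≮⇒≥ λ lt → tight (≤-trans (≤-reflexive (+-comm (dg L w) 6))
                         (≤-trans (+-monoʳ-≤ 5 lt) (≤-reflexive (sym lenR))))) (dg-mono uniq into-R)

          -- Three universal vertices close a 4-cycle through c.
          triangles : length Q₁ ≡ 2 → length Q₂ ≡ 2 → 8 ≤ n → Res L
          triangles len₁ len₂ 8≤n = none (next len₁ len₂ ups ps⊆ (PC⇒Conn pc₀) (λ z∈ → z∈) (below 0 z≤n))
            where
            len₅ : length ps ≡ 5
            len₅ = ≡.trans len (cong₂ (λ k l → k + suc l) len₂ len₁)
            -- As `n ≥ 8`, at least three vertices lie outside the five of `ps`, so a third
            -- universal vertex can still be sought after two.
            below : ∀ k → k ≤ 2 → k + length ps < n
            below k k≤2 = ≤-trans (s≤s (≤-trans (+-mono-≤ k≤2 (≤-reflexive len₅)) ≤-refl)) 8≤n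
            c∈ : c ∈ ps
            c∈ = ms-in 1st
            uni : ∀ {w u} → Universal w → u ∈ L → u ∉ ps → u ≢ w → w ~ u
            uni U u∈ u∉ = U u∈ (u∉ ∘ Q₁-in) (u∉ ∘ Q₂-in)
            to-c : ∀ {w} → w ∉ ps → Universal w → w ~ c
            to-c w∉ U = U (Er.a∈ E₁) (big∉₁ (Er.big-a E₁)) (big∉₂ (Er.big-a E₁)) λ { refl → w∉ c∈ }
            pc₀ : PC ps
            pc₀ = PC-path path ups
            extend⊆ : ∀ {w X} → w ∈ L → X ⊆ L → w ∷ X ⊆ L
            extend⊆ w∈ X⊆ 1st = w∈
            extend⊆ w∈ X⊆ (there z∈)  = X⊆ z∈

            third : ∀ {w₁ w₂ w₃} → w₁ ∈ L → w₂ ∈ L → w₃ ∈ L → w₁ ∉ ps → w₂ ∉ w₁ ∷ ps → w₃ ∉ w₂ ∷ w₁ ∷ ps →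
                    Universal w₁ → Universal w₂ → Universal w₃ → Res L
            third {w₁} {w₂} {w₃} w₁∈ w₂∈ w₃∈ w₁∉ w₂∉ w₃∉ U₁ U₂ U₃ =
              absorb [] (_ , 1st) u₃ (extend⊆ w₃∈ (extend⊆ w₂∈ (extend⊆ w₁∈ ps⊆)))
                (PC-4-cycle pc₀ c∈ u₃ (~-sym (to-c (w₃∉ ∘ there ∘ there) U₃))
                  (uni U₃ w₂∈ (w₂∉ ∘ there) (λ { refl → w₃∉ 1st }))
                  (uni U₂ w₁∈ w₁∉ (λ { refl → w₂∉ 1st })) (to-c w₁∉ U₁))
                (inj₂ (≤-trans (n≤1+n 6) (≤-trans (n≤1+n 7) (≤-reflexive (cong (3 +_) (sym len₅))))))
                z≤n (λ ()) (λ ()) (λ ()) (λ v∈ sv u∈ v~u → inj₁ (there (there (there (near v∈ sv u∈ v~u)))))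
              where
              u₃ : Unique (w₃ ∷ w₂ ∷ w₁ ∷ ps)
              u₃ = ∷-Unique w₃∉ (∷-Unique w₂∉ (∷-Unique w₁∉ ups))

            Next : List V → Set
            Next X = Res L ⊎ ∃[ w ] w ∈ L × w ∉ X × Universal w

            second : ∀ {w₁ w₂} → w₁ ∈ L → w₂ ∈ L → w₁ ∉ ps → w₂ ∉ w₁ ∷ ps → Universal w₁ → Universal w₂ →
                     Next (w₂ ∷ w₁ ∷ ps) → Res L
            second _ _ _ _ _ _ (inj₁ r) = r
            second w₁∈ w₂∈ w₁∉ w₂∉ U₁ U₂ (inj₂ (_ , w₃∈ , w₃∉ , U₃)) = third w₁∈ w₂∈ w₃∈ w₁∉ w₂∉ w₃∉ U₁ U₂ U₃

            first : ∀ {w₁} → w₁ ∈ L → w₁ ∉ ps → Universal w₁ → Conn (w₁ ∷ ps) → Next (w₁ ∷ ps) → Res L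
            first _ _ _ _ (inj₁ r) = r
            first w₁∈ w₁∉ U₁ c₁ (inj₂ (_ , w₂∈ , w₂∉ , U₂)) = second w₁∈ w₂∈ w₁∉ w₂∉ U₁ U₂
              (next len₁ len₂ (∷-Unique w₂∉ (∷-Unique w₁∉ ups)) (extend⊆ w₂∈ (extend⊆ w₁∈ ps⊆))
                (Conn-∷ c₁ (there c∈) (to-c (w₂∉ ∘ there) U₂)) (there ∘ there) (below 2 ≤-refl))

            none : Next ps → Res L
            none (inj₁ r) = r
            none (inj₂ (_ , w₁∈ , w₁∉ , U₁)) = first w₁∈ w₁∉ U₁ c₁
              (next len₁ len₂ (∷-Unique w₁∉ ups) (extend⊆ w₁∈ ps⊆) c₁ there (below 1 (s≤s z≤n)))
              where
              c₁ : Conn (_ ∷ ps)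
              c₁ = Conn-∷ (PC⇒Conn pc₀) c∈ (to-c w₁∉ U₁)

          result : Res L
          result with n ≤? 7 | 6 ≤? length ps
          ... | yes n≤7 | _       = enough (inj₁ n≤7)
          ... | no _    | yes six = enough (inj₂ six)
          ... | no n≰7  | no ¬six = triangles (len-2 (Er.two E₁) (Er.two E₂) short) (len-2 (Er.two E₂) (Er.two E₁)
                                      (≤-trans (≤-reflexive (+-comm (length Q₂) (length Q₁))) short)) (≰⇒> n≰7)
            where
            short : length Q₁ + length Q₂ ≤ 4
            short = ≤-pred (≤-trans (≤-reflexive (≡.trans (cong suc (+-comm (length Q₁) (length Q₂)))
                      (≡.trans (sym (+-suc (length Q₂) (length Q₁))) (sym len)))) (≤-pred (≰⇒> ¬six)))
            len-2 : ∀ {k l} → 2 ≤ k → 2 ≤ l → k + l ≤ 4 → k ≡ 2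
            len-2 {k} {l} 2≤k 2≤l le = ≤-antisym (+-cancelʳ-≤ 2 k 2 (≤-trans (+-monoʳ-≤ k 2≤l) le)) 2≤k

    record Pair (E₁ E₂ : Ear) : Set where
      field
        disj : ∀ {v} → v ∈ Er.Q E₂ → v ∉ Er.Q E₁
        all  : Covered E₁ E₂

    open Pair

    pair-swap : ∀ {E₁ E₂} → Pair E₁ E₂ → Pair E₂ E₁
    pair-swap {E₁} P = record
      { disj = λ v∈₁ v∈₂ → disj P v∈₂ v∈₁
      ; all  = λ v∈ sv → [ ∈-++⁺ʳ _ , ∈-++⁺ˡ ]′ (∈-++⁻ (Er.Q E₁) (all P v∈ sv)) }

    pair-replace : ∀ {E₁ E₁′ E₂} → Er.Q E₁ ↭ Er.Q E₁′ → Pair E₁ E₂ → Pair E₁′ E₂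
    pair-replace {E₁} {E₁′} π P = record
      { disj = λ v∈₂ v∈₁ → disj P v∈₂ (∈-resp-↭ (↭-sym π) v∈₁)
      ; all  = λ v∈ sv → [ ∈-++⁺ˡ ∘ ∈-resp-↭ π , ∈-++⁺ʳ (Er.Q E₁′) ]′ (∈-++⁻ (Er.Q E₁) (all P v∈ sv)) }

    common-end : ∀ {E₁ E₂} → Pair E₁ E₂ → Er.a E₂ ≡ Er.a E₁ → Res L
    common-end {E₁} {E₂} P a₂≡a₁ with Er.b E₁ ≟ Er.a E₁ | Er.b E₂ ≟ Er.a E₁
    ... | no b₁≢a₁  | _         = TwoEars.Shared.distinct E₁ E₂ (disj P) (all P) a₂≡a₁ b₁≢a₁
    ... | yes _     | no b₂≢a₁  = TwoEars.Shared.distinct E₂ E₁ (disj (pair-swap P)) (all (pair-swap P)) (sym a₂≡a₁)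
                                    (λ b₂≡a₂ → b₂≢a₁ (≡.trans b₂≡a₂ a₂≡a₁))
    ... | yes b₁≡a₁ | yes b₂≡a₁ = TwoEars.Shared.Same.result E₁ E₂ (disj P) (all P) a₂≡a₁ b₁≡a₁ b₂≡a₁

    module Reach (E₁ E₂ : Ear) (P : Pair E₁ E₂) where
      open Ear E₁ using () renaming (Q to Q₁; a to a₁; b to b₁)
      open Ear E₂ using () renaming (Q to Q₂; a to a₂; b to b₂)

      Link : V → List V → Set
      Link t X = ∃[ s ] ∃[ ps ] (s ≡ a₁ ⊎ s ≡ b₁) × Path t s ps × Unique ps × ps ⊆ X

      Free : List V → Set
      Free X = ∀ {v} → v ∈ X → v ∈ L × v ∉ Q₁ × v ∉ Q₂

      -- A set that avoids both ears is grown from `a₁` and `b₁`, together with a path from each of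
      -- its vertices back to one of these two, until it contains an attachment of the second ear.
      link : ∃[ X ] ∃[ t ] Free X × (t ≡ a₂ ⊎ t ≡ b₂) × Link t X
      link = start (a₁ ≟ b₁)
        where
        Found : Set
        Found = ∃[ X ] ∃[ t ] Free X × (t ≡ a₂ ⊎ t ≡ b₂) × Link t X

        go : ∀ k {X} → n ≤ k + length X → Unique X → Free X → a₁ ∈ X → b₁ ∈ X → (∀ {t} → t ∈ X → Link t X) → Found
        go k {X} len uX free a₁∈ b₁∈ links with a₂ ∈? X | b₂ ∈? X
        ... | yes a₂∈ | _       = X , a₂ , free , inj₁ refl , links a₂∈
        ... | no _    | yes b₂∈ = X , b₂ , free , inj₂ refl , links b₂∈
        ... | no a₂∉  | no b₂∉
          -- Adding `Q₁` to the cut forces the edge to leave from `X`, since `Q₁` has no further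
          -- neighbours than `a₁` and `b₁`. It does not enter `Q₂` either, as `X` contains no
          -- attachment of the second ear yet.
          with s , t , s∈ , t∈ , s∈Y , t∉Y , s~t ← conn (X ++ Q₁) (Er.a∈ E₁) (∈-++⁺ˡ a₁∈) (Er.a∈ E₂)
                 (λ a₂∈ → [ a₂∉ , Er.big∉ E₁ (Er.big-a E₂) ]′ (∈-++⁻ X a₂∈))
          with ∈-++⁻ X s∈Y
        ...   | inj₂ s∈Q₁ = contradiction
                  ([ ∈-++⁺ʳ X , [ (λ { refl → ∈-++⁺ˡ a₁∈ }) , (λ { refl → ∈-++⁺ˡ b₁∈ }) ]′ ]′ (Er.nbrs E₁ s∈Q₁ t∈ s~t)) t∉Y
        ...   | inj₁ s∈X = extend k len
          where
          t∉Q₂ : t ∉ Q₂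
          t∉Q₂ t∈Q₂ = [ proj₂ (proj₂ (free s∈X)) , [ (λ { refl → a₂∉ s∈X }) , (λ { refl → b₂∉ s∈X }) ]′ ]′
                        (Er.nbrs E₂ t∈Q₂ s∈ (~-sym s~t))
          t∉X : t ∉ X
          t∉X = t∉Y ∘ ∈-++⁺ˡ
          free′ : Free (t ∷ X)
          free′ 1st = t∈ , t∉Y ∘ ∈-++⁺ʳ X , t∉Q₂
          free′ (there v∈)  = free v∈
          extend : ∀ k → n ≤ k + length X → Found
          extend zero    len = contradiction (Unique-⊆-length (∷-Unique t∉X uX) (proj₁ ∘ free′)) (≤⇒≯ len)
          extend (suc k) len = go k (≤-trans len (≤-reflexive (sym (+-suc k _)))) (∷-Unique t∉X uX) free′
            (there a₁∈) (there b₁∈) λ where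
              1st → let r , ps , r-end , p , ups , sub = links s∈X in
                r , t ∷ ps , r-end , ~-sym s~t ◅ p , ∷-Unique (t∉X ∘ sub) ups ,
                λ { 1st → 1st ; (there v∈) → there (sub v∈) }
              (there v∈) → let r , ps , r-end , p , ups , sub = links v∈ in r , ps , r-end , p , ups , there ∘ sub

        free-a : a₁ ∈ L × a₁ ∉ Q₁ × a₁ ∉ Q₂
        free-a = Er.a∈ E₁ , Er.big∉ E₁ (Er.big-a E₁) , Er.big∉ E₂ (Er.big-a E₁)
        free-b : b₁ ∈ L × b₁ ∉ Q₁ × b₁ ∉ Q₂
        free-b = Er.b∈ E₁ , Er.big∉ E₁ (Er.big-b E₁) , Er.big∉ E₂ (Er.big-b E₁)

        start : Dec (a₁ ≡ b₁) → Found
        start (yes a₁≡b₁) = go n {[ a₁ ]} (m≤m+n n 1) ([] ∷ []) (λ { 1st → free-a }) 1st (here (sym a₁≡b₁))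
          λ { 1st → a₁ , [ a₁ ] , inj₁ refl , stop a₁ , [] ∷ [] , λ v∈ → v∈ }
        start (no a₁≢b₁) = go n {a₁ ∷ b₁ ∷ []} (m≤m+n n 2) ((a₁≢b₁ ∷ []) ∷ [] ∷ [])
          (λ { 1st → free-a ; 2nd → free-b }) 1st 2nd λ where
            1st         → a₁ , [ a₁ ] , inj₁ refl , stop a₁ , [] ∷ [] , λ { 1st → 1st }
            2nd → b₁ , [ b₁ ] , inj₂ refl , stop b₁ , [] ∷ [] , λ { 1st → 2nd }

    -- Reversing ears turns any coincidence of their attachments into `a₂ ≡ a₁`. If there is none,
    -- the path of `link` joins the ears, again after reversing them so that it ends at the right
    -- attachments.
    two-ears : ∀ {E₁ E₂} → Pair E₁ E₂ → Res L
    two-ears {E₁} {E₂} P with ear-reverse E₁ | ear-reverse E₂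
    ... | E₁′ , a₁′≡b₁ , b₁′≡a₁ , π₁ | E₂′ , a₂′≡b₂ , b₂′≡a₂ , π₂ =
      go (Er.a E₂ ≟ Er.a E₁) (Er.a E₂ ≟ Er.b E₁) (Er.b E₂ ≟ Er.a E₁) (Er.b E₂ ≟ Er.b E₁)
      where
      P₁ : Pair E₁′ E₂
      P₁ = pair-replace π₁ P
      P₂ : Pair E₁ E₂′
      P₂ = pair-swap (pair-replace π₂ (pair-swap P))
      P₁₂ : Pair E₁′ E₂′
      P₁₂ = pair-replace π₁ P₂

      joined : ∀ {F₁ F₂} → Pair F₁ F₂ → ∀ {X} → (∀ {v} → v ∈ X → v ∈ L × v ∉ Er.Q E₁ × v ∉ Er.Q E₂) →
               Er.Q E₁ ↭ Er.Q F₁ → Er.Q E₂ ↭ Er.Q F₂ →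
               ∀ {ps} → Path (Er.a F₂) (Er.a F₁) ps → Unique ps → ps ⊆ X → Er.a F₂ ≢ Er.a F₁ → Res L
      joined {F₁} {F₂} P′ free σ₁ σ₂ p ups sub a₂≢a₁ = TwoEars.apart F₁ F₂ (disj P′) (all P′) p ups
        (λ v∈ → proj₁ (free (sub v∈)))
        (λ v∈ v∈Q → proj₁ (proj₂ (free (sub v∈))) (∈-resp-↭ (↭-sym σ₁) v∈Q))
        (λ v∈ v∈Q → proj₂ (proj₂ (free (sub v∈))) (∈-resp-↭ (↭-sym σ₂) v∈Q)) (a₂≢a₁ ∘ sym)

      go : Dec (Er.a E₂ ≡ Er.a E₁) → Dec (Er.a E₂ ≡ Er.b E₁) → Dec (Er.b E₂ ≡ Er.a E₁) → Dec (Er.b E₂ ≡ Er.b E₁) → Res L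
      go (yes eq) _ _ _ = common-end P eq
      go _ (yes eq) _ _ = common-end P₁ (≡.trans eq (sym a₁′≡b₁))
      go _ _ (yes eq) _ = common-end P₂ (≡.trans a₂′≡b₂ eq)
      go _ _ _ (yes eq) = common-end P₁₂ (≡.trans a₂′≡b₂ (≡.trans eq (sym a₁′≡b₁)))
      go (no aa) (no ab) (no ba) (no bb) with Reach.link E₁ E₂ P
      ... | X , _ , free , inj₁ refl , _ , ps , inj₁ refl , p , ups , sub = joined P free ↭-refl ↭-refl p ups sub aa
      ... | X , _ , free , inj₁ refl , _ , ps , inj₂ refl , p , ups , sub =
        joined P₁ free π₁ ↭-refl (subst (λ s → Path (Er.a E₂) s ps) (sym a₁′≡b₁) p) ups sub
          (λ eq → ab (≡.trans eq a₁′≡b₁))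
      ... | X , _ , free , inj₂ refl , _ , ps , inj₁ refl , p , ups , sub =
        joined P₂ free ↭-refl π₂ (subst (λ t → Path t (Er.a E₁) ps) (sym a₂′≡b₂) p) ups sub
          (λ eq → ba (≡.trans (sym a₂′≡b₂) eq))
      ... | X , _ , free , inj₂ refl , _ , ps , inj₂ refl , p , ups , sub =
        joined P₁₂ free π₁ π₂ (subst (λ t → Path t (Er.a E₁′) ps) (sym a₂′≡b₂) (subst (λ s → Path (Er.b E₂) s ps) (sym a₁′≡b₁) p)) ups sub
          (λ eq → bb (≡.trans (sym a₂′≡b₂) (≡.trans eq a₁′≡b₁)))

    -- Three ears

    first-two : ∀ {u v Q} → Path u v Q → 2 ≤ length Q → ∃[ s ] ∃[ t ] ∃[ M ] Q ≡ s ∷ t ∷ M × s ~ t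
    first-two (stop _) (s≤s ())
    first-two (s~t ◅ stop t)    _ = _ , t , [] , refl , s~t
    first-two (s~t ◅ (_ ◅ _)) _ = _ , _ , _ , refl , s~t

    path-2 : ∀ {u v Q} → Path u v Q → length Q ≡ 2 → Q ≡ u ∷ v ∷ [] × u ~ v
    path-2 (u~v ◅ stop v) refl = refl , u~v
    path-2 (_ ◅ _ ◅ stop _)  ()
    path-2 (_ ◅ _ ◅ _ ◅ _) ()

    path-3 : ∀ {u v Q} → Path u v Q → length Q ≡ 3 → ∃[ w ] Q ≡ u ∷ w ∷ v ∷ [] × u ~ w × w ~ v
    path-3 (_◅_ {w = w} u~w (w~v ◅ stop v)) refl = w , refl , u~w , w~v
    path-3 (_ ◅ _ ◅ _ ◅ stop _)  ()
    path-3 (_ ◅ _ ◅ _ ◅ _ ◅ _) ()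

    record Triple (E₁ E₂ E₃ : Ear) (Y : List V) : Set where
      constructor triple
      field order : L ↭ Er.Q E₁ ++ (Er.Q E₂ ++ (Er.Q E₃ ++ Y))

    open Triple

    swap₁₂ : ∀ {E₁ E₂ E₃ Y} → Triple E₁ E₂ E₃ Y → Triple E₂ E₁ E₃ Y
    swap₁₂ {E₁} {E₂} T = triple (↭-trans (order T) (shifts (Er.Q E₁) (Er.Q E₂)))

    swap₂₃ : ∀ {E₁ E₂ E₃ Y} → Triple E₁ E₂ E₃ Y → Triple E₁ E₃ E₂ Y
    swap₂₃ {E₁} {E₂} {E₃} T = triple (↭-trans (order T) (++⁺ˡ (Er.Q E₁) (shifts (Er.Q E₂) (Er.Q E₃))))

    replace₁ : ∀ {E₁ E₁′ E₂ E₃ Y} → Er.Q E₁ ↭ Er.Q E₁′ → Triple E₁ E₂ E₃ Y → Triple E₁′ E₂ E₃ Y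
    replace₁ π T = triple (↭-trans (order T) (++⁺ʳ _ π))

    module Facts {E₁ E₂ E₃ Y} (T : Triple E₁ E₂ E₃ Y) where
      open Ear E₁ using () renaming (Q to Q₁)
      open Ear E₂ using () renaming (Q to Q₂)
      open Ear E₃ using () renaming (Q to Q₃)

      private
        u₁ : Unique (Q₁ ++ (Q₂ ++ (Q₃ ++ Y)))
        u₁ = Unique-resp-↭ (order T) uniq
        u₂ : Unique (Q₂ ++ (Q₃ ++ Y))
        u₂ = ++-Uniqueʳ Q₁ u₁
        u₃ : Unique (Q₃ ++ Y)
        u₃ = ++-Uniqueʳ Q₂ u₂

      uY : Unique Y
      uY = ++-Uniqueʳ Q₃ u₃
      disj₁₂ : ∀ {v} → v ∈ Q₂ → v ∉ Q₁
      disj₁₂ v∈₂ v∈₁ = ++-disjoint Q₁ u₁ v∈₁ (∈-++⁺ˡ v∈₂)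
      disj₁₃ : ∀ {v} → v ∈ Q₃ → v ∉ Q₁
      disj₁₃ v∈₃ v∈₁ = ++-disjoint Q₁ u₁ v∈₁ (∈-++⁺ʳ Q₂ (∈-++⁺ˡ v∈₃))
      disj₂₃ : ∀ {v} → v ∈ Q₃ → v ∉ Q₂
      disj₂₃ v∈₃ v∈₂ = ++-disjoint Q₂ u₂ v∈₂ (∈-++⁺ˡ v∈₃)
      Y∉₁ : ∀ {v} → v ∈ Y → v ∉ Q₁
      Y∉₁ v∈ v∈₁ = ++-disjoint Q₁ u₁ v∈₁ (∈-++⁺ʳ Q₂ (∈-++⁺ʳ Q₃ v∈))
      Y∉₂ : ∀ {v} → v ∈ Y → v ∉ Q₂
      Y∉₂ v∈ v∈₂ = ++-disjoint Q₂ u₂ v∈₂ (∈-++⁺ʳ Q₃ v∈)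
      Y∉₃ : ∀ {v} → v ∈ Y → v ∉ Q₃
      Y∉₃ v∈ v∈₃ = ++-disjoint Q₃ u₃ v∈₃ v∈
      Y⊆ : Y ⊆ L
      Y⊆ v∈ = ∈-resp-↭ (↭-sym (order T)) (∈-++⁺ʳ Q₁ (∈-++⁺ʳ Q₂ (∈-++⁺ʳ Q₃ v∈)))

      cover : ∀ {v} → v ∈ L → v ∈ Q₁ ⊎ v ∈ Q₂ ⊎ v ∈ Q₃ ⊎ v ∈ Y
      cover v∈ with ∈-++⁻ Q₁ (∈-resp-↭ (order T) v∈)
      ... | inj₁ v∈₁ = inj₁ v∈₁
      ... | inj₂ v∈′ with ∈-++⁻ Q₂ v∈′
      ...   | inj₁ v∈₂ = inj₂ (inj₁ v∈₂)
      ...   | inj₂ v∈″ = inj₂ (inj₂ (∈-++⁻ Q₃ v∈″))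

      end-in-Y : ∀ {v} → v ∈ L → Big v → v ∈ Y
      end-in-Y v∈ bv with cover v∈
      ... | inj₁ v∈₁               = contradiction v∈₁ (Er.big∉ E₁ bv)
      ... | inj₂ (inj₁ v∈₂)        = contradiction v∈₂ (Er.big∉ E₂ bv)
      ... | inj₂ (inj₂ (inj₁ v∈₃)) = contradiction v∈₃ (Er.big∉ E₃ bv)
      ... | inj₂ (inj₂ (inj₂ v∈Y)) = v∈Y

      len : n ≡ length Q₁ + (length Q₂ + (length Q₃ + length Y))
      len = ≡.trans (↭-length (order T)) (≡.trans (length-++ Q₁) (cong (length Q₁ +_) (≡.trans (length-++ Q₂) (cong (length Q₂ +_) (length-++ Q₃)))))

      -- Three disjoint edges between vertices of degree 2 carry at most nine
      -- edges, too few when n ≥ 9.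
      n≤8 : n ≤ 8
      n≤8 with first-two (Er.path E₁) (Er.two E₁) | first-two (Er.path E₂) (Er.two E₂) | first-two (Er.path E₃) (Er.two E₃)
      ... | s₁ , t₁ , M₁ , refl , st₁ | s₂ , t₂ , M₂ , refl , st₂ | s₃ , t₃ , M₃ , refl , st₃ =
        bound (complement six-unique six⊆)
        where
        six : List V
        six = s₁ ∷ t₁ ∷ s₂ ∷ t₂ ∷ s₃ ∷ t₃ ∷ []
        pick-two : ∀ {s t : V} {M N} → Unique ((s ∷ t ∷ M) ++ N) → Unique (s ∷ t ∷ [])
        pick-two ((s≢t ∷ _) ∷ _) = (s≢t ∷ []) ∷ [] ∷ []
        front : ∀ {s t : V} {M} → s ∷ t ∷ [] ⊆ s ∷ t ∷ M
        front 1st = 1st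
        front 2nd = 2nd
        six-unique : Unique six
        six-unique = Unique-++⁺ (pick-two {M = M₁} u₁)
          (Unique-++⁺ (pick-two {M = M₂} u₂) (pick-two {M = M₃} u₃)
            λ (z∈₂ , z∈₃) → disj₂₃ (front z∈₃) (front z∈₂))
          λ { (z∈₁ , z∈) → [ (λ z∈₂ → disj₁₂ (front z∈₂) (front z∈₁)) , (λ z∈₃ → disj₁₃ (front z∈₃) (front z∈₁)) ]′
                             (∈-++⁻ (s₂ ∷ t₂ ∷ []) z∈) }
        six⊆ : six ⊆ L
        six⊆ 1st = Er.Q⊆ E₁ 1st
        six⊆ 2nd = Er.Q⊆ E₁ 2nd
        six⊆ 3rd = Er.Q⊆ E₂ 1st
        six⊆ 4th = Er.Q⊆ E₂ 2nd
        six⊆ 5th = Er.Q⊆ E₃ 1st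
        six⊆ 6th = Er.Q⊆ E₃ 2nd
        bound : ∃[ R ] L ↭ six ++ R → n ≤ 8
        bound (R , perm) = small-n (≤-trans edges few)
          where
          v₁ : Unique (six ++ R)
          v₁ = Unique-resp-↭ perm uniq
          sub₁ : six ++ R ⊆ L
          sub₁ = ∈-resp-↭ (↭-sym perm)
          few : e L ≤ 9 + tri (length R)
          few = begin
            e L                                       ≡⟨ e-↭ perm ⟩
            e (six ++ R)
              ≤⟨ e-pair {L} (Er.small E₁ 1st) (Er.small E₁ 2nd) st₁ v₁ sub₁ ⟩
            3 + e (s₂ ∷ t₂ ∷ s₃ ∷ t₃ ∷ R)
              ≤⟨ +-monoʳ-≤ 3 (e-pair {L} (Er.small E₂ 1st) (Er.small E₂ 2nd) st₂
                   (tail-Unique (tail-Unique v₁)) (sub₁ ∘ there ∘ there)) ⟩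
            6 + e (s₃ ∷ t₃ ∷ R)
              ≤⟨ +-monoʳ-≤ 6 (e-pair {L} (Er.small E₃ 1st) (Er.small E₃ 2nd) st₃
                   (tail-Unique (tail-Unique (tail-Unique (tail-Unique v₁)))) (sub₁ ∘ there ∘ there ∘ there ∘ there)) ⟩
            9 + e R                                   ≤⟨ +-monoʳ-≤ 9 (e-≤ R) ⟩
            9 + tri (length R)                        ∎
            where open ≤-Reasoning
          small-n : threshold n ≤ 9 + tri (length R) → n ≤ 8
          small-n le = subst (_≤ 8) (sym (↭-length perm)) (go (length R) (subst (λ m → threshold m ≤ 9 + tri (length R)) (↭-length perm) le))
            where
            -- `threshold (6 + r)` equals `r + tri r + 7`, so the hypothesis amounts to `r ≤ 2`.
            go : ∀ r → threshold (6 + r) ≤ 9 + tri r → 6 + r ≤ 8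
            go r le = +-monoʳ-≤ 6 (+-cancelʳ-≤ (tri r + 7) r 2 (≤-trans (≤-reflexive (sym (+-assoc r (tri r) 7)))
                        (≤-trans le (≤-reflexive (solve 1 (λ t → con 9 :+ t := con 2 :+ (t :+ con 7)) refl (tri r))))))
              where open +-*-Solver

    -- The third ear and `c` form a 4-cycle, attached at `c` to the path `Q₂`, `c`, `Q₁` through
    -- everything else.
    cycle-ear : ∀ {E₁ E₂ E₃ c} → Triple E₁ E₂ E₃ [ c ] → length (Er.Q E₃) ≡ 3 → Res L
    cycle-ear {E₁} {E₂} {E₃} {c} T three = go (path-3 (Er.path E₃) three)
      where
      open Facts T
      is-c : ∀ {v} → v ∈ L → Big v → v ≡ c
      is-c v∈ bv with end-in-Y v∈ bv
      ... | here v≡c = v≡c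
      mid : Path (Er.a E₂) (Er.a E₁) [ c ]
      mid = subst (λ v → Path v (Er.a E₁) [ c ]) (sym (is-c (Er.a∈ E₂) (Er.big-a E₂)))
              (subst (λ v → Path c v [ c ]) (sym (is-c (Er.a∈ E₁) (Er.big-a E₁))) (stop c))
      open Chain E₁ E₂ disj₁₂ mid ([] ∷ []) (All.lookup (Y⊆ 1st ∷ []))
                 (All.lookup (Y∉₁ 1st ∷ [])) (All.lookup (Y∉₂ 1st ∷ []))
      c∈ : c ∈ ps
      c∈ = ms-in 1st
      ∉ps : ∀ {v} → v ∈ Er.Q E₃ → v ∉ ps
      ∉ps v∈₃ v∈ with ∈-++⁻ Q₂′ v∈
      ... | inj₁ v∈₂ = disj₂₃ v∈₃ (∈-resp-↭ (↭-sym π) v∈₂)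
      ... | inj₂ 1st = Y∉₃ 1st v∈₃
      ... | inj₂ (there v∈₁) = disj₁₃ v∈₃ v∈₁
      go : ∃[ w ] Er.Q E₃ ≡ Er.x E₃ ∷ w ∷ Er.y E₃ ∷ [] × Er.x E₃ ~ w × w ~ Er.y E₃ → Res L
      go (w , eq , x~w , w~y) = inj₁ (PC-⊆ sub sup
        (PC-4-cycle (PC-path path ups) c∈ u
          (subst (_~ Er.x E₃) (is-c (Er.a∈ E₃) (Er.big-a E₃)) (Er.a~x E₃)) x~w w~y
          (subst (Er.y E₃ ~_) (is-c (Er.b∈ E₃) (Er.big-b E₃)) (Er.y~b E₃))))
        where
        u : Unique ((Er.x E₃ ∷ w ∷ Er.y E₃ ∷ []) ++ ps)
        u = subst (λ Q → Unique (Q ++ ps)) eq (Unique-++⁺ (Er.uQ E₃) ups λ (v∈₃ , v∈) → ∉ps v∈₃ v∈)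
        sub : (Er.x E₃ ∷ w ∷ Er.y E₃ ∷ []) ++ ps ⊆ L
        sub v∈ = [ (λ v∈₃ → Er.Q⊆ E₃ (subst (_ ∈_) (sym eq) v∈₃)) , ps⊆ ]′ (∈-++⁻ (Er.x E₃ ∷ w ∷ Er.y E₃ ∷ []) v∈)
        sup : L ⊆ (Er.x E₃ ∷ w ∷ Er.y E₃ ∷ []) ++ ps
        sup v∈ with cover v∈
        ... | inj₁ v∈₁ = ∈-++⁺ʳ (Er.x E₃ ∷ w ∷ Er.y E₃ ∷ []) (Q₁-in v∈₁)
        ... | inj₂ (inj₁ v∈₂) = ∈-++⁺ʳ (Er.x E₃ ∷ w ∷ Er.y E₃ ∷ []) (Q₂-in v∈₂)
        ... | inj₂ (inj₂ (inj₁ v∈₃)) = ∈-++⁺ˡ (subst (_ ∈_) eq v∈₃)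
        ... | inj₂ (inj₂ (inj₂ 1st)) = ∈-++⁺ʳ (Er.x E₃ ∷ w ∷ Er.y E₃ ∷ []) c∈

    Edge : V → Ear → Set
    Edge c E = Er.Q E ≡ Er.x E ∷ Er.y E ∷ [] × Er.x E ~ Er.y E × Er.x E ~ c × Er.y E ~ c × Small (Er.x E) × Small (Er.y E)

    edge : ∀ {c} E → length (Er.Q E) ≡ 2 → Er.a E ≡ c → Er.b E ≡ c → Edge c E
    edge E two refl b≡c with path-2 (Er.path E) two
    ... | eq , x~y = eq , x~y , ~-sym (Er.a~x E) , subst (Er.y E ~_) b≡c (Er.y~b E) ,
                     Er.small E (Er.x∈Q E) , Er.small E (Er.y∈Q E)

    bowtie : ∀ {c E₁ E₂ R} → L ↭ Er.Q E₁ ++ (Er.Q E₂ ++ c ∷ R) → Edge c E₁ → Edge c E₂ → Σ[ b ∈ Bowtie L ] Bowtie.R b ≡ R × Bowtie.c b ≡ c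
    bowtie {c} {E₁} {E₂} {R} perm (eq₁ , x~y₁ , x~c₁ , y~c₁ , sx₁ , sy₁) (eq₂ , x~y₂ , x~c₂ , y~c₂ , sx₂ , sy₂) = record
      { perm = subst (λ Q → L ↭ Er.x E₁ ∷ Er.y E₁ ∷ (Q ++ c ∷ R)) eq₂ (subst (λ Q → L ↭ Q ++ (Er.Q E₂ ++ c ∷ R)) eq₁ perm)
      ; pq = x~y₁ ; pc = x~c₁ ; qc = y~c₁ ; pq′ = x~y₂ ; pc′ = x~c₂ ; qc′ = y~c₂
      ; dp = sx₁ ; dq = sy₁ ; dp′ = sx₂ ; dq′ = sy₂ } , refl , refl

    -- By `n ≤ 8` the ears have at most seven vertices together, so if one is longer than an edge,
    -- it has exactly three vertices and `cycle-ear` applies. Three edges joined to `c` are `G₁`.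
    one-centre : ∀ {E₁ E₂ E₃ c} → Triple E₁ E₂ E₃ [ c ] → Res L
    one-centre {E₁} {E₂} {E₃} {c} T = go (length Q₁ ℕ≟ 2) (length Q₂ ℕ≟ 2) (length Q₃ ℕ≟ 2)
      where
      open Facts T
      open Ear E₁ using () renaming (Q to Q₁)
      open Ear E₂ using () renaming (Q to Q₂)
      open Ear E₃ using () renaming (Q to Q₃)
      is-c : ∀ {v} → v ∈ L → Big v → v ≡ c
      is-c v∈ bv with end-in-Y v∈ bv
      ... | here v≡c = v≡c
      is-edge : ∀ E → length (Er.Q E) ≡ 2 → Edge c E
      is-edge E two = edge E two (is-c (Er.a∈ E) (Er.big-a E)) (is-c (Er.b∈ E) (Er.big-b E))
      three : ∀ {i j k} → n ≡ i + (j + (k + 1)) → 2 ≤ i → 2 ≤ j → 2 ≤ k → k ≢ 2 → k ≡ 3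
      three {i} {j} {k} eq 2≤i 2≤j 2≤k k≢2 = ≤-antisym
        (+-cancelʳ-≤ 1 k 3 (+-cancelˡ-≤ 4 (k + 1) 4 (≤-trans (≤-trans (≤-reflexive (+-assoc 2 2 (k + 1))) (+-mono-≤ 2≤i (+-monoˡ-≤ (k + 1) 2≤j)))
          (≤-trans (≤-reflexive (sym eq)) n≤8))))
        (≤∧≢⇒< 2≤k (k≢2 ∘ sym))
      go : Dec (length Q₁ ≡ 2) → Dec (length Q₂ ≡ 2) → Dec (length Q₃ ≡ 2) → Res L
      go _ _ (no ≢2) = cycle-ear T (three len (Er.two E₁) (Er.two E₂) (Er.two E₃) ≢2)
      go _ (no ≢2) _ = cycle-ear (swap₂₃ T)
        (three (Facts.len (swap₂₃ T)) (Er.two E₁) (Er.two E₃) (Er.two E₂) ≢2)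
      go (no ≢2) _ _ = cycle-ear T′ (three (Facts.len T′) (Er.two E₂) (Er.two E₃) (Er.two E₁) ≢2)
        where
        T′ : Triple E₂ E₃ E₁ [ c ]
        T′ = swap₂₃ (swap₁₂ T)
      go (yes two₁) (yes two₂) (yes two₃) with is-edge E₃ two₃
      ... | eq₃ , x~y₃ , x~c₃ , y~c₃ , _
        with bowtie {c} {E₁} {E₂} {Q₃} (↭-trans (order T) (++⁺ˡ Q₁ (++⁺ˡ Q₂ (++-comm Q₃ [ c ])))) (is-edge E₁ two₁) (is-edge E₂ two₂)
      ...   | b , refl , refl = inj₂ (b , inj₁ (Er.x E₃ , Er.y E₃ , eq₃ , x~y₃ , x~c₃ , y~c₃))

    module TwoCentres {c d : V} where

      Tri : Ear → Ear → Ear → Set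
      Tri E₁ E₂ E₃ = Triple E₁ E₂ E₃ (c ∷ d ∷ [])

      end-of : ∀ {E₁ E₂ E₃} → Tri E₁ E₂ E₃ → ∀ {s t} → s ∈ L → Big s → t ∈ L → Big t → s ≢ t →
               ∀ {v} → v ∈ c ∷ d ∷ [] → v ≡ s ⊎ v ≡ t
      end-of {E₁} {E₂} {E₃} T s∈ bs t∈ bt s≢t v∈ =
        place (Facts.end-in-Y T s∈ bs) (Facts.end-in-Y T t∈ bt) s≢t v∈
        where
        place : ∀ {s t v} → s ∈ c ∷ d ∷ [] → t ∈ c ∷ d ∷ [] → s ≢ t → v ∈ c ∷ d ∷ [] → v ≡ s ⊎ v ≡ t
        place 1st 1st s≢t _ = contradiction refl s≢t
        place 2nd 2nd s≢t _ = contradiction refl s≢t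
        place 1st 2nd _ 1st = inj₁ refl
        place 1st 2nd _ 2nd = inj₂ refl
        place 2nd 1st _ 1st = inj₂ refl
        place 2nd 1st _ 2nd = inj₁ refl

      -- Two vertices from each ear together with `c` and `d` already exhaust `n ≤ 8`.
      all-two : ∀ {E₁ E₂ E₃} → Tri E₁ E₂ E₃ → length (Er.Q E₃) ≡ 2
      all-two {E₁} {E₂} {E₃} T = ≤-antisym
        (+-cancelʳ-≤ 2 _ 2 (+-cancelˡ-≤ 4 _ 4 (≤-trans (+-mono-≤ (Er.two E₁) (+-monoˡ-≤ _ (Er.two E₂)))
          (≤-trans (≤-reflexive (sym (Facts.len T))) (Facts.n≤8 T)))))
        (Er.two E₃)

      -- The path Q₂, a₁, Q₁, b₁, Q₃.
      hamiltonian : ∀ {E₁ E₂ E₃} → Tri E₁ E₂ E₃ → Er.a E₁ ≢ Er.b E₁ → Er.a E₂ ≡ Er.a E₁ → Er.a E₃ ≡ Er.b E₁ → Res L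
      hamiltonian {E₁} {E₂} {E₃} T a≢b a₂≡a₁ a₃≡b₁ = inj₁ (PC-⊆ sub sup (PC-path
        (Path-++ path (Er.y~b E₁) (subst (_~ Er.x E₃) a₃≡b₁ (Er.a~x E₃) ◅ Er.path E₃))
        (Unique-++⁺ ups (∷-Unique (Er.big∉ E₃ (Er.big-b E₁)) (Er.uQ E₃)) λ where
          (v∈ , 1st)      → b₁∉ v∈
          (v∈ , there v∈₃) → ∉₃ v∈ v∈₃)))
        where
        open Facts T
        mid : Path (Er.a E₂) (Er.a E₁) [ Er.a E₁ ]
        mid = subst (λ v → Path v (Er.a E₁) [ Er.a E₁ ]) (sym a₂≡a₁) (stop (Er.a E₁))
        open Chain E₁ E₂ disj₁₂ mid ([] ∷ []) (All.lookup (Er.a∈ E₁ ∷ []))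
          (All.lookup (Er.big∉ E₁ (Er.big-a E₁) ∷ [])) (All.lookup (Er.big∉ E₂ (Er.big-a E₁) ∷ []))
        split : ∀ {v} → v ∈ ps → v ∈ Er.Q E₂ ⊎ v ≡ Er.a E₁ ⊎ v ∈ Er.Q E₁
        split v∈ with ∈-++⁻ Q₂′ v∈
        ... | inj₁ v∈₂ = inj₁ (∈-resp-↭ (↭-sym π) v∈₂)
        ... | inj₂ (here eq) = inj₂ (inj₁ eq)
        ... | inj₂ (there v∈₁) = inj₂ (inj₂ v∈₁)
        b₁∉ : Er.b E₁ ∉ ps
        b₁∉ v∈ = [ Er.big∉ E₂ (Er.big-b E₁) , [ a≢b ∘ sym , Er.big∉ E₁ (Er.big-b E₁) ]′ ]′ (split v∈)
        ∉₃ : ∀ {v} → v ∈ ps → v ∉ Er.Q E₃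
        ∉₃ v∈ v∈₃ = [ disj₂₃ v∈₃ , [ (λ { refl → Er.big∉ E₃ (Er.big-a E₁) v∈₃ }) , disj₁₃ v∈₃ ]′ ]′ (split v∈)
        sub : ps ++ Er.b E₁ ∷ Er.Q E₃ ⊆ L
        sub v∈ with ∈-++⁻ ps v∈
        ... | inj₁ v∈ps = ps⊆ v∈ps
        ... | inj₂ 1st = Er.b∈ E₁
        ... | inj₂ (there v∈₃) = Er.Q⊆ E₃ v∈₃
        sup : L ⊆ ps ++ Er.b E₁ ∷ Er.Q E₃
        sup v∈ with cover v∈
        ... | inj₁ v∈₁ = ∈-++⁺ˡ (Q₁-in v∈₁)
        ... | inj₂ (inj₁ v∈₂) = ∈-++⁺ˡ (Q₂-in v∈₂)
        ... | inj₂ (inj₂ (inj₁ v∈₃)) = ∈-++⁺ʳ ps (there v∈₃)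
        ... | inj₂ (inj₂ (inj₂ v∈Y)) = [ (λ { refl → ∈-++⁺ˡ (ms-in 1st) }) , (λ { refl → ∈-++⁺ʳ ps 1st }) ]′
              (end-of T (Er.a∈ E₁) (Er.big-a E₁) (Er.b∈ E₁) (Er.big-b E₁) a≢b v∈Y)

      -- Otherwise b₁ has no neighbours but a₁ and an end of Q₁.
      starved : ∀ {E₁ E₂ E₃} → Tri E₁ E₂ E₃ → Er.a E₁ ≢ Er.b E₁ → Er.a E₂ ≡ Er.a E₁ → Er.b E₂ ≡ Er.a E₁ →
                Er.a E₃ ≡ Er.a E₁ → Er.b E₃ ≡ Er.a E₁ → Res L
      starved {E₁} {E₂} {E₃} T a≢b a₂ b₂ a₃ b₃ = ¬both (dg-nbrs (Er.y E₁ ∷ Er.a E₁ ∷ []) uniq only) (Er.big-b E₁)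
        where
        open Facts T
        edge₁ = path-2 (Er.path E₁) (all-two (swap₂₃ (swap₁₂ T)))
        only : ∀ {u} → u ∈ L → Er.b E₁ ~ u → u ∈ Er.y E₁ ∷ Er.a E₁ ∷ []
        only {u} u∈ b~u with cover u∈
        ... | inj₂ (inj₁ u∈₂) = contradiction (Er.nbrs E₂ u∈₂ (Er.b∈ E₁) (~-sym b~u))
              [ Er.big∉ E₂ (Er.big-b E₁) , [ (λ b≡ → a≢b (sym (≡.trans b≡ a₂))) , (λ b≡ → a≢b (sym (≡.trans b≡ b₂))) ]′ ]′
        ... | inj₂ (inj₂ (inj₁ u∈₃)) = contradiction (Er.nbrs E₃ u∈₃ (Er.b∈ E₁) (~-sym b~u))
              [ Er.big∉ E₃ (Er.big-b E₁) , [ (λ b≡ → a≢b (sym (≡.trans b≡ a₃))) , (λ b≡ → a≢b (sym (≡.trans b≡ b₃))) ]′ ]′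
        ... | inj₂ (inj₂ (inj₂ u∈Y)) = [ (λ { refl → 2nd }) , (λ { refl → contradiction refl (~⇒≢ b~u) }) ]′
              (end-of T (Er.a∈ E₁) (Er.big-a E₁) (Er.b∈ E₁) (Er.big-b E₁) a≢b u∈Y)
        ... | inj₁ u∈₁ with subst (u ∈_) (proj₁ edge₁) u∈₁
        ...   | 2nd = 1st
        ...   | 1st = contradiction
          (dg-≥ (Er.a E₁ ∷ Er.b E₁ ∷ Er.y E₁ ∷ [])
            ((a≢b ∷ (λ a≡y → Er.big∉ E₁ (Er.big-a E₁) (subst (_∈ Er.Q E₁) (sym a≡y) (Er.y∈Q E₁))) ∷ [])
              ∷ (~⇒≢ (~-sym (Er.y~b E₁)) ∷ []) ∷ [] ∷ [])
            (λ { 1st → Er.a∈ E₁ ; 2nd → Er.b∈ E₁ ; 3rd → Er.Q⊆ E₁ (Er.y∈Q E₁) })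
            (λ { 1st → ~-sym (Er.a~x E₁) ; 2nd → ~-sym b~u ; 3rd → proj₂ edge₁ }))
          (<⇒≱ (s≤s (Er.small E₁ (Er.x∈Q E₁))))

      -- The first ear joins the two centres and the second is attached to `a₁`. If the third ear
      -- also touches `b₁`, or if the second touches `b₁` and the third `a₁`, a path runs through
      -- one ear, `a₁`, `Q₁`, `b₁` and the remaining ear. Otherwise `b₁` has too small a degree.
      hub : ∀ {E₁ E₂ E₃} → Tri E₁ E₂ E₃ → Er.a E₁ ≢ Er.b E₁ → Er.a E₂ ≡ Er.a E₁ → Res L
      hub {E₁} {E₂} {E₃} T a≢b a₂≡a₁ with ear-reverse E₂ | ear-reverse E₃
      ... | E₂′ , a₂′≡b₂ , _ , π₂ | E₃′ , a₃′≡b₃ , _ , π₃ =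
        go (where-is (Er.a∈ E₃) (Er.big-a E₃)) (where-is (Er.b∈ E₃) (Er.big-b E₃)) (where-is (Er.b∈ E₂) (Er.big-b E₂))
        where
        where-is : ∀ {v} → v ∈ L → Big v → v ≡ Er.a E₁ ⊎ v ≡ Er.b E₁
        where-is v∈ bv = end-of T (Er.a∈ E₁) (Er.big-a E₁) (Er.b∈ E₁) (Er.big-b E₁) a≢b
                           (Facts.end-in-Y T v∈ bv)
        T₃ : Tri E₁ E₂ E₃′
        T₃ = triple (↭-trans (order T) (++⁺ˡ (Er.Q E₁) (++⁺ˡ (Er.Q E₂) (++⁺ʳ _ π₃))))
        T₂ : Tri E₁ E₃ E₂′
        T₂ = triple (↭-trans (order (swap₂₃ T)) (++⁺ˡ (Er.Q E₁) (++⁺ˡ (Er.Q E₃) (++⁺ʳ _ π₂))))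
        go : Er.a E₃ ≡ Er.a E₁ ⊎ Er.a E₃ ≡ Er.b E₁ → Er.b E₃ ≡ Er.a E₁ ⊎ Er.b E₃ ≡ Er.b E₁ →
             Er.b E₂ ≡ Er.a E₁ ⊎ Er.b E₂ ≡ Er.b E₁ → Res L
        go (inj₂ a₃) _ _ = hamiltonian T a≢b a₂≡a₁ a₃
        go _ (inj₂ b₃) _ = hamiltonian T₃ a≢b a₂≡a₁ (≡.trans a₃′≡b₃ b₃)
        go (inj₁ a₃) _ (inj₂ b₂) = hamiltonian T₂ a≢b a₃ (≡.trans a₂′≡b₂ b₂)
        go (inj₁ a₃) (inj₁ b₃) (inj₁ b₂) = starved T a≢b a₂≡a₁ b₂ a₃ b₃

      open-ear : ∀ {E₁ E₂ E₃} → Tri E₁ E₂ E₃ → Er.a E₁ ≢ Er.b E₁ → Res L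
      open-ear {E₁} {E₂} {E₃} T a≢b with ear-reverse E₁
      ... | E₁′ , a₁′≡b₁ , b₁′≡a₁ , π
        with end-of T (Er.a∈ E₁) (Er.big-a E₁) (Er.b∈ E₁) (Er.big-b E₁) a≢b
               (Facts.end-in-Y T (Er.a∈ E₂) (Er.big-a E₂))
      ...   | inj₁ a₂≡a₁ = hub T a≢b a₂≡a₁
      ...   | inj₂ a₂≡b₁ = hub (replace₁ {E₁} {E₁′} {E₂} {E₃} π T)
                             (λ eq → a≢b (≡.trans (sym b₁′≡a₁) (≡.trans (sym eq) a₁′≡b₁))) (≡.trans a₂≡b₁ (sym a₁′≡b₁))

      -- Two triangles at s and one at t form the exceptional graph on eight vertices.
      exceptional : ∀ {E₁ E₂ E₃} → Tri E₁ E₂ E₃ → ∀ {s t} → s ≢ t → Er.a E₁ ≡ s → Er.b E₁ ≡ s → Er.a E₂ ≡ s → Er.b E₂ ≡ s →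
                    Er.a E₃ ≡ t → Er.b E₃ ≡ t → Res L
      exceptional {E₁} {E₂} {E₃} T {s} {t} s≢t refl b₁ a₂ b₂ refl b₃ =
        go (edge E₁ (all-two (swap₂₃ (swap₁₂ T))) refl b₁)
           (edge E₂ (all-two (swap₂₃ T)) a₂ b₂)
           (edge E₃ (all-two T) refl b₃)
        where
        open Facts T
        st : ∀ {v} → v ∈ c ∷ d ∷ [] → v ≡ s ⊎ v ≡ t
        st = end-of T (Er.a∈ E₁) (Er.big-a E₁) (Er.a∈ E₃) (Er.big-a E₃) s≢t
        Y↭ : c ∷ d ∷ [] ↭ s ∷ t ∷ []
        Y↭ = ⊆-antisym-↭ ((s≢t ∷ []) ∷ [] ∷ []) uY
               (λ { 1st → end-in-Y (Er.a∈ E₁) (Er.big-a E₁) ; 2nd → end-in-Y (Er.a∈ E₃) (Er.big-a E₃) })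
               (λ v∈ → [ here , there ∘ here ]′ (st v∈))
        R : List V
        R = t ∷ Er.Q E₃
        perm : L ↭ Er.Q E₁ ++ (Er.Q E₂ ++ s ∷ R)
        perm = ↭-trans (order T) (++⁺ˡ (Er.Q E₁) (++⁺ˡ (Er.Q E₂) (↭-trans (++⁺ˡ (Er.Q E₃) Y↭) (++-comm (Er.Q E₃) (s ∷ t ∷ [])))))
        -- The cut around `s` and its two triangles can only be left at `s`. Since the third ear is
        -- attached to nothing but `t`, the edge found ends at `t`.
        s~t : s ~ t
        s~t with conn (s ∷ (Er.Q E₁ ++ Er.Q E₂)) (Er.a∈ E₁) 1st (Er.a∈ E₃)
                   (λ { (here t≡s) → s≢t (sym t≡s) ; (there t∈) → [ Er.big∉ E₁ (Er.big-a E₃) , Er.big∉ E₂ (Er.big-a E₃) ]′ (∈-++⁻ (Er.Q E₁) t∈) })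
        ... | u , v , u∈ , v∈ , there u∈Q , v∉ , u~v with ∈-++⁻ (Er.Q E₁) u∈Q
        ...   | inj₁ u∈₁ = contradiction ([ there ∘ ∈-++⁺ˡ , [ here , (λ v≡b → here (≡.trans v≡b b₁)) ]′ ]′ (Er.nbrs E₁ u∈₁ v∈ u~v)) v∉
        ...   | inj₂ u∈₂ = contradiction ([ there ∘ ∈-++⁺ʳ (Er.Q E₁) , [ (λ v≡a → here (≡.trans v≡a a₂)) , (λ v≡b → here (≡.trans v≡b b₂)) ]′ ]′
                                (Er.nbrs E₂ u∈₂ v∈ u~v)) v∉
        s~t | u , v , u∈ , v∈ , 1st , v∉ , s~v with cover v∈
        ...   | inj₁ v∈₁ = contradiction (there (∈-++⁺ˡ v∈₁)) v∉
        ...   | inj₂ (inj₁ v∈₂) = contradiction (there (∈-++⁺ʳ (Er.Q E₁) v∈₂)) v∉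
        ...   | inj₂ (inj₂ (inj₁ v∈₃)) = contradiction (Er.nbrs E₃ v∈₃ (Er.a∈ E₁) (~-sym s~v))
                  [ Er.big∉ E₃ (Er.big-a E₁) , [ s≢t , (λ s≡b → s≢t (≡.trans s≡b b₃)) ]′ ]′
        ...   | inj₂ (inj₂ (inj₂ v∈Y)) = [ (λ { refl → contradiction refl (~⇒≢ s~v) }) , (λ { refl → s~v }) ]′ (st v∈Y)
        only : ∀ {r} → r ∈ R → s ~ r → r ≡ t
        only 1st _ = refl
        only (there r∈) s~r = contradiction (Er.nbrs E₃ r∈ (Er.a∈ E₁) (~-sym s~r))
                                [ Er.big∉ E₃ (Er.big-a E₁) , [ s≢t , (λ s≡b → s≢t (≡.trans s≡b b₃)) ]′ ]′
        go : Edge s E₁ → Edge s E₂ → Edge t E₃ → Res L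
        go e₁ e₂ (eq₃ , x~y , x~t , y~t , _) with bowtie {s} {E₁} {E₂} {R} perm e₁ e₂
        ... | b , refl , refl = inj₂ (b , inj₂ (t , 1st , s~t , only , complete , three))
          where
          three : 3 ≤ length R
          three = s≤s (Er.two E₃)
          in₃ : ∀ {v} → v ∈ Er.Q E₃ → v ≡ Er.x E₃ ⊎ v ≡ Er.y E₃
          in₃ v∈ with subst (_ ∈_) eq₃ v∈
          ... | here eq = inj₁ eq
          ... | there (here eq) = inj₂ eq
          to-t : ∀ {v} → v ∈ Er.Q E₃ → v ~ t
          to-t v∈ = [ (λ { refl → x~t }) , (λ { refl → y~t }) ]′ (in₃ v∈)
          complete : Complete R
          complete 1st 1st ne = contradiction refl ne
          complete 1st (there v∈) _ = ~-sym (to-t v∈)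
          complete (there u∈) 1st _ = to-t u∈
          complete (there u∈) (there v∈) ne with in₃ u∈ | in₃ v∈
          ... | inj₁ refl | inj₁ refl = contradiction refl ne
          ... | inj₁ refl | inj₂ refl = x~y
          ... | inj₂ refl | inj₁ refl = ~-sym x~y
          ... | inj₂ refl | inj₂ refl = contradiction refl ne

      -- If all ears are attached to one centre, the other centre is left with that one as its only
      -- possible neighbour, against the minimum degree.
      lonely : ∀ {E₁ E₂ E₃} → Tri E₁ E₂ E₃ → ∀ {s} → Er.a E₁ ≡ s → Er.b E₁ ≡ s → Er.a E₂ ≡ s → Er.b E₂ ≡ s →
               Er.a E₃ ≡ s → Er.b E₃ ≡ s → Res L
      lonely {E₁} {E₂} {E₃} T {s} a₁ b₁ a₂ b₂ a₃ b₃ = go (c ≟ s)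
        where
        open Facts T
        c≢d : c ≢ d
        c≢d c≡d = Unique[x∷xs]⇒x∉xs uY (here c≡d)
        stuck : ∀ {z} → z ∈ c ∷ d ∷ [] → z ≢ s → (∀ {u} → u ∈ c ∷ d ∷ [] → u ≢ z → u ≡ s) → Res L
        stuck {z} z∈ z≢s rest = contradiction (deg (Y⊆ z∈)) (<⇒≱ (s≤s (dg-nbrs [ s ] uniq only)))
          where
          apart-from : ∀ E → Er.a E ≡ s → Er.b E ≡ s → z ∉ Er.Q E → ∀ {u} → u ∈ Er.Q E → ¬ z ~ u
          apart-from E a≡s b≡s z∉ u∈ z~u = [ z∉ , [ (λ z≡a → z≢s (≡.trans z≡a a≡s)) , (λ z≡b → z≢s (≡.trans z≡b b≡s)) ]′ ]′
                                     (Er.nbrs E u∈ (Y⊆ z∈) (~-sym z~u))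
          only : ∀ {u} → u ∈ L → z ~ u → u ∈ [ s ]
          only u∈ z~u with cover u∈
          ... | inj₁ u∈₁ = contradiction z~u (apart-from E₁ a₁ b₁ (Y∉₁ z∈) u∈₁)
          ... | inj₂ (inj₁ u∈₂) = contradiction z~u (apart-from E₂ a₂ b₂ (Y∉₂ z∈) u∈₂)
          ... | inj₂ (inj₂ (inj₁ u∈₃)) = contradiction z~u (apart-from E₃ a₃ b₃ (Y∉₃ z∈) u∈₃)
          ... | inj₂ (inj₂ (inj₂ u∈Y)) = here (rest u∈Y (~⇒≢ z~u ∘ sym))
        go : Dec (c ≡ s) → Res L
        go (yes c≡s) = stuck 2nd (λ d≡s → c≢d (≡.trans c≡s (sym d≡s))) λ where
          (here u≡c) _           → ≡.trans u≡c c≡s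
          (there (here u≡d)) u≢d → contradiction u≡d u≢d
        go (no c≢s) = stuck 1st c≢s λ
          { (here u≡c) u≢c       → contradiction u≡c u≢c
          ; (there (here u≡d)) _ → ≡.trans u≡d (d≡s (subst (_∈ c ∷ d ∷ []) a₁ (end-in-Y (Er.a∈ E₁) (Er.big-a E₁)))) }
          where
          d≡s : s ∈ c ∷ d ∷ [] → d ≡ s
          d≡s (here s≡c)         = contradiction (sym s≡c) c≢s
          d≡s (there (here s≡d)) = sym s≡d

      result : ∀ {E₁ E₂ E₃} → Tri E₁ E₂ E₃ → Res L
      result {E₁} {E₂} {E₃} T = go (Er.b E₁ ≟ Er.a E₁) (Er.b E₂ ≟ Er.a E₂) (Er.b E₃ ≟ Er.a E₃)
                                    (Er.a E₂ ≟ Er.a E₁) (Er.a E₃ ≟ Er.a E₁)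
        where
        T₂₁ : Tri E₂ E₁ E₃
        T₂₁ = swap₁₂ T
        T₁₃ : Tri E₁ E₃ E₂
        T₁₃ = swap₂₃ T
        T₂₃ : Tri E₂ E₃ E₁
        T₂₃ = swap₂₃ T₂₁
        go : Dec (Er.b E₁ ≡ Er.a E₁) → Dec (Er.b E₂ ≡ Er.a E₂) → Dec (Er.b E₃ ≡ Er.a E₃) →
             Dec (Er.a E₂ ≡ Er.a E₁) → Dec (Er.a E₃ ≡ Er.a E₁) → Res L
        go (no ne) _ _ _ _ = open-ear T (ne ∘ sym)
        go _ (no ne) _ _ _ = open-ear T₂₁ (ne ∘ sym)
        go _ _ (no ne) _ _ = open-ear (swap₁₂ T₁₃) (ne ∘ sym)
        go (yes b₁) (yes b₂) (yes b₃) (yes a₂₁) (yes a₃₁) =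
          lonely T refl b₁ a₂₁ (≡.trans b₂ a₂₁) a₃₁ (≡.trans b₃ a₃₁)
        go (yes b₁) (yes b₂) (yes b₃) (yes a₂₁) (no a₃≢) =
          exceptional T (a₃≢ ∘ sym) refl b₁ a₂₁ (≡.trans b₂ a₂₁) refl b₃
        go (yes b₁) (yes b₂) (yes b₃) (no a₂≢) (yes a₃₁) =
          exceptional T₁₃ (a₂≢ ∘ sym) refl b₁ a₃₁ (≡.trans b₃ a₃₁) refl b₂
        go (yes b₁) (yes b₂) (yes b₃) (no a₂≢) (no a₃≢) =
          exceptional T₂₃ a₂≢ refl b₂ a₃₂ (≡.trans b₃ a₃₂) refl b₁
          where
          a₃₂ : Er.a E₃ ≡ Er.a E₂
          a₃₂ = [ (λ eq → contradiction eq a₃≢) , (λ eq → eq) ]′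
                  (end-of T (Er.a∈ E₁) (Er.big-a E₁) (Er.a∈ E₂) (Er.big-a E₂) (a₂≢ ∘ sym)
                    (Facts.end-in-Y T (Er.a∈ E₃) (Er.big-a E₃)))

    three-ears : ∀ {E₁ E₂ E₃ Y} → Triple E₁ E₂ E₃ Y → Res L
    three-ears {E₁} {E₂} {E₃} {[]} T with Facts.end-in-Y T (Er.a∈ E₁) (Er.big-a E₁)
    ... | ()
    three-ears {E₁} {E₂} {E₃} {c ∷ []} T = one-centre T
    three-ears {E₁} {E₂} {E₃} {c ∷ d ∷ []} T = TwoCentres.result T
    three-ears {E₁} {E₂} {E₃} {c ∷ d ∷ y ∷ Y} T = contradiction (Facts.n≤8 T) (<⇒≱ (begin
      9                                                             ≤⟨ m≤m+n 9 (length Y) ⟩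
      2 + (2 + (2 + (3 + length Y)))
        ≤⟨ +-mono-≤ (Er.two E₁) (+-mono-≤ (Er.two E₂) (+-monoˡ-≤ (3 + length Y) (Er.two E₃))) ⟩
      length (Er.Q E₁) + (length (Er.Q E₂) + (length (Er.Q E₃) + (3 + length Y))) ≡⟨ Facts.len T ⟨
      n ∎))
      where open ≤-Reasoning

    -- Combining the cases of the induction step

    separate : ∀ E → Separate (Er.Q E)
    separate E z∈ u∈ z~u = [ inj₁ , [ (λ { refl → inj₂ (Er.big-a E) }) , (λ { refl → inj₂ (Er.big-b E) }) ]′ ]′ (Er.nbrs E z∈ u∈ z~u)

    separate-++ : ∀ {Y Z} → Separate Y → Separate Z → Separate (Y ++ Z)
    separate-++ {Y} sepY sepZ z∈ u∈ z~u with ∈-++⁻ Y z∈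
    ... | inj₁ z∈Y = [ inj₁ ∘ ∈-++⁺ˡ , inj₂ ]′ (sepY z∈Y u∈ z~u)
    ... | inj₂ z∈Z = [ inj₁ ∘ ∈-++⁺ʳ Y , inj₂ ]′ (sepZ z∈Z u∈ z~u)

    conclude : Res L
    conclude with find-ear [] (λ ())
    ... | inj₁ none = no-small (λ v∈ → not-small λ s → case none v∈ s) (proj₂ some)
      where
      case : (∀ {v} → v ∈ L → Small v → v ∈ []) → ∀ {v} → v ∈ L → Small v → ⊥
      case none v∈ s with none v∈ s
      ... | ()
      head∈ : ∀ (M : List V) → 1 ≤ length M → ∃[ v ] v ∈ M
      head∈ (v ∷ _) _ = v , 1st
      some : ∃[ v ] v ∈ L
      some = head∈ L (≤-trans (s≤s z≤n) size)
    ... | inj₂ (inj₁ r) = r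
    ... | inj₂ (inj₂ (E₁ , _)) with find-ear (Er.Q E₁) (separate E₁)
    ...   | inj₁ all = one-ear E₁ all
    ...   | inj₂ (inj₁ r) = r
    ...   | inj₂ (inj₂ (E₂ , E₂∉)) with find-ear (Er.Q E₁ ++ Er.Q E₂) (separate-++ (separate E₁) (separate E₂))
    ...     | inj₁ all = two-ears {E₁} {E₂} record { disj = E₂∉ ; all = all }
    ...     | inj₂ (inj₁ r) = r
    ...     | inj₂ (inj₂ (E₃ , E₃∉))
      with Y , p ← complement {Er.Q E₁ ++ (Er.Q E₂ ++ Er.Q E₃)} {L}
             (Unique-++⁺ (Er.uQ E₁) (Unique-++⁺ (Er.uQ E₂) (Er.uQ E₃) λ (v∈₂ , v∈₃) → E₃∉ v∈₃ (∈-++⁺ʳ (Er.Q E₁) v∈₂))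
               λ (v∈₁ , v∈) → [ (λ v∈₂ → E₂∉ v∈₂ v∈₁) , (λ v∈₃ → E₃∉ v∈₃ (∈-++⁺ˡ v∈₁)) ]′ (∈-++⁻ (Er.Q E₂) v∈))
             (λ v∈ → [ Er.Q⊆ E₁ , (λ v∈′ → [ Er.Q⊆ E₂ , Er.Q⊆ E₃ ]′ (∈-++⁻ (Er.Q E₂) v∈′)) ]′ (∈-++⁻ (Er.Q E₁) v∈)) =
      three-ears {E₁} {E₂} {E₃} (triple (subst (L ↭_) (≡.trans (++-assoc (Er.Q E₁) (Er.Q E₂ ++ Er.Q E₃) Y)
        (cong (Er.Q E₁ ++_) (++-assoc (Er.Q E₂) (Er.Q E₃) Y))) p))

  structure : ∀ {L} → Good L → Res L
  structure {L} good = go good (<-wellFounded (length L))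
    where
    go : ∀ {L} → Good L → Acc _<_ (length L) → Res L
    go good (acc rs) = Induction.conclude good λ lt good′ → go good′ (rs lt)

-- Translation into the notions of the theorem

nC2≡tri : ∀ n → n C 2 ≡ tri n
nC2≡tri zero    = refl
nC2≡tri (suc n) = ≡.trans (sym (nCk+nC[k+1]≡[n+1]C[k+1] n 1)) (cong₂ _+_ (nC1≡n n) (nC2≡tri n))

length-filter-map : ∀ {A B : Set} {P : B → Set} (P? : Decidable P) (g : A → B) xs →
                    length (filter P? (map g xs)) ≡ length (filter (λ x → P? (g x)) xs)
length-filter-map P? g []       = refl
length-filter-map P? g (x ∷ xs) with P? (g x)
... | yes _ = cong suc (length-filter-map P? g xs)
... | no _  = length-filter-map P? g xs

module ProperConnection {n : ℕ} (G : SimpleGraph (Fin n)) where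

  open SimpleGraph G
  open Graphs (Fin._≟_ {n}) G using (PC; AP; []; step)

  shade : Bool → Fin 2
  shade true  = 1F
  shade false = 0F

  shade-≢ : ∀ α → shade α ≢ shade (not α)
  shade-≢ true  ()
  shade-≢ false ()

  PC⇒connectable : PC (allFin n) → ProperlyConnectableWith G 2
  PC⇒connectable (c , c-sym , pr) = colouring , λ u v _ →
    let α , vs , p , uvs , _ = pr (∈-allFin u) (∈-allFin v)
    in walk p , subst Unique (sym (vertices-walk p)) uvs , linked p
    where
    colouring : EdgeColouring G 2
    colouring = record { colour = λ {u} {v} _ → shade (c u v) ; undirected = λ {u} {v} _ _ → cong shade (c-sym u v) }
    open EdgeColouring colouring

    walk : ∀ {α u v vs} → AP c α u v vs → Walk G u v
    walk []             = ε
    walk (step u~w _ p) = u~w ◅ walk p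

    vertices-walk : ∀ {α u v vs} (p : AP c α u v vs) → vertices G (walk p) ≡ vs
    vertices-walk []           = refl
    vertices-walk (step _ _ p) = cong (_ ∷_) (vertices-walk p)

    linked : ∀ {α u v vs} (p : AP c α u v vs) → Linked _≢_ (colours (walk p))
    linked []                                        = []
    linked (step _ _ [])                             = [-]
    linked {α} (step _ eq q@(step _ eq′ _)) =
      (λ same → shade-≢ α (≡.trans (cong shade (sym eq)) (≡.trans same (cong shade eq′)))) ∷ linked q

  0<pc : ∀ {u v} → u ≢ v → ∀ j → ProperlyConnectableWith G j → 1 ≤ j
  0<pc u≢v (suc j) _ = s≤s z≤n
  0<pc {u} {v} u≢v zero (c , pr) with proj₁ (pr u v u≢v)
  ... | ε       = contradiction refl u≢v
  ... | e ◅ _ with EdgeColouring.colour c e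
  ...   | ()

  1<pc : ∀ {u v} → u ≢ v → ¬ u ~ v → ∀ j → ProperlyConnectableWith G j → 2 ≤ j
  1<pc u≢v u≁v zero          p = contradiction (0<pc u≢v 0 p) λ ()
  1<pc u≢v u≁v (suc (suc j)) _ = s≤s (s≤s z≤n)
  1<pc {u} {v} u≢v u≁v (suc zero) (c , pr) with pr u v u≢v
  ... | ε , _                         = contradiction refl u≢v
  ... | e ◅ ε , _                     = contradiction e u≁v
  ... | e ◅ e′ ◅ _ , _ , (c≢c′ ∷ _) = contradiction (all-equal (colour e) (colour e′)) c≢c′
    where
    open EdgeColouring c
    all-equal : (i j : Fin 1) → i ≡ j
    all-equal 0F 0F = refl

  connectable-1 : (∀ u v → u ≢ v → u ~ v) → ProperlyConnectableWith G 1
  connectable-1 complete = record { colour = λ _ → zero ; undirected = λ _ _ → refl } ,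
    λ u v u≢v → complete u v u≢v ◅ ε , ((u≢v ∷ []) ∷ [] ∷ []) , [-]

  -- The proper connection number itself has to be exhibited: it is 1 if all distinct vertices are
  -- adjacent and 2 otherwise.
  pc≤2 : ∀ {u v} → u ≢ v → ProperlyConnectableWith G 2 → ∃[ k ] (IsProperConnectionNumber G k × k ≤ 2)
  pc≤2 u≢v two with any? (λ u → any? (λ v → ¬? (u Fin.≟ v) ×-dec ¬? (u ~? v)) (allFin n)) (allFin n)
  ... | yes some with u , _ , hit ← find some with v , _ , u≢v , u≁v ← find hit = 2 , (two , 1<pc u≢v u≁v) , ≤-refl
  ... | no none = 1 , (connectable-1 complete , 0<pc u≢v) , s≤s z≤n
    where
    complete : ∀ u v → u ≢ v → u ~ v
    complete u v u≢v with u ~? v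
    ... | yes u~v = u~v
    ... | no u≁v  = contradiction (lose (∈-allFin u) (lose (∈-allFin v) (u≢v , u≁v))) none

-- Isomorphisms with the exceptional graphs

module Isomorphism {n : ℕ} (G : SimpleGraph (Fin n)) where

  open Graphs (Fin._≟_ {n}) G

  private
    pos : ∀ {us} → allFin n ↭ us → Fin n → Fin (length us)
    pos perm v = index (∈-resp-↭ perm (∈-allFin v))

    lookup-pos : ∀ {us} (perm : allFin n ↭ us) v → lookup us (pos perm v) ≡ v
    lookup-pos perm v = sym (lookup-index (∈-resp-↭ perm (∈-allFin v)))

  private
    both : {A B : Set} → A → B → A ⇔ B
    both a b = mk⇔ (λ _ → b) (λ _ → a)

    neither : {A B : Set} → ¬ A → ¬ B → A ⇔ B
    neither ¬a ¬b = mk⇔ (λ a → contradiction a ¬a) (λ b → contradiction b ¬b)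

  -- An isomorphism is given on the positions in a list of all vertices. Both adjacency relations
  -- are symmetric and irreflexive, so it is enough to compare them on positions `i < j`.
  numbered : ∀ {W : Set} (H : SimpleGraph W) {us} → allFin n ↭ us →
             (to : Fin (length us) → W) (from : W → Fin (length us)) → (∀ w → to (from w) ≡ w) → (∀ i → from (to i) ≡ i) →
             (∀ i j → i Fin.< j → lookup us i ~ lookup us j ⇔ SimpleGraph._~_ H (to i) (to j)) → G ≅ H
  numbered H {us} perm to from to-from from-to adj = record
    { bijection = mk↔ₛ′ (to ∘ pos perm) (lookup us ∘ from)
        (λ w → ≡.trans (cong to (lookup-injective uus (lookup-pos perm _))) (to-from w))
        (λ v → ≡.trans (cong (lookup us) (from-to _)) (lookup-pos perm v))
    ; adjacency = λ u v → subst₂ (λ x y → x ~ y ⇔ to (pos perm u) H.~ to (pos perm v))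
                            (lookup-pos perm u) (lookup-pos perm v) (adj-all (pos perm u) (pos perm v)) }
    where
    module H = SimpleGraph H
    uus : Unique us
    uus = Unique-resp-↭ perm (allFin⁺ n)
    adj-all : ∀ i j → lookup us i ~ lookup us j ⇔ to i H.~ to j
    adj-all i j with Fin.<-cmp i j
    ... | tri< i<j _ _  = adj i j i<j
    ... | tri≈ _ refl _ = neither (~-irr refl) (H.~-irr refl)
    ... | tri> _ _ j<i  = mk⇔ (λ e → H.~-sym (to′ (~-sym e))) (λ e → ~-sym (from′ (H.~-sym e)))
      where open Equivalence (adj j i j<i) renaming (to to to′; from to from′)

  module _ (b : Bowtie (allFin n)) where
    open Bowtie b

    private
      us : List (Fin n)
      us = p ∷ q ∷ p′ ∷ q′ ∷ c ∷ R

      uus : Unique us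
      uus = Unique-resp-↭ perm (allFin⁺ n)

      two-only : ∀ {v x y} → dg (allFin n) v ≤ 2 → v ~ x → v ~ y → x ≢ y → ∀ {u} → v ~ u → u ≡ x ⊎ u ≡ y
      two-only {v} {x} {y} dv v~x v~y x≢y {u} v~u with u Fin.≟ x | u Fin.≟ y
      ... | yes u≡x | _       = inj₁ u≡x
      ... | no _    | yes u≡y = inj₂ u≡y
      ... | no u≢x  | no u≢y  = contradiction
        (dg-≥ {allFin n} (u ∷ x ∷ y ∷ []) ((u≢x ∷ u≢y ∷ []) ∷ (x≢y ∷ []) ∷ [] ∷ []) (λ {z} _ → ∈-allFin z)
          (λ { 1st → v~u ; 2nd → v~x ; 3rd → v~y }))
        (<⇒≱ (s≤s dv))

      at : ∀ {i} k → lookup us i ≡ lookup us k → i ≡ k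
      at _ = lookup-injective uus

      not-p : ∀ i → i ≢ 1F → i ≢ 4F → ¬ p ~ lookup us i
      not-p i ≢q ≢c p~ = [ ≢q ∘ at 1F , ≢c ∘ at 4F ]′ (two-only dp pq pc (~⇒≢ qc) p~)
      not-q : ∀ i → i ≢ 0F → i ≢ 4F → ¬ q ~ lookup us i
      not-q i ≢p ≢c q~ = [ ≢p ∘ at 0F , ≢c ∘ at 4F ]′ (two-only dq (~-sym pq) qc (~⇒≢ pc) q~)
      not-p′ : ∀ i → i ≢ 3F → i ≢ 4F → ¬ p′ ~ lookup us i
      not-p′ i ≢q ≢c p~ = [ ≢q ∘ at 3F , ≢c ∘ at 4F ]′ (two-only dp′ pq′ pc′ (~⇒≢ qc′) p~)
      not-q′ : ∀ i → i ≢ 2F → i ≢ 4F → ¬ q′ ~ lookup us i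
      not-q′ i ≢p ≢c q~ = [ ≢p ∘ at 2F , ≢c ∘ at 4F ]′ (two-only dq′ (~-sym pq′) qc′ (~⇒≢ pc′) q~)

    ≅G₁ : ThirdTriangle b → G ≅ G₁
    ≅G₁ (r , s , refl , rs , rc , sc) = numbered G₁ perm to from to-from from-to adj
      where
      to : Fin 7 → Fin 1 ⊎ (Fin 3 × Fin 2)
      to 0F = inj₂ (0F , 0F)
      to 1F = inj₂ (0F , 1F)
      to 2F = inj₂ (1F , 0F)
      to 3F = inj₂ (1F , 1F)
      to 4F = inj₁ 0F
      to 5F = inj₂ (2F , 0F)
      to 6F = inj₂ (2F , 1F)
      from : Fin 1 ⊎ (Fin 3 × Fin 2) → Fin 7
      from (inj₁ 0F)        = 4F
      from (inj₂ (0F , 0F)) = 0F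
      from (inj₂ (0F , 1F)) = 1F
      from (inj₂ (1F , 0F)) = 2F
      from (inj₂ (1F , 1F)) = 3F
      from (inj₂ (2F , 0F)) = 5F
      from (inj₂ (2F , 1F)) = 6F
      to-from : ∀ w → to (from w) ≡ w
      to-from (inj₁ 0F)        = refl
      to-from (inj₂ (0F , 0F)) = refl
      to-from (inj₂ (0F , 1F)) = refl
      to-from (inj₂ (1F , 0F)) = refl
      to-from (inj₂ (1F , 1F)) = refl
      to-from (inj₂ (2F , 0F)) = refl
      to-from (inj₂ (2F , 1F)) = refl
      from-to : ∀ i → from (to i) ≡ i
      from-to 0F = refl
      from-to 1F = refl
      from-to 2F = refl
      from-to 3F = refl
      from-to 4F = refl
      from-to 5F = refl
      from-to 6F = refl
      Adj : Fin 7 → Fin 7 → Set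
      Adj i j = lookup us i ~ lookup us j ⇔ SimpleGraph._~_ G₁ (to i) (to j)
      adj : ∀ i j → i Fin.< j → Adj i j
      adj 0F 1F _ = both pq (refl , λ ())
      adj 0F 2F _ = neither (not-p 2F (λ ()) λ ()) λ ()
      adj 0F 3F _ = neither (not-p 3F (λ ()) λ ()) λ ()
      adj 0F 4F _ = both pc tt
      adj 0F 5F _ = neither (not-p 5F (λ ()) λ ()) λ ()
      adj 0F 6F _ = neither (not-p 6F (λ ()) λ ()) λ ()
      adj 1F 2F _ = neither (not-q 2F (λ ()) λ ()) λ ()
      adj 1F 3F _ = neither (not-q 3F (λ ()) λ ()) λ ()
      adj 1F 4F _ = both qc tt
      adj 1F 5F _ = neither (not-q 5F (λ ()) λ ()) λ ()
      adj 1F 6F _ = neither (not-q 6F (λ ()) λ ()) λ ()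
      adj 2F 3F _ = both pq′ (refl , λ ())
      adj 2F 4F _ = both pc′ tt
      adj 2F 5F _ = neither (not-p′ 5F (λ ()) λ ()) λ ()
      adj 2F 6F _ = neither (not-p′ 6F (λ ()) λ ()) λ ()
      adj 3F 4F _ = both qc′ tt
      adj 3F 5F _ = neither (not-q′ 5F (λ ()) λ ()) λ ()
      adj 3F 6F _ = neither (not-q′ 6F (λ ()) λ ()) λ ()
      adj 4F 5F _ = both (~-sym rc) tt
      adj 4F 6F _ = both (~-sym sc) tt
      adj 5F 6F _ = both rs (refl , λ ())
      adj (suc i) 1F (s≤s ())
      adj (suc (suc i)) 2F (s≤s (s≤s ()))
      adj (suc (suc (suc i))) 3F (s≤s (s≤s (s≤s ())))
      adj (suc (suc (suc (suc i)))) 4F (s≤s (s≤s (s≤s (s≤s ()))))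
      adj (5+ i) 5F (s≤s (s≤s (s≤s (s≤s (s≤s ())))))
      adj (suc (5+ i)) 6F (s≤s (s≤s (s≤s (s≤s (s≤s (s≤s ()))))))

    ≅Gₙ : Bridge b → ∃[ a ] G ≅ Gₙ n a
    ≅Gₙ (r₀ , r₀∈ , c~r₀ , only , complete , _) = a , numbered H perm to from to-from from-to adj
      where
      len : length R ≡ n ∸ 5
      len = cong (_∸ 5) (≡.trans (sym (↭-length perm)) (length-tabulate {n = n} (λ i → i)))
      there-cast : Fin (length R) → Fin (n ∸ 5)
      there-cast = Fin.cast len
      back-cast : Fin (n ∸ 5) → Fin (length R)
      back-cast = Fin.cast (sym len)
      a : Fin (n ∸ 5)
      a = there-cast (index r₀∈)
      H : SimpleGraph (Fin (n ∸ 5) ⊎ (Fin 1 ⊎ (Fin 2 × Fin 2)))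
      H = Gₙ n a
      to : Fin (length us) → Fin (n ∸ 5) ⊎ (Fin 1 ⊎ (Fin 2 × Fin 2))
      to 0F = inj₂ (inj₂ (0F , 0F))
      to 1F = inj₂ (inj₂ (0F , 1F))
      to 2F = inj₂ (inj₂ (1F , 0F))
      to 3F = inj₂ (inj₂ (1F , 1F))
      to 4F = inj₂ (inj₁ 0F)
      to (5+ i) = inj₁ (there-cast i)
      from : Fin (n ∸ 5) ⊎ (Fin 1 ⊎ (Fin 2 × Fin 2)) → Fin (length us)
      from (inj₁ i)                = 5+ back-cast i
      from (inj₂ (inj₁ 0F))        = 4F
      from (inj₂ (inj₂ (0F , 0F))) = 0F
      from (inj₂ (inj₂ (0F , 1F))) = 1F
      from (inj₂ (inj₂ (1F , 0F))) = 2F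
      from (inj₂ (inj₂ (1F , 1F))) = 3F
      to-from : ∀ w → to (from w) ≡ w
      to-from (inj₁ i)                = cong inj₁ (Fin.cast-involutive len (sym len) i)
      to-from (inj₂ (inj₁ 0F))        = refl
      to-from (inj₂ (inj₂ (0F , 0F))) = refl
      to-from (inj₂ (inj₂ (0F , 1F))) = refl
      to-from (inj₂ (inj₂ (1F , 0F))) = refl
      to-from (inj₂ (inj₂ (1F , 1F))) = refl
      from-to : ∀ i → from (to i) ≡ i
      from-to 0F = refl
      from-to 1F = refl
      from-to 2F = refl
      from-to 3F = refl
      from-to 4F = refl
      from-to (5+ i) = cong (λ j → 5+ j) (Fin.cast-involutive (sym len) len i)

      uR : Unique R
      uR = ++-Uniqueʳ (p ∷ q ∷ p′ ∷ q′ ∷ c ∷ []) uus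
      cast-injective : ∀ {i j} → there-cast i ≡ there-cast j → i ≡ j
      cast-injective {i} {j} eq = ≡.trans (sym (Fin.cast-involutive (sym len) len i)) (≡.trans (cong back-cast eq) (Fin.cast-involutive (sym len) len j))

      Adj : Fin (length us) → Fin (length us) → Set
      Adj i j = lookup us i ~ lookup us j ⇔ SimpleGraph._~_ H (to i) (to j)

      bridge-adj : ∀ i → c ~ lookup R i ⇔ (there-cast i ≡ a × inj₁ 0F ≡ inj₁ {B = Fin 2 × Fin 2} 0F)
      bridge-adj i = mk⇔
        (λ c~r → cong there-cast (lookup-injective uR (≡.trans (only (∈-lookup i) c~r) (lookup-index r₀∈))) , refl)
        (λ (eq , _) → subst (c ~_) (≡.trans (lookup-index r₀∈) (cong (lookup R) (sym (cast-injective eq)))) c~r₀)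
      clique-adj : ∀ i j → lookup R i ~ lookup R j ⇔ there-cast i ≢ there-cast j
      clique-adj i j = mk⇔ (λ e eq → ~⇒≢ e (cong (lookup R) (cast-injective eq)))
        (λ ne → complete (∈-lookup i) (∈-lookup j) λ eq → ne (cong there-cast (lookup-injective uR eq)))

      adj : ∀ i j → i Fin.< j → Adj i j
      adj 0F 1F _ = both pq (refl , λ ())
      adj 0F 2F _ = neither (not-p 2F (λ ()) λ ()) λ ()
      adj 0F 3F _ = neither (not-p 3F (λ ()) λ ()) λ ()
      adj 0F 4F _ = both pc tt
      adj 0F (5+ i) _ = neither (not-p (5+ i) (λ ()) λ ()) λ ()
      adj 1F 2F _ = neither (not-q 2F (λ ()) λ ()) λ ()
      adj 1F 3F _ = neither (not-q 3F (λ ()) λ ()) λ ()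
      adj 1F 4F _ = both qc tt
      adj 1F (5+ i) _ = neither (not-q (5+ i) (λ ()) λ ()) λ ()
      adj 2F 3F _ = both pq′ (refl , λ ())
      adj 2F 4F _ = both pc′ tt
      adj 2F (5+ i) _ = neither (not-p′ (5+ i) (λ ()) λ ()) λ ()
      adj 3F 4F _ = both qc′ tt
      adj 3F (5+ i) _ = neither (not-q′ (5+ i) (λ ()) λ ()) λ ()
      adj 4F (5+ i) _ = bridge-adj i
      adj (5+ i) (5+ j) _ = clique-adj i j
      adj (suc i) 1F (s≤s ())
      adj (suc (suc i)) 2F (s≤s (s≤s ()))
      adj (suc (suc (suc i))) 3F (s≤s (s≤s (s≤s ())))
      adj (suc (suc (suc (suc i)))) 4F (s≤s (s≤s (s≤s (s≤s ()))))

  Connected⇒Conn : Connected G → Conn (allFin n)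
  Connected⇒Conn cn X {a} {b} _ a∈X _ b∉X = cross (cn a b) a∈X b∉X
    where
    cross : ∀ {u v} → Walk G u v → u ∈ X → v ∉ X →
            ∃[ x ] ∃[ y ] x ∈ allFin n × y ∈ allFin n × x ∈ X × y ∉ X × x ~ y
    cross ε u∈ v∉ = contradiction u∈ v∉
    cross {u} (_◅_ {j = w} u~w p) u∈ v∉ with w ∈? X
    ... | yes w∈ = cross p w∈ v∉
    ... | no w∉  = u , w , ∈-allFin u , ∈-allFin w , u∈ , w∉ , u~w

  edgeCount-≤ : edgeCount G ≤ e (allFin n)
  edgeCount-≤ = go (allFin n) (tabulate⁺-< (λ i<j → i<j)) (λ _ _ _ → ∈-allFin _)
    where
    P? = λ ((u , v) : Fin n × Fin n) → (u Fin.<? v) ×-dec (u ~? v)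

    count : List (Fin n) → ℕ
    count xs = length (filter P? (cartesianProduct xs (allFin n)))

    -- The last hypothesis says that `xs` is a final segment of the ordered vertices. The pairs
    -- counted at its head `x` then have their larger endpoint in the tail, which is where `e`
    -- counts them.
    go : ∀ xs → AllPairs Fin._<_ xs → (∀ {x y} → x ∈ xs → y ∈ allFin n → x Fin.< y → y ∈ xs) → count xs ≤ e xs
    go []       _           _  = z≤n
    go (x ∷ xs) (x< ∷ sorted) up = begin
      count (x ∷ xs)
        ≡⟨ cong length (filter-++ P? (map (x ,_) (allFin n)) (cartesianProduct xs (allFin n))) ⟩
      length (filter P? (map (x ,_) (allFin n)) ++ filter P? (cartesianProduct xs (allFin n)))
        ≡⟨ length-++ (filter P? (map (x ,_) (allFin n))) ⟩
      length (filter P? (map (x ,_) (allFin n))) + count xs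
        ≡⟨ cong (_+ count xs) (length-filter-map P? (x ,_) (allFin n)) ⟩
      length (filter (λ y → P? (x , y)) (allFin n)) + count xs
        ≤⟨ +-mono-≤ (Unique-⊆-length (Unique-filter⁺ (λ y → P? (x , y)) (allFin⁺ n)) later) (go xs sorted up′) ⟩
      dg xs x + e xs ∎
      where
      open ≤-Reasoning
      later : filter (λ y → P? (x , y)) (allFin n) ⊆ filter (x ~?_) xs
      later {y} y∈ with y∈L , x<y , x~y ← ∈-filter⁻ (λ y → P? (x , y)) {xs = allFin n} y∈ =
        ∈-filter⁺ (x ~?_) (∈-tail (up 1st y∈L x<y) (~⇒≢ x~y ∘ sym)) x~y
      up′ : ∀ {x′ y} → x′ ∈ xs → y ∈ allFin n → x′ Fin.< y → y ∈ xs
      up′ x′∈ y∈ x′<y = ∈-tail (up (there x′∈) y∈ x′<y) λ { refl → Fin.<-asym (All.lookup x< x′∈) x′<y }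

theorem3p4 : (n : ℕ) → n ≥ 6 →
    (G : SimpleGraph (Fin n)) →
    Connected G →
    HasMinDegree G 2 →
    edgeCount G ≥ ((n ∸ 5) C 2) + 7 →
    ¬ (G ≅ G₁) →
    ¬ (∃[ a ] G ≅ Gₙ n a) →
    ∃[ k ] (IsProperConnectionNumber G k × k ≤ 2)
theorem3p4 (suc (suc m)) n≥6 G connected (deg , _) edges ≇G₁ ≇Gₙ =
  pc≤2 {0F} {1F} (λ ()) (PC⇒connectable (connectable (7 ≤? suc (suc m))))
  where
  n = suc (suc m)
  open ProperConnection G using (pc≤2; PC⇒connectable)
  open Isomorphism G
  open Graphs (Fin._≟_ {n}) G using (PC; PC-small; structure)

  len : length (allFin n) ≡ n
  len = length-tabulate {n = n} (λ i → i)

  connectable : Dec (7 ≤ n) → PC (allFin n)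
  connectable (no n<7) = PC-small (allFin⁺ n) (Connected⇒Conn connected) (∈-allFin 0F) (λ {v} _ → deg v)
    (≤-trans (≤-reflexive len) (≤-pred (≰⇒> n<7)))
  connectable (yes n≥7) with structure record
    { uniq = allFin⁺ n ; conn = Connected⇒Conn connected ; deg = λ {v} _ → deg v
    ; size = ≤-trans n≥7 (≤-reflexive (sym len))
    ; edges = ≤-trans (≤-reflexive (≡.trans (cong threshold len) (cong (_+ 7) (sym (nC2≡tri (n ∸ 5)))))) (≤-trans edges edgeCount-≤) }
  ... | inj₁ pc              = pc
  ... | inj₂ (b , inj₁ third) = contradiction (≅G₁ b third) ≇G₁
  ... | inj₂ (b , inj₂ bridge) = contradiction (≅Gₙ b bridge) ≇Gₙ
theorem3p4 (suc zero) (s≤s ())
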